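{- Let $\mathcal{P}_1$ be a set of $m$ points on a curve $\gamma$ of fixed degree $r$ in $\mathbb{R}^2$, and let $\mathcal{P}_2$ be a set of $n$ points in $\mathbb{R}^2$. Then $$D(\mathcal{P}_1,\mathcal{P}_2)=\begin{cases}\Omega\left(m^{1/2}n^{1/2}\log^{ -1/2}n\right), & \text{when } m=\Omega\left(n^{1/2}\log^{ -1/3}n\right),\\ \Omega\left(m^{1/3}n^{1/2}\right), & \text{when } m=O\left(n^{1/2}\log^{ -1/3}n\right).\end{cases}$$
   Context: For finite sets $\mathcal{P}_1,\mathcal{P}_2\subset\mathbb{R}^2$, $D(\mathcal{P}_1,\mathcal{P}_2)$ denotes the number of distinct distances between the two sets, i.e. the number of distinct values of the Euclidean distance $|ab|$ with $a\in\mathcal{P}_1$ and $b\in\mathcal{P}_2$. A curve of degree $r$ in $\mathbb{R}^2$ is a real algebraic curve $V(f)=\{p\in\mathbb{R}^2: f(p)=0\}$ with $f\in\mathbb{R}[x,y]$ of degree $r$; it may be reducible. The set $\mathcal{P}_2$ is arbitrary. The degree $r$ is fixed (it does not vary with $m$ and $n$), and the constants implied by the asymptotic notation $\Omega(\cdot)$ and $O(\cdot)$ may depend on $r$. Notation such as $\log^{ -1/2}n$ means $(\log n)^{ -1/2}$.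
   Formalization: The formal theorem assumes m ≥ 2 and n ≥ 2: for m = 1 the second case fails (n points on a circle about the single point of P₁ give D = 1), and for n = 1 the negative powers of log n are undefined. -}

module Defs where

open import Algebra.Bundles using (CommutativeRing)
open import Axiom.ExcludedMiddle using (ExcludedMiddle)
open import Data.Fin.Base using (toℕ)
open import Data.List.Base using (List; []; _∷_; foldr; length; deduplicate; cartesianProductWith)
open import Data.Nat.Base as ℕ using (ℕ; zero; suc; _!)
open import Data.Product.Base using (_×_; _,_; ∃; ∃-syntax)
open import Data.Product.Relation.Binary.Pointwise.NonDependent using (×-setoid)
open import Level using (0ℓ) renaming (suc to lsuc)
open import Relation.Binary.Bundles using (Setoid)
import Relation.Binary.Construct.StrictToNonStrict as ToNonStrict
open import Relation.Binary.Core using (Rel)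
open import Relation.Binary.PropositionalEquality.Core using (_≡_)
open import Relation.Binary.Structures using (IsStrictTotalOrder)
open import Relation.Nullary using (yes; no)
open import Relation.Unary using (Pred)

-- The real numbers, axiomatised as a Dedekind-complete ordered field.  These
-- axioms determine ℝ up to isomorphism.
record RealField : Set (lsuc 0ℓ) where
  infix 4 _<_
  field
    commutativeRing : CommutativeRing 0ℓ 0ℓ

  open CommutativeRing commutativeRing public

  field
    _<_                : Rel Carrier 0ℓ
    isStrictTotalOrder : IsStrictTotalOrder _≈_ _<_
    0≉1                : 0# ≉ 1#
    inverse            : ∀ x → x ≉ 0# → ∃[ y ] x * y ≈ 1#
    +-monoʳ-<          : ∀ x {y z} → y < z → x + y < x + z
    *-pos              : ∀ {x y} → 0# < x → 0# < y → 0# < x * y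

  open IsStrictTotalOrder isStrictTotalOrder public using (_≟_)
  open ToNonStrict _≈_ _<_ public using (_≤_)

  UpperBound : Pred Carrier 0ℓ → Pred Carrier 0ℓ
  UpperBound P u = ∀ x → P x → x ≤ u

  field
    supremum : ∀ (P : Pred Carrier 0ℓ) → ∃ P → ∃ (UpperBound P) →
               ∃[ s ] UpperBound P s × (∀ u → UpperBound P u → s ≤ u)

module RealPlane (em : ExcludedMiddle 0ℓ) (ℝ : RealField) where
  open RealField ℝ public
  open import Algebra.Properties.Semiring.Exp semiring public using (_^_)
  open import Algebra.Properties.Semiring.Mult semiring public
    using () renaming (_×_ to _·_)
  open import Algebra.Properties.Monoid.Sum +-monoid using (sum-syntax)

  fromℕ : ℕ → Carrier
  fromℕ n = n · 1#

  -- Definite description: it is only meaningful when the real satisfying P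
  -- exists and is unique up to _≈_; otherwise the value is a junk value.
  the : Pred Carrier 0ℓ → Carrier
  the P with em {P = ∃ P}
  ... | yes (x , _) = x
  ... | no  _       = 0#

  -- Meaningful for x ≉ 0.
  infix 9 _⁻¹
  _⁻¹ : Carrier → Carrier
  x ⁻¹ = the λ y → x * y ≈ 1#

  -- Meaningful for q ≥ 1 and x ≥ 0: the nonnegative q-th root, x^(1/q).
  root : ℕ → Carrier → Carrier
  root q x = the λ y → 0# ≤ y × y ^ q ≈ x

  HasSum : (ℕ → Carrier) → Carrier → Set
  HasSum a s = ∀ ε → 0# < ε → ∃[ N ] ∀ M → N ℕ.≤ M →
    (s - ε < ∑[ k < M ] a (toℕ k)) × (∑[ k < M ] a (toℕ k) < s + ε)

  -- Natural logarithm, meaningful for x > 0: the y with Σ yᵏ/k! = x.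
  log : Carrier → Carrier
  log x = the λ y → HasSum (λ k → y ^ k * fromℕ (k !) ⁻¹) x

  Point : Set
  Point = Carrier × Carrier

  pointSetoid : Setoid 0ℓ 0ℓ
  pointSetoid = ×-setoid setoid setoid

  open import Data.List.Relation.Unary.Unique.Setoid pointSetoid public
    using (Unique)

  dist : Point → Point → Carrier
  dist (x₁ , y₁) (x₂ , y₂) = root 2 ((x₁ - x₂) ^ 2 + (y₁ - y₂) ^ 2)

  D : List Point → List Point → ℕ
  D P₁ P₂ = length (deduplicate _≟_ (cartesianProductWith dist P₁ P₂))

  -- ℝ[x,y] as ℝ[x][y]: the i-th entry of the j-th list is the coefficient of
  -- xⁱyʲ, absent entries being zero.
  Polynomial : Set
  Polynomial = List (List Carrier)

  nth : {A : Set} → A → List A → ℕ → A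
  nth d []       _       = d
  nth d (a ∷ _)  zero    = a
  nth d (_ ∷ as) (suc i) = nth d as i

  coeff : Polynomial → ℕ → ℕ → Carrier
  coeff f i j = nth 0# (nth [] f j) i

  eval : Polynomial → Point → Carrier
  eval f (x , y) =
    foldr (λ g acc → foldr (λ a acc′ → a + x * acc′) 0# g + y * acc) 0# f

  -- Total degree exactly r; in particular f is not the zero polynomial.
  HasDegree : Polynomial → ℕ → Set
  HasDegree f r =
    (∀ i j → r ℕ.< i ℕ.+ j → coeff f i j ≈ 0#) ×
    (∃[ i ] ∃[ j ] i ℕ.+ j ≡ r × coeff f i j ≉ 0#)

  V : Polynomial → Pred Point 0ℓ
  V f p = eval f p ≈ 0#

{-# OPTIONS --safe #-}
-- The squared distance from a fixed point p to a point moving along the curve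
-- crosses a given level boundedly often.  Indeed, a branch of the curve is the
-- set of its points with a given Thom code (the signs of all the derivatives
-- ∂ʲf/∂yʲ); at each x it has at most one point, and Thom's lemma reads off the
-- position of that point with respect to the two points b ± √s(x) of a circle
-- from the Thom codes at these points.  A polynomial takes values U ± V √s at
-- b ± √s(x), whose signs are determined by those of the polynomials U, V,
-- U² - V² s and s in x, hence change boundedly often.
--
-- Order the points of a branch by x, and replace each distance by its rank among
-- the D distances.  By the above the ranks of the distances to p vary by O(D) in
-- total, so for w = O(D / m) most pairs of consecutive points have ranks that
-- differ by less than w.  Each of the m - 1 pairs of consecutive points is close
-- in this sense for O(D w) points p, since two circles meet at most twice.  Hence
-- n = O(D w), which gives m n = O(D²).  If D is not of order at least m, three
-- consecutive points are equidistant from p, and from q, for two points p and q,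
-- which is impossible.
--
-- The bound √(m n) = O(D) implies both claims, as log n is bounded below for
-- n ≥ 2 and m^(1/3) ≤ m^(1/2).
module Submission where

open import Defs
open import Algebra.Bundles using (CommutativeRing)
import Algebra.Properties.Monoid.Sum as MonoidSum
import Algebra.Properties.Ring as RingProperties
import Algebra.Properties.Semiring.Mult as SemiringMult
import Algebra.Properties.Semiring.Mult.TCOptimised as Multiples
import Algebra.Solver.Ring as RingSolver
open import Algebra.Solver.Ring.AlmostCommutativeRing using (fromCommutativeRing; _-Raw-AlmostCommutative⟶_)
open import Axiom.ExcludedMiddle using (ExcludedMiddle)
open import Data.Empty using (⊥)
open import Data.Fin.Base using (toℕ)
open import Data.Integer.Base as ℤ using (ℤ; +_; -[1+_])
import Data.Integer.Properties as ℤ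
open import Data.List.Base using (List; []; _∷_; length; map; filter; _++_; foldr; take; cartesianProductWith;
    deduplicate)
open import Data.List.Membership.Propositional using (_∈_)
import Data.List.Membership.Propositional.Properties as ∈
import Data.List.Properties as List
open import Data.List.Relation.Unary.All as All using (All; []; _∷_)
import Data.List.Relation.Unary.All.Properties as All
open import Data.List.Relation.Unary.AllPairs as AllPairs using (AllPairs; []; _∷_)
import Data.List.Relation.Unary.AllPairs.Properties as AllPairs
open import Data.List.Relation.Unary.Any as Any using (Any; here; there)
import Data.List.Relation.Unary.Any.Properties as Any
open import Data.List.Relation.Unary.Linked as Linked using (Linked; []; [-]; _∷_)
import Data.List.Relation.Unary.Linked.Properties as Linked
open import Data.Maybe.Base using (Maybe; just; nothing)
open import Data.Nat.Base as ℕ using (ℕ; zero; suc; z≤n; s≤s; _!)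
open import Data.Nat.DivMod using (_/_; _%_; m/n*n≤m; m≡m%n+[m/n]*n; m%n<n)
open import Data.Nat.ListAction using (sum)
import Data.Nat.Properties as ℕ
open import Data.Nat.Solver using (module +-*-Solver)
open import Data.Product.Base as Product using (_×_; _,_; ∃; ∃-syntax; proj₁; proj₂)
open import Data.Sum.Base as Sum using (_⊎_; inj₁; inj₂; [_,_]′)
open import Level using (0ℓ)
open import Relation.Binary.Bundles using (StrictTotalOrder)
open import Relation.Binary.Core using (Rel)
open import Relation.Binary.Definitions using (DecidableEquality; Tri; tri<; tri≈; tri>)
import Relation.Binary.Properties.StrictTotalOrder as StrictTotalOrderProperties
import Relation.Binary.PropositionalEquality as ≡
import Relation.Binary.Reasoning.Setoid as SetoidReasoning
import Relation.Binary.Reasoning.StrictPartialOrder as StrictPartialOrderReasoning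
open import Relation.Binary.Structures using (IsStrictTotalOrder)
open import Relation.Nullary using (¬_; Dec; yes; no; contradiction)
open import Relation.Nullary.Decidable using (¬?)
open import Relation.Unary using (Pred; Decidable)
open ≡ using (_≡_)

-- The curve may be reducible and may contain vertical lines, or circles about points of the second
-- set; a count of intersection points by Bézout's theorem would meet these as exceptions. Two
-- choices avoid this. What is followed along a branch is membership of a closed disk and not
-- intersection with its boundary, so an arc of a circle about p is treated like any other. And a
-- branch is a class of points with equal Thom code; there are 3^(r+1) codes, so one class holds a
-- fixed fraction of the points, whatever the components are. The code that is entirely zero
-- remains: a point with this code has its whole vertical line on the curve, such lines lie over the
-- roots of one nonzero coefficient, and each of them is ordered by y.
--
-- Ranks replace distances because only the number of the distances is controlled and not their
-- spacing. A window w has to be at least 1 even to admit equal ranks, so e w = O(T), with e steps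
-- and total variation T, requires e = O(T); this is what the argument with three equidistant points
-- supplies.

-- Ring identities with integer coefficients

module IntegerCoefficients {c ℓ} (R : CommutativeRing c ℓ) where
  open CommutativeRing R
  open Multiples semiring using (1+×; ×-homo-+; ×1-homo-*) renaming (_×_ to _×′_)
  open RingProperties ring using (-‿involutive; -‿distribˡ-*; -‿distribʳ-*; -0#≈0#; -‿+-comm)
  open SetoidReasoning setoid

  ⟦_⟧ᶻ : ℤ → Carrier
  ⟦ + n ⟧ᶻ      = n ×′ 1#
  ⟦ -[1+ n ] ⟧ᶻ = - (suc n ×′ 1#)

  ⟦⟧-neg : ∀ i → ⟦ ℤ.- i ⟧ᶻ ≈ - ⟦ i ⟧ᶻ
  ⟦⟧-neg (+ zero)    = sym -0#≈0#
  ⟦⟧-neg (+ suc n)   = refl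
  ⟦⟧-neg -[1+ n ]    = sym (-‿involutive _)

  cancel-suc : ∀ x y z → (x + y) - (x + z) ≈ y - z
  cancel-suc x y z = begin
    (x + y) - (x + z)      ≈⟨ +-congˡ (-‿+-comm x z) ⟨
    (x + y) + (- x - z)    ≈⟨ +-congʳ (+-comm x y) ⟩
    (y + x) + (- x - z)    ≈⟨ +-assoc _ _ _ ⟩
    y + (x + (- x - z))    ≈⟨ +-congˡ (+-assoc _ _ _) ⟨
    y + ((x - x) - z)      ≈⟨ +-congˡ (+-congʳ (-‿inverseʳ x)) ⟩
    y + (0# - z)           ≈⟨ +-congˡ (+-identityˡ _) ⟩
    y - z                  ∎

  ⟦⟧-⊖ : ∀ m n → ⟦ m ℤ.⊖ n ⟧ᶻ ≈ m ×′ 1# - n ×′ 1#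
  ⟦⟧-⊖ zero    zero    = sym (-‿inverseʳ 0#)
  ⟦⟧-⊖ zero    (suc n) = sym (+-identityˡ _)
  ⟦⟧-⊖ (suc m) zero    = sym (trans (+-congˡ -0#≈0#) (+-identityʳ _))
  ⟦⟧-⊖ (suc m) (suc n) = begin
    ⟦ suc m ℤ.⊖ suc n ⟧ᶻ          ≡⟨ ≡.cong ⟦_⟧ᶻ (ℤ.[1+m]⊖[1+n]≡m⊖n m n) ⟩
    ⟦ m ℤ.⊖ n ⟧ᶻ                  ≈⟨ ⟦⟧-⊖ m n ⟩
    m ×′ 1# - n ×′ 1#               ≈⟨ cancel-suc 1# _ _ ⟨
    (1# + m ×′ 1#) - (1# + n ×′ 1#) ≈⟨ +-cong (1+× m 1#) (-‿cong (1+× n 1#)) ⟨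
    suc m ×′ 1# - suc n ×′ 1#       ∎

  ⟦⟧-+ : ∀ i j → ⟦ i ℤ.+ j ⟧ᶻ ≈ ⟦ i ⟧ᶻ + ⟦ j ⟧ᶻ
  ⟦⟧-+ (+ m)    (+ n)    = ×-homo-+ 1# m n
  ⟦⟧-+ (+ m)    -[1+ n ] = ⟦⟧-⊖ m (suc n)
  ⟦⟧-+ -[1+ m ] (+ n)    = trans (⟦⟧-⊖ n (suc m)) (+-comm _ _)
  ⟦⟧-+ -[1+ m ] -[1+ n ] = begin
    - (suc (suc (m ℕ.+ n)) ×′ 1#)    ≡⟨ ≡.cong (λ k → - (suc k ×′ 1#)) (ℕ.+-suc m n) ⟨
    - ((suc m ℕ.+ suc n) ×′ 1#)      ≈⟨ -‿cong (×-homo-+ 1# (suc m) (suc n)) ⟩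
    - (suc m ×′ 1# + suc n ×′ 1#)     ≈⟨ -‿+-comm _ _ ⟨
    - (suc m ×′ 1#) - (suc n ×′ 1#)   ∎

  ⟦⟧-*⁺ : ∀ m j → ⟦ + m ℤ.* j ⟧ᶻ ≈ m ×′ 1# * ⟦ j ⟧ᶻ
  ⟦⟧-*⁺ m (+ n)    = trans (reflexive (≡.cong ⟦_⟧ᶻ (≡.sym (ℤ.pos-* m n)))) (×1-homo-* m n)
  ⟦⟧-*⁺ m -[1+ n ] = begin
    ⟦ + m ℤ.* (ℤ.- (+ suc n)) ⟧ᶻ   ≡⟨ ≡.cong ⟦_⟧ᶻ (ℤ.neg-distribʳ-* (+ m) (+ suc n)) ⟨
    ⟦ ℤ.- (+ m ℤ.* + suc n) ⟧ᶻ     ≈⟨ ⟦⟧-neg (+ m ℤ.* + suc n) ⟩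
    - ⟦ + m ℤ.* + suc n ⟧ᶻ         ≈⟨ -‿cong (⟦⟧-*⁺ m (+ suc n)) ⟩
    - (m ×′ 1# * (suc n ×′ 1#))      ≈⟨ -‿distribʳ-* _ _ ⟩
    m ×′ 1# * - (suc n ×′ 1#)        ∎

  ⟦⟧-* : ∀ i j → ⟦ i ℤ.* j ⟧ᶻ ≈ ⟦ i ⟧ᶻ * ⟦ j ⟧ᶻ
  ⟦⟧-* (+ m)    j = ⟦⟧-*⁺ m j
  ⟦⟧-* -[1+ m ] j = begin
    ⟦ (ℤ.- (+ suc m)) ℤ.* j ⟧ᶻ ≡⟨ ≡.cong ⟦_⟧ᶻ (ℤ.neg-distribˡ-* (+ suc m) j) ⟨
    ⟦ ℤ.- (+ suc m ℤ.* j) ⟧ᶻ   ≈⟨ ⟦⟧-neg (+ suc m ℤ.* j) ⟩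
    - ⟦ + suc m ℤ.* j ⟧ᶻ       ≈⟨ -‿cong (⟦⟧-*⁺ (suc m) j) ⟩
    - (suc m ×′ 1# * ⟦ j ⟧ᶻ)    ≈⟨ -‿distribˡ-* _ _ ⟩
    - (suc m ×′ 1#) * ⟦ j ⟧ᶻ    ∎

  -- Coefficients in ℤ have a decidable equality that computes, so the solver can normalise
  -- identities with subtraction and numerals over an abstract ring.
  morphism : ℤ.+-*-rawRing -Raw-AlmostCommutative⟶ fromCommutativeRing R
  morphism = record
    { ⟦_⟧    = ⟦_⟧ᶻ
    ; +-homo = ⟦⟧-+
    ; *-homo = ⟦⟧-*
    ; -‿homo = ⟦⟧-neg
    ; 0-homo = refl
    ; 1-homo = refl
    }

  coefficient≟ : ∀ i j → Maybe (⟦ i ⟧ᶻ ≈ ⟦ j ⟧ᶻ)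
  coefficient≟ i j with i ℤ.≟ j
  ... | yes i≡j = just (reflexive (≡.cong ⟦_⟧ᶻ i≡j))
  ... | no  _   = nothing

  open RingSolver ℤ.+-*-rawRing (fromCommutativeRing R) morphism coefficient≟ public
    using (solve; _:=_; con; _:+_; _:*_; _:-_; :-_)

-- Arithmetic and order in the real field

module OrderedField (ℝ : RealField) where
  open RealField ℝ public
  open IntegerCoefficients commutativeRing public
    using (solve; _:=_; con; _:+_; _:*_; _:-_; :-_)

  strictTotalOrder : StrictTotalOrder _ _ _
  strictTotalOrder = record { isStrictTotalOrder = isStrictTotalOrder }

  open IsStrictTotalOrder isStrictTotalOrder public
    using (compare; _<?_)
    renaming (irrefl to <-irrefl; trans to <-trans; <-respʳ-≈ to <-respʳ; <-respˡ-≈ to <-respˡ; asym to <-asym)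
  open StrictTotalOrderProperties strictTotalOrder public
    using ()
    renaming (refl to ≤-refl; trans to ≤-trans; reflexive to ≤-reflexive; total to ≤-total; antisym to ≤-antisym;
        ≤-respʳ-≈ to ≤-respʳ; ≤-respˡ-≈ to ≤-respˡ)
  open StrictTotalOrder strictTotalOrder using (strictPartialOrder)
  module ≤-Reasoning = StrictPartialOrderReasoning strictPartialOrder
  open ≤-Reasoning

  abstract
    <⇒≤ : ∀ {x y} → x < y → x ≤ y
    <⇒≤ = inj₁

    <-≤-trans : ∀ {x y z} → x < y → y ≤ z → x < z
    <-≤-trans x<y (inj₁ y<z) = <-trans x<y y<z
    <-≤-trans x<y (inj₂ y≈z) = <-respʳ y≈z x<y

    ≤-<-trans : ∀ {x y z} → x ≤ y → y < z → x < z
    ≤-<-trans (inj₁ x<y) y<z = <-trans x<y y<z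
    ≤-<-trans (inj₂ x≈y) y<z = <-respˡ (sym x≈y) y<z

    ≤⇒≯ : ∀ {x y} → x ≤ y → ¬ (y < x)
    ≤⇒≯ x≤y y<x = <-irrefl refl (≤-<-trans x≤y y<x)

    ≮⇒≥ : ∀ {x y} → ¬ (x < y) → y ≤ x
    ≮⇒≥ {x} {y} x≮y with compare x y
    ... | tri< x<y _ _ = contradiction x<y x≮y
    ... | tri≈ _ x≈y _ = inj₂ (sym x≈y)
    ... | tri> _ _ y<x = inj₁ y<x

    ≰⇒> : ∀ {x y} → ¬ (x ≤ y) → y < x
    ≰⇒> {x} {y} x≰y with compare x y
    ... | tri< x<y _ _ = contradiction (inj₁ x<y) x≰y
    ... | tri≈ _ x≈y _ = contradiction (inj₂ x≈y) x≰y
    ... | tri> _ _ y<x = y<x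

    <⇒≉ : ∀ {x y} → x < y → x ≉ y
    <⇒≉ x<y x≈y = <-irrefl x≈y x<y

    +-monoˡ-< : ∀ z {x y} → x < y → x + z < y + z
    +-monoˡ-< z {x} {y} x<y = <-respˡ (+-comm z x) (<-respʳ (+-comm z y) (+-monoʳ-< z x<y))

    +-monoʳ-≤ : ∀ z {x y} → x ≤ y → z + x ≤ z + y
    +-monoʳ-≤ z (inj₁ x<y) = inj₁ (+-monoʳ-< z x<y)
    +-monoʳ-≤ z (inj₂ x≈y) = inj₂ (+-congˡ x≈y)

    +-monoˡ-≤ : ∀ z {x y} → x ≤ y → x + z ≤ y + z
    +-monoˡ-≤ z (inj₁ x<y) = inj₁ (+-monoˡ-< z x<y)
    +-monoˡ-≤ z (inj₂ x≈y) = inj₂ (+-congʳ x≈y)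

    +-mono-≤ : ∀ {x y u v} → x ≤ y → u ≤ v → x + u ≤ y + v
    +-mono-≤ {y = y} {u = u} x≤y u≤v = ≤-trans (+-monoˡ-≤ u x≤y) (+-monoʳ-≤ y u≤v)

    +-mono-<-≤ : ∀ {x y u v} → x < y → u ≤ v → x + u < y + v
    +-mono-<-≤ {y = y} {u = u} x<y u≤v = <-≤-trans (+-monoˡ-< u x<y) (+-monoʳ-≤ y u≤v)

    x<y⇒0<y-x : ∀ {x y} → x < y → 0# < y - x
    x<y⇒0<y-x {x} x<y = <-respˡ (-‿inverseʳ x) (+-monoˡ-< (- x) x<y)

    x≤y⇒0≤y-x : ∀ {x y} → x ≤ y → 0# ≤ y - x
    x≤y⇒0≤y-x (inj₁ x<y) = inj₁ (x<y⇒0<y-x x<y)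
    x≤y⇒0≤y-x {x} (inj₂ x≈y) = inj₂ (trans (sym (-‿inverseʳ x)) (+-congʳ x≈y))

    y-x+x≈y : ∀ x y → (y - x) + x ≈ y
    y-x+x≈y = solve 2 (λ x y → (y :- x) :+ x := y) refl

    0<y-x⇒x<y : ∀ {x y} → 0# < y - x → x < y
    0<y-x⇒x<y {x} {y} 0<y-x = <-respˡ (+-identityˡ x) (<-respʳ (y-x+x≈y x y) (+-monoˡ-< x 0<y-x))

    0≤y-x⇒x≤y : ∀ {x y} → 0# ≤ y - x → x ≤ y
    0≤y-x⇒x≤y {x} {y} 0≤y-x = ≤-respˡ (+-identityˡ x) (≤-respʳ (y-x+x≈y x y) (+-monoˡ-≤ x 0≤y-x))

    x-y≈0⇒x≈y : ∀ {x y} → x - y ≈ 0# → x ≈ y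
    x-y≈0⇒x≈y {x} {y} e = trans (sym (y-x+x≈y y x)) (trans (+-congʳ e) (+-identityˡ y))

    x≈y⇒x-y≈0 : ∀ {x y} → x ≈ y → x - y ≈ 0#
    x≈y⇒x-y≈0 {x} {y} e = trans (+-congʳ e) (-‿inverseʳ y)

    -‿mono-< : ∀ {x y} → x < y → - y < - x
    -‿mono-< {x} {y} x<y = 0<y-x⇒x<y (<-respʳ (solve 2 (λ x y → y :- x := (:- x) :- (:- y)) refl x y) (x<y⇒0<y-x x<y))

    -‿mono-≤ : ∀ {x y} → x ≤ y → - y ≤ - x
    -‿mono-≤ (inj₁ x<y) = inj₁ (-‿mono-< x<y)
    -‿mono-≤ (inj₂ x≈y) = inj₂ (-‿cong (sym x≈y))

    -0≈0 : - 0# ≈ 0#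
    -0≈0 = solve 0 ((:- con (+ 0)) := con (+ 0)) refl

    x<0⇒0<-x : ∀ {x} → x < 0# → 0# < - x
    x<0⇒0<-x x<0 = <-respˡ -0≈0 (-‿mono-< x<0)

    0<x⇒-x<0 : ∀ {x} → 0# < x → - x < 0#
    0<x⇒-x<0 0<x = <-respʳ -0≈0 (-‿mono-< 0<x)

    +-pos-nonneg : ∀ {x y} → 0# < x → 0# ≤ y → 0# < x + y
    +-pos-nonneg 0<x 0≤y = <-respˡ (+-identityˡ 0#) (+-mono-<-≤ 0<x 0≤y)

    +-nonneg : ∀ {x y} → 0# ≤ x → 0# ≤ y → 0# ≤ x + y
    +-nonneg 0≤x 0≤y = ≤-respˡ (+-identityˡ 0#) (+-mono-≤ 0≤x 0≤y)

    *-nonneg : ∀ {x y} → 0# ≤ x → 0# ≤ y → 0# ≤ x * y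
    *-nonneg (inj₁ 0<x) (inj₁ 0<y) = inj₁ (*-pos 0<x 0<y)
    *-nonneg {x} {y} (inj₂ 0≈x) _ = inj₂ (sym (trans (*-congʳ (sym 0≈x)) (zeroˡ y)))
    *-nonneg {x} {y} (inj₁ _) (inj₂ 0≈y) = inj₂ (sym (trans (*-congˡ (sym 0≈y)) (zeroʳ x)))

    *-pos-neg : ∀ {x y} → 0# < x → y < 0# → x * y < 0#
    *-pos-neg {x} {y} 0<x y<0 = 0<y-x⇒x<y
      (<-respʳ (solve 2 (λ x y → x :* (:- y) := con (+ 0) :- x :* y) refl x y) (*-pos 0<x (x<0⇒0<-x y<0)))

    *-neg-pos : ∀ {x y} → x < 0# → 0# < y → x * y < 0#
    *-neg-pos {x} {y} x<0 0<y = <-respˡ (*-comm y x) (*-pos-neg 0<y x<0)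

    *-neg-neg : ∀ {x y} → x < 0# → y < 0# → 0# < x * y
    *-neg-neg {x} {y} x<0 y<0 =
      <-respʳ (solve 2 (λ x y → (:- x) :* (:- y) := x :* y) refl x y) (*-pos (x<0⇒0<-x x<0) (x<0⇒0<-x y<0))

    x*y≈0⇒x≈0⊎y≈0 : ∀ {x y} → x * y ≈ 0# → x ≈ 0# ⊎ y ≈ 0#
    x*y≈0⇒x≈0⊎y≈0 {x} {y} xy≈0 with compare x 0# | compare y 0#
    ... | tri≈ _ x≈0 _ | _            = inj₁ x≈0
    ... | tri< _ _ _   | tri≈ _ y≈0 _ = inj₂ y≈0
    ... | tri> _ _ _   | tri≈ _ y≈0 _ = inj₂ y≈0
    ... | tri< x<0 _ _ | tri< y<0 _ _ = contradiction (sym xy≈0) (<⇒≉ (*-neg-neg x<0 y<0))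
    ... | tri< x<0 _ _ | tri> _ _ 0<y = contradiction xy≈0 (<⇒≉ (*-neg-pos x<0 0<y))
    ... | tri> _ _ 0<x | tri< y<0 _ _ = contradiction xy≈0 (<⇒≉ (*-pos-neg 0<x y<0))
    ... | tri> _ _ 0<x | tri> _ _ 0<y = contradiction (sym xy≈0) (<⇒≉ (*-pos 0<x 0<y))

    *-cancelˡ-≉0 : ∀ {x y} → x ≉ 0# → x * y ≈ 0# → y ≈ 0#
    *-cancelˡ-≉0 x≉0 xy≈0 with x*y≈0⇒x≈0⊎y≈0 xy≈0
    ... | inj₁ x≈0 = contradiction x≈0 x≉0
    ... | inj₂ y≈0 = y≈0

    square-nonneg : ∀ x → 0# ≤ x * x
    square-nonneg x with compare x 0#
    ... | tri< x<0 _ _ = inj₁ (*-neg-neg x<0 x<0)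
    ... | tri≈ _ x≈0 _ = inj₂ (sym (trans (*-congʳ x≈0) (zeroˡ x)))
    ... | tri> _ _ 0<x = inj₁ (*-pos 0<x 0<x)

    0<1 : 0# < 1#
    0<1 with ≤-respʳ (*-identityˡ 1#) (square-nonneg 1#)
    ... | inj₁ 0<1 = 0<1
    ... | inj₂ 0≈1 = contradiction 0≈1 0≉1

    *-monoˡ-≤ : ∀ {x y z} → 0# ≤ z → x ≤ y → x * z ≤ y * z
    *-monoˡ-≤ {x} {y} {z} 0≤z x≤y = 0≤y-x⇒x≤y
      (≤-respʳ (solve 3 (λ x y z → (y :- x) :* z := y :* z :- x :* z) refl x y z) (*-nonneg (x≤y⇒0≤y-x x≤y) 0≤z))

    *-monoˡ-< : ∀ {x y z} → 0# < z → x < y → x * z < y * z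
    *-monoˡ-< {x} {y} {z} 0<z x<y = 0<y-x⇒x<y
      (<-respʳ (solve 3 (λ x y z → (y :- x) :* z := y :* z :- x :* z) refl x y z) (*-pos (x<y⇒0<y-x x<y) 0<z))

    *-monoʳ-≤ : ∀ {x y z} → 0# ≤ z → x ≤ y → z * x ≤ z * y
    *-monoʳ-≤ {x} {y} {z} 0≤z x≤y = ≤-respˡ (*-comm x z) (≤-respʳ (*-comm y z) (*-monoˡ-≤ 0≤z x≤y))

    *-mono-≤ : ∀ {x y u v} → 0# ≤ x → 0# ≤ v → x ≤ y → u ≤ v → x * u ≤ y * v
    *-mono-≤ 0≤x 0≤v x≤y u≤v = ≤-trans (*-monoʳ-≤ 0≤x u≤v) (*-monoˡ-≤ 0≤v x≤y)

    square-mono-< : ∀ {x y} → 0# ≤ x → x < y → x * x < y * y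
    square-mono-< {x} {y} 0≤x x<y = 0<y-x⇒x<y
      (<-respʳ (solve 2 (λ x y → (y :- x) :* (y :+ x) := y :* y :- x :* x) refl x y)
        (*-pos (x<y⇒0<y-x x<y) (+-pos-nonneg (≤-<-trans 0≤x x<y) 0≤x)))

    square-cancel-≤ : ∀ {x y} → 0# ≤ y → x * x ≤ y * y → x ≤ y
    square-cancel-≤ 0≤y x²≤y² = ≮⇒≥ (λ y<x → ≤⇒≯ x²≤y² (square-mono-< 0≤y y<x))

    positive-inverse : ∀ {x} → 0# < x → ∃[ y ] 0# < y × x * y ≈ 1#
    positive-inverse {x} 0<x with inverse x (λ x≈0 → <⇒≉ 0<x (sym x≈0))
    ... | y , xy≈1 with compare y 0#
    ... | tri> _ _ 0<y = y , 0<y , xy≈1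
    ... | tri≈ _ y≈0 _ = contradiction (trans (sym (zeroʳ x)) (trans (*-congˡ (sym y≈0)) xy≈1)) 0≉1
    ... | tri< y<0 _ _ = contradiction (<-respˡ xy≈1 (*-pos-neg 0<x y<0)) (<-asym 0<1)

    midpoint : ∀ {x y} → x < y → ∃[ z ] x < z × z < y
    midpoint {x} {y} x<y with positive-inverse (+-pos-nonneg 0<1 (<⇒≤ 0<1))
    ... | h , 0<h , 2h≈1 = x + (y - x) * h , 0<y-x⇒x<y lower , 0<y-x⇒x<y upper
      where
      gap : 0# < (y - x) * h
      gap = *-pos (x<y⇒0<y-x x<y) 0<h

      lower : 0# < (x + (y - x) * h) - x
      lower = <-respʳ (solve 2 (λ x d → d := (x :+ d) :- x) refl x ((y - x) * h)) gap

      upper : 0# < y - (x + (y - x) * h)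
      upper = <-respʳ (begin-equality
        (y - x) * h                             ≈⟨ solve 2 (λ d h →
            d :* h := d :* ((con (+ 1) :+ con (+ 1)) :* h) :- d :* h) refl (y - x) h ⟩
        (y - x) * ((1# + 1#) * h) - (y - x) * h ≈⟨ +-congʳ (trans (*-congˡ 2h≈1) (*-identityʳ _)) ⟩
        (y - x) - (y - x) * h                   ≈⟨ solve 3 (λ x y d → (y :- x) :- d := y :- (x :+ d)) refl x y
            ((y - x) * h) ⟩
        y - (x + (y - x) * h)                   ∎) gap

    positive-min : ∀ {x y} → 0# < x → 0# < y → ∃[ z ] 0# < z × z ≤ x × z ≤ y
    positive-min {x} {y} 0<x 0<y with ≤-total x y
    ... | inj₁ x≤y = x , 0<x , ≤-refl , x≤y
    ... | inj₂ y≤x = y , 0<y , y≤x , ≤-refl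

-- Signs and formal derivatives

data Sign : Set where
  neg zer pos : Sign

-- The coefficients are a parameter because both real numbers and functions of x occur; the latter
-- give the partial derivative with respect to y. The numerals of the usual formula arise by
-- repeated addition.
module Derivative {A : Set} (_⊞_ : A → A → A) (𝟘 : A) where
  addWith : List A → List A → List A
  addWith []      h       = h
  addWith (a ∷ g) []      = a ∷ g
  addWith (a ∷ g) (b ∷ h) = (a ⊞ b) ∷ addWith g h

  -- The derivative of X g, so that (X (b + X g))′ = (b + X g) + X (X g)′.
  derivX : List A → List A
  derivX []      = []
  derivX (b ∷ g) = addWith (b ∷ g) (𝟘 ∷ derivX g)

  deriv : List A → List A
  deriv []      = []
  deriv (_ ∷ g) = derivX g

  length-addWith : ∀ g h → length (addWith g h) ≡ length g ℕ.⊔ length h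
  length-addWith []      h       = ≡.refl
  length-addWith (a ∷ g) []      = ≡.refl
  length-addWith (a ∷ g) (b ∷ h) = ≡.cong suc (length-addWith g h)

  length-derivX : ∀ g → length (derivX g) ≡ length g
  length-derivX []      = ≡.refl
  length-derivX (b ∷ g) = ≡.cong suc (≡.trans (length-addWith g (derivX g))
    (≡.trans (≡.cong (length g ℕ.⊔_) (length-derivX g)) (ℕ.⊔-idem (length g))))

  length-deriv : ∀ {k} g → length g ℕ.≤ suc k → length (deriv g) ℕ.≤ k
  length-deriv []      _         = z≤n
  length-deriv (a ∷ g) (s≤s |g|≤) = ℕ.≤-trans (ℕ.≤-reflexive (length-derivX g)) |g|≤

  All-addWith : ∀ {P : Pred A 0ℓ} → (∀ {a b} → P a → P b → P (a ⊞ b)) →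
                ∀ {g h} → All P g → All P h → All P (addWith g h)
  All-addWith P-⊞ []       ph       = ph
  All-addWith P-⊞ (a ∷ pg) []       = a ∷ pg
  All-addWith P-⊞ (a ∷ pg) (b ∷ ph) = P-⊞ a b ∷ All-addWith P-⊞ pg ph

  All-derivX : ∀ {P : Pred A 0ℓ} → (∀ {a b} → P a → P b → P (a ⊞ b)) → P 𝟘 →
               ∀ {g} → All P g → All P (derivX g)
  All-derivX P-⊞ P-𝟘 []       = []
  All-derivX P-⊞ P-𝟘 (b ∷ pg) = All-addWith P-⊞ (b ∷ pg) (P-𝟘 ∷ All-derivX P-⊞ P-𝟘 pg)

  All-deriv : ∀ {P : Pred A 0ℓ} → (∀ {a b} → P a → P b → P (a ⊞ b)) → P 𝟘 →
              ∀ {g} → All P g → All P (deriv g)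
  All-deriv P-⊞ P-𝟘 []       = []
  All-deriv P-⊞ P-𝟘 (_ ∷ pg) = All-derivX P-⊞ P-𝟘 pg

-- Real polynomials in one variable: roots, continuity, constancy of sign

module UnivariatePolynomials (em : ExcludedMiddle 0ℓ) (ℝ : RealField) where
  open OrderedField ℝ public
  open Derivative _+_ 0# public
  open ≤-Reasoning

  sgn : Carrier → Sign
  sgn x with compare x 0#
  ... | tri< _ _ _ = neg
  ... | tri≈ _ _ _ = zer
  ... | tri> _ _ _ = pos

  sgn-pos : ∀ {x} → 0# < x → sgn x ≡ pos
  sgn-pos {x} 0<x with compare x 0#
  ... | tri< _ _ x≯0 = contradiction 0<x x≯0
  ... | tri≈ _ _ x≯0 = contradiction 0<x x≯0
  ... | tri> _ _ _   = ≡.refl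

  sgn-zer : ∀ {x} → x ≈ 0# → sgn x ≡ zer
  sgn-zer {x} x≈0 with compare x 0#
  ... | tri< _ x≉0 _ = contradiction x≈0 x≉0
  ... | tri≈ _ _ _   = ≡.refl
  ... | tri> _ x≉0 _ = contradiction x≈0 x≉0

  sgn-neg : ∀ {x} → x < 0# → sgn x ≡ neg
  sgn-neg {x} x<0 with compare x 0#
  ... | tri< _ _ _   = ≡.refl
  ... | tri≈ x≮0 _ _ = contradiction x<0 x≮0
  ... | tri> x≮0 _ _ = contradiction x<0 x≮0

  sgn⁻¹-pos : ∀ {x} → sgn x ≡ pos → 0# < x
  sgn⁻¹-pos {x} e with compare x 0#
  sgn⁻¹-pos () | tri< _ _ _
  sgn⁻¹-pos () | tri≈ _ _ _
  ... | tri> _ _ 0<x = 0<x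

  sgn⁻¹-zer : ∀ {x} → sgn x ≡ zer → x ≈ 0#
  sgn⁻¹-zer {x} e with compare x 0#
  sgn⁻¹-zer () | tri< _ _ _
  ... | tri≈ _ x≈0 _ = x≈0
  sgn⁻¹-zer () | tri> _ _ _

  sgn⁻¹-neg : ∀ {x} → sgn x ≡ neg → x < 0#
  sgn⁻¹-neg {x} e with compare x 0#
  ... | tri< x<0 _ _ = x<0
  sgn⁻¹-neg () | tri≈ _ _ _
  sgn⁻¹-neg () | tri> _ _ _

  sgn-cong : ∀ {x y} → x ≈ y → sgn x ≡ sgn y
  sgn-cong {x} {y} x≈y with compare x 0#
  ... | tri< x<0 _ _ = ≡.sym (sgn-neg (<-respˡ x≈y x<0))
  ... | tri≈ _ x≈0 _ = ≡.sym (sgn-zer (trans (sym x≈y) x≈0))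
  ... | tri> _ _ 0<x = ≡.sym (sgn-pos (<-respʳ x≈y 0<x))

  ev : List Carrier → Carrier → Carrier
  ev g x = foldr (λ a acc → a + x * acc) 0# g

  ev-cong : ∀ g {x y} → x ≈ y → ev g x ≈ ev g y
  ev-cong []      x≈y = refl
  ev-cong (a ∷ g) x≈y = +-congˡ (*-cong x≈y (ev-cong g x≈y))

  -- The quotient of a ∷ g by X - b does not depend on a.
  quotient : Carrier → List Carrier → List Carrier
  quotient b []      = []
  quotient b (a ∷ g) = ev (a ∷ g) b ∷ quotient b g

  length-quotient : ∀ b g → length (quotient b g) ≡ length g
  length-quotient b []      = ≡.refl
  length-quotient b (a ∷ g) = ≡.cong suc (length-quotient b g)

  -- Division with remainder by X - b. Three facts rest on it: a root splits off a linear factor, a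
  -- polynomial is continuous at b, and the sign of the derivative at b governs the growth near b.
  ev-quotient : ∀ b a g x → ev (a ∷ g) x ≈ ev (a ∷ g) b + (x - b) * ev (quotient b g) x
  ev-quotient b a []       x = solve 3 (λ a b x → a :+ x :* con (+ 0) := (a :+ b :* con (+ 0)) :+ (x :- b) :* con
      (+ 0)) refl a b x
  ev-quotient b a (a′ ∷ g) x = begin-equality
    a + x * ev (a′ ∷ g) x
      ≈⟨ +-congˡ (*-congˡ (ev-quotient b a′ g x)) ⟩
    a + x * (ev (a′ ∷ g) b + (x - b) * ev (quotient b g) x)
      ≈⟨ solve 5 (λ a b x e q → a :+ x :* (e :+ (x :- b) :* q) := (a :+ b :* e) :+ (x :- b) :* (e :+ x :* q)) refl
           a b x (ev (a′ ∷ g) b) (ev (quotient b g) x) ⟩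
    (a + b * ev (a′ ∷ g) b) + (x - b) * (ev (a′ ∷ g) b + x * ev (quotient b g) x) ∎

  AllZero : Pred (List Carrier) 0ℓ
  AllZero = All (_≈ 0#)

  ev-AllZero : ∀ {g} x → AllZero g → ev g x ≈ 0#
  ev-AllZero x []          = refl
  ev-AllZero x (a≈0 ∷ g≈0) = trans (+-cong a≈0 (trans (*-congˡ (ev-AllZero x g≈0)) (zeroʳ x))) (+-identityˡ 0#)

  quotient-AllZero : ∀ b g → AllZero (quotient b g) → AllZero g
  quotient-AllZero b []      [] = []
  quotient-AllZero b (a ∷ g) (e≈0 ∷ q≈0) = a≈0 ∷ g≈0
    where
    g≈0 = quotient-AllZero b g q≈0
    a≈0 = begin-equality
      a               ≈⟨ +-identityʳ a ⟨
      a + 0#          ≈⟨ +-congˡ (trans (*-congˡ (ev-AllZero b g≈0)) (zeroʳ b)) ⟨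
      a + b * ev g b  ≈⟨ e≈0 ⟩
      0#              ∎

  Covers : List Carrier → Pred (Pred Carrier 0ℓ) 0ℓ
  Covers B P = ∀ x → P x → Any (x ≈_) B

  Root : List Carrier → Pred Carrier 0ℓ
  Root g x = ev g x ≈ 0#

  -- Excluded middle decides whether a root is left; if so, it splits off and the nonzero quotient
  -- has one coefficient fewer.
  roots : ∀ g → ¬ AllZero g → ∃[ B ] length B ℕ.≤ length g × Covers B (Root g)
  roots g = go (length g) g ≡.refl
    where
    go : ∀ k g → length g ≡ k → ¬ AllZero g → ∃[ B ] length B ℕ.≤ k × Covers B (Root g)
    go k       []      _   g≉0 = contradiction [] g≉0
    go (suc k) (a ∷ g) len g≉0 with em {∃ (Root (a ∷ g))}
    ... | no ∄root = [] , z≤n , λ x root → contradiction (x , root) ∄root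
    ... | yes (b , b-root) with go k (quotient b g) (≡.trans (length-quotient b g) (ℕ.suc-injective len)) q≉0
      where
      q≉0 : ¬ AllZero (quotient b g)
      q≉0 q≈0 = g≉0 (trans (sym (trans (+-congˡ (trans (*-congˡ (ev-AllZero b g≈0)) (zeroʳ b))) (+-identityʳ a)))
          b-root ∷ g≈0)
        where g≈0 = quotient-AllZero b g q≈0
    ... | B , |B|≤ , covers = b ∷ B , s≤s |B|≤ , cover
      where
      cover : Covers (b ∷ B) (Root (a ∷ g))
      cover x x-root with x*y≈0⇒x≈0⊎y≈0 (trans (sym (trans (+-congʳ b-root) (+-identityˡ _)))
          (trans (sym (ev-quotient b a g x)) x-root))
      ... | inj₁ x-b≈0 = here (x-y≈0⇒x≈y x-b≈0)
      ... | inj₂ root  = there (covers x root)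

  Within : Carrier → Pred Carrier 0ℓ
  Within r x = (- r ≤ x) × (x ≤ r)

  -- No case distinction on signs: twice `r * k + x * v` and twice `r * k - x * v` are sums of two
  -- products of the nonnegative gaps r + x, r - x, k + v and k - v.
  *-within : ∀ {r k x v} → Within r x → Within k v → Within (r * k) (x * v)
  *-within {r} {k} {x} {v} (-r≤x , x≤r) (-k≤v , v≤k) = lower , upper
    where
    a = x≤y⇒0≤y-x -r≤x
    b = x≤y⇒0≤y-x x≤r
    c = x≤y⇒0≤y-x -k≤v
    d = x≤y⇒0≤y-x v≤k

    halve : ∀ {z} → 0# ≤ z + z → 0# ≤ z
    halve {z} 0≤2z with compare z 0#
    ... | tri< z<0 _ _ = contradiction (<-respʳ (+-identityˡ 0#) (+-mono-<-≤ z<0 (<⇒≤ z<0))) (≤⇒≯ 0≤2z)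
    ... | tri≈ _ z≈0 _ = inj₂ (sym z≈0)
    ... | tri> _ _ 0<z = inj₁ 0<z

    lower = 0≤y-x⇒x≤y (halve (≤-respʳ
      (solve 4 (λ r k x v → (x :- :- r) :* (v :- :- k) :+ (r :- x) :* (k :- v)
                         := (x :* v :- :- (r :* k)) :+ (x :* v :- :- (r :* k))) refl r k x v)
      (+-nonneg (*-nonneg a c) (*-nonneg b d))))

    upper = 0≤y-x⇒x≤y (halve (≤-respʳ
      (solve 4 (λ r k x v → (x :- :- r) :* (k :- v) :+ (r :- x) :* (v :- :- k)
                         := (r :* k :- x :* v) :+ (r :* k :- x :* v)) refl r k x v)
      (+-nonneg (*-nonneg a d) (*-nonneg b c))))

  +-within : ∀ {r k x v} → Within r x → Within k v → Within (r + k) (x + v)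
  +-within {r} {k} (a , b) (c , d) =
    ≤-respˡ (solve 2 (λ r k → :- r :+ :- k := :- (r :+ k)) refl r k) (+-mono-≤ a c) , +-mono-≤ b d

  within : ∀ x → ∃[ r ] 0# < r × Within r x
  within x with compare x 0#
  ... | tri< x<0 _ _ = - x , x<0⇒0<-x x<0 , inj₂ (solve 1 (λ x → :- :- x := x) refl x) ,
      <⇒≤ (<-trans x<0 (x<0⇒0<-x x<0))
  ... | tri≈ _ x≈0 _ = 1# , 0<1 , <⇒≤ (<-respʳ (sym x≈0) (0<x⇒-x<0 0<1)) , <⇒≤ (<-respˡ (sym x≈0) 0<1)
  ... | tri> _ _ 0<x = x , 0<x , <⇒≤ (<-trans (0<x⇒-x<0 0<x) 0<x) , ≤-refl

  ev-bounded : ∀ g s → ∃[ k ] 0# < k × ∀ x → Within 1# (x - s) → Within k (ev g x)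
  ev-bounded []      s = 1# , 0<1 , λ _ _ → <⇒≤ (0<x⇒-x<0 0<1) , <⇒≤ 0<1
  ev-bounded (a ∷ g) s with ev-bounded g s | within a | within s
  ... | k , 0<k , bound | r , 0<r , a-within | t , 0<t , s-within =
    r + (1# + t) * k , +-pos-nonneg 0<r (*-nonneg (<⇒≤ (+-pos-nonneg 0<1 (<⇒≤ 0<t))) (<⇒≤ 0<k)) ,
    λ x x-near → +-within a-within (*-within (x-within x x-near) (bound x x-near))
    where
    x-within : ∀ x → Within 1# (x - s) → Within (1# + t) x
    x-within x x-near with +-within x-near s-within
    ... | lower , upper = ≤-respʳ (y-x+x≈y s x) lower , ≤-respˡ (y-x+x≈y s x) upper

  Near : Carrier → Carrier → Pred Carrier 0ℓ
  Near s δ x = s - δ < x × x < s + δ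

  -- The value at x differs from the value c at s by at most δ k, where k bounds the quotient by X -
  -- s on [s - 1 , s + 1]. The midpoint of 0 and c / k, cut off at 1, serves as δ.
  ev-pos-near : ∀ g s → 0# < ev g s → ∃[ δ ] 0# < δ × ∀ x → Near s δ x → 0# < ev g x
  ev-pos-near []      s 0<0 = contradiction 0<0 (<-irrefl refl)
  ev-pos-near (a ∷ g) s 0<c with ev-bounded (quotient s g) s
  ... | k , 0<k , bound with positive-inverse 0<k
  ... | i , 0<i , ki≈1 with midpoint (*-pos 0<c 0<i)
  ... | d , 0<d , d<ci with positive-min 0<d 0<1
  ... | δ , 0<δ , δ≤d , δ≤1 = δ , 0<δ , positive
    where
    c = ev (a ∷ g) s

    δk<c : δ * k < c
    δk<c = begin-strict
      δ * k       ≤⟨ *-monoˡ-≤ (<⇒≤ 0<k) δ≤d ⟩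
      d * k       <⟨ *-monoˡ-< 0<k d<ci ⟩
      c * i * k   ≈⟨ solve 3 (λ c i k → c :* i :* k := c :* (k :* i)) refl c i k ⟩
      c * (k * i) ≈⟨ trans (*-congˡ ki≈1) (*-identityʳ c) ⟩
      c           ∎

    positive : ∀ x → Near s δ x → 0# < ev (a ∷ g) x
    positive x (s-δ<x , x<s+δ) = begin-strict
      0#                                       <⟨ x<y⇒0<y-x δk<c ⟩
      c - δ * k                                ≤⟨ +-monoʳ-≤ c (proj₁
          (*-within (<⇒≤ lower , <⇒≤ upper) (bound x near))) ⟩
      c + (x - s) * ev (quotient s g) x        ≈⟨ ev-quotient s a g x ⟨
      ev (a ∷ g) x                             ∎
      where
      lower : - δ < x - s
      lower = <-respˡ (solve 2 (λ s δ → (s :- δ) :- s := :- δ) refl s δ) (+-monoˡ-< (- s) s-δ<x)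
      upper : x - s < δ
      upper = <-respʳ (solve 2 (λ s δ → (s :+ δ) :- s := δ) refl s δ) (+-monoˡ-< (- s) x<s+δ)
      near : Within 1# (x - s)
      near = <⇒≤ (≤-<-trans (-‿mono-≤ δ≤1) lower) , <⇒≤ (<-≤-trans upper δ≤1)

  negate : List Carrier → List Carrier
  negate = map (-_)

  ev-negate : ∀ g x → ev (negate g) x ≈ - ev g x
  ev-negate []      x = sym -0≈0
  ev-negate (a ∷ g) x = trans (+-congˡ (*-congˡ (ev-negate g x)))
    (solve 3 (λ a x e → :- a :+ x :* (:- e) := :- (a :+ x :* e)) refl a x (ev g x))

  0<-x⇒x<0 : ∀ {x} → 0# < - x → x < 0#
  0<-x⇒x<0 {x} 0<-x = <-respˡ (solve 1 (λ x → :- :- x := x) refl x) (0<x⇒-x<0 0<-x)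

  opaque
    ev-neg-near : ∀ g s → ev g s < 0# → ∃[ δ ] 0# < δ × ∀ x → Near s δ x → ev g x < 0#
    ev-neg-near g s c<0 with ev-pos-near (negate g) s (<-respʳ (sym (ev-negate g s)) (x<0⇒0<-x c<0))
    ... | δ , 0<δ , positive = δ , 0<δ , λ x near → 0<-x⇒x<0 (<-respʳ (ev-negate g x) (positive x near))

  s-δ<s : ∀ {s δ} → 0# < δ → s - δ < s
  s-δ<s {s} 0<δ = <-respʳ (+-identityʳ s) (+-monoʳ-< s (0<x⇒-x<0 0<δ))

  s<s+δ : ∀ {s δ} → 0# < δ → s < s + δ
  s<s+δ {s} 0<δ = <-respˡ (+-identityʳ s) (+-monoʳ-< s 0<δ)

  opaque
    above-near : ∀ {s δ b} → 0# < δ → s < b → ∃[ x ] s < x × x < b × Near s δ x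
    above-near {s} {δ} {b} 0<δ s<b with positive-min 0<δ (x<y⇒0<y-x s<b)
    ... | e , 0<e , e≤δ , e≤b-s with midpoint 0<e
    ... | h , 0<h , h<e = s + h , s<s+δ 0<h ,
      <-≤-trans (+-monoʳ-< s h<e) (≤-respʳ (solve 2 (λ s b → s :+ (b :- s) := b) refl s b) (+-monoʳ-≤ s e≤b-s)) ,
      <-trans (s-δ<s 0<δ) (s<s+δ 0<h) ,
      +-monoʳ-< s (<-≤-trans h<e e≤δ)

  opaque
    -- The root is the supremum of the points of [a , b] with negative value. A negative value there
    -- would persist to the right of it, and a positive one would make a smaller number an upper
    -- bound.
    intermediate-value : ∀ g {a b} → a < b → ev g a < 0# → 0# < ev g b →
                         ∃[ c ] a < c × c < b × ev g c ≈ 0#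
    intermediate-value g {a} {b} a<b ga<0 0<gb with supremum P (a , ≤-refl , <⇒≤ a<b , ga<0)
        (b , λ x → λ (_ , x≤b , _) → x≤b)
      where
      P : Pred Carrier 0ℓ
      P x = a ≤ x × x ≤ b × ev g x < 0#
    ... | s , upper , least with upper a (≤-refl , <⇒≤ a<b , ga<0) | least b (λ x → λ (_ , x≤b , _) → x≤b) | compare
        (ev g s) 0#
    ... | inj₂ a≈s | _ | tri≈ _ gs≈0 _ = contradiction (trans (ev-cong g a≈s) gs≈0) (<⇒≉ ga<0)
    ... | inj₁ a<s | inj₂ s≈b | tri≈ _ gs≈0 _ = contradiction (trans (sym gs≈0) (ev-cong g s≈b)) (<⇒≉ 0<gb)
    ... | inj₁ a<s | inj₁ s<b | tri≈ _ gs≈0 _ = s , a<s , s<b , gs≈0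
    ... | _   | inj₂ s≈b | tri< gs<0 _ _ = contradiction (<-respʳ (ev-cong g (sym s≈b)) 0<gb) (<-asym gs<0)
    ... | a≤s | inj₁ s<b | tri< gs<0 _ _ with ev-neg-near g s gs<0
    ...   | δ , 0<δ , negative with above-near 0<δ s<b
    ...   | x , s<x , x<b , near = contradiction s<x (≤⇒≯ (upper x
        (≤-trans a≤s (<⇒≤ s<x) , <⇒≤ x<b , negative x near)))
    intermediate-value g {a} {b} a<b ga<0 0<gb | s , upper , least | _ | _ | tri> _ _ 0<gs with ev-pos-near g s 0<gs
    ... | δ , 0<δ , positive = contradiction (s-δ<s 0<δ) (≤⇒≯ (least (s - δ) bound))
      where
      bound : ∀ x → a ≤ x × x ≤ b × ev g x < 0# → x ≤ s - δ
      bound x p@(_ , _ , gx<0) = ≮⇒≥ λ s-δ<x →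
        <-asym gx<0 (positive x (s-δ<x , ≤-<-trans (upper x p) (s<s+δ 0<δ)))

  opaque
    opposite-signs⇒root : ∀ g {a b} → a < b → ev g a ≉ 0# → ev g b ≉ 0# → sgn (ev g a) ≡ sgn (ev g b) ⊎
                          (∃[ c ] a < c × c < b × ev g c ≈ 0#)
    opposite-signs⇒root g {a} {b} a<b ga≉0 gb≉0 with compare (ev g a) 0# | compare (ev g b) 0#
    ... | tri≈ _ e _ | _ = contradiction e ga≉0
    ... | tri< _ _ _ | tri≈ _ e _ = contradiction e gb≉0
    ... | tri> _ _ _ | tri≈ _ e _ = contradiction e gb≉0
    ... | tri< _ _ _ | tri< _ _ _ = inj₁ ≡.refl
    ... | tri> _ _ _ | tri> _ _ _ = inj₁ ≡.refl
    ... | tri< ga<0 _ _ | tri> _ _ 0<gb = inj₂ (intermediate-value g a<b ga<0 0<gb)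
    ... | tri> _ _ 0<ga | tri< gb<0 _ _ with intermediate-value (negate g) a<b
            (<-respˡ (sym (ev-negate g a)) (0<x⇒-x<0 0<ga)) (<-respʳ (sym (ev-negate g b)) (x<0⇒0<-x gb<0))
    ...   | c , a<c , c<b , e = inj₂ (c , a<c , c<b ,
              trans (solve 1 (λ x → x := :- :- x) refl (ev g c))
                  (trans (-‿cong (trans (sym (ev-negate g c)) e)) -0≈0))

  -- x and y lie in one cell of the line cut at B. As signs have three values, each point of B is a
  -- cell of its own.
  SameSide : List Carrier → Carrier → Carrier → Set
  SameSide B x y = All (λ b → sgn (x - b) ≡ sgn (y - b)) B

  SameSide-sym : ∀ {B x y} → SameSide B x y → SameSide B y x
  SameSide-sym = All.map ≡.sym

  -- Cells are intervals, and the cell of a point of B is that point alone.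
  separated : ∀ {B x y c} → SameSide B x y → Any (c ≈_) B → x ≤ c → c ≤ y → x ≈ y
  separated {x = x} {y} {c} (e ∷ _) (here {b} c≈b) x≤c c≤y with compare (x - b) 0# | compare (y - b) 0#
  separated (() ∷ _) (here c≈b) x≤c c≤y | tri< _ _ _ | tri≈ _ _ _
  separated (() ∷ _) (here c≈b) x≤c c≤y | tri< _ _ _ | tri> _ _ _
  separated (() ∷ _) (here c≈b) x≤c c≤y | tri≈ _ _ _ | tri< _ _ _
  separated (() ∷ _) (here c≈b) x≤c c≤y | tri≈ _ _ _ | tri> _ _ _
  separated (() ∷ _) (here c≈b) x≤c c≤y | tri> _ _ _ | tri< _ _ _
  separated (() ∷ _) (here c≈b) x≤c c≤y | tri> _ _ _ | tri≈ _ _ _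
  ... | tri< _ _ _ | tri< y-b<0 _ _ =
    contradiction (<-respˡ (-‿inverseʳ b) (≤-<-trans (+-monoˡ-≤ (- b) (≤-respˡ c≈b c≤y)) y-b<0)) (<-irrefl refl)
  ... | tri≈ _ e₁ _ | tri≈ _ e₂ _ = trans (x-y≈0⇒x≈y e₁) (sym (x-y≈0⇒x≈y e₂))
  ... | tri> _ _ 0<x-b | tri> _ _ _ =
    contradiction (<-respʳ (-‿inverseʳ b) (<-≤-trans 0<x-b (+-monoˡ-≤ (- b) (≤-respʳ c≈b x≤c)))) (<-irrefl refl)
  separated (_ ∷ s) (there c∈B) x≤c c≤y = separated s c∈B x≤c c≤y

  opaque
    -- The breaks are the roots: different nonzero signs within a cell would force a root between
    -- the two points. The zero polynomial, for which roots are unbounded in number, has constant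
    -- sign without breaks.
    sgn-ev-const : ∀ g → ∃[ B ] length B ℕ.≤ length g ×
                   ∀ x y → SameSide B x y → sgn (ev g x) ≡ sgn (ev g y)
    sgn-ev-const g with All.all? (_≟ 0#) g
    ... | yes g≈0 = [] , z≤n , λ x y _ → ≡.trans (sgn-zer (ev-AllZero x g≈0)) (≡.sym (sgn-zer (ev-AllZero y g≈0)))
    ... | no g≉0 with roots g g≉0
    ... | B , |B|≤ , covers = B , |B|≤ , const
      where
      ordered : ∀ {x y} → x < y → SameSide B x y → sgn (ev g x) ≡ sgn (ev g y)
      ordered {x} {y} x<y same with ev g x ≟ 0# | ev g y ≟ 0#
      ... | yes e | _     = contradiction (separated same (covers x e) ≤-refl (<⇒≤ x<y)) (<⇒≉ x<y)
      ... | no _  | yes e = contradiction (separated same (covers y e) (<⇒≤ x<y) ≤-refl) (<⇒≉ x<y)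
      ... | no gx≉0 | no gy≉0 with opposite-signs⇒root g x<y gx≉0 gy≉0
      ... | inj₁ eq = eq
      ... | inj₂ (c , x<c , c<y , root) = contradiction (separated same (covers c root) (<⇒≤ x<c) (<⇒≤ c<y)) (<⇒≉ x<y)

      const : ∀ x y → SameSide B x y → sgn (ev g x) ≡ sgn (ev g y)
      const x y same with compare x y
      ... | tri< x<y _ _ = ordered x<y same
      ... | tri≈ _ x≈y _ = sgn-cong (ev-cong g x≈y)
      ... | tri> _ _ y<x = ≡.sym (ordered y<x (SameSide-sym same))

  ev-addWith : ∀ g h x → ev (addWith g h) x ≈ ev g x + ev h x
  ev-addWith []      h       x = sym (+-identityˡ _)
  ev-addWith (a ∷ g) []      x = sym (+-identityʳ _)
  ev-addWith (a ∷ g) (b ∷ h) x = trans (+-congˡ (*-congˡ (ev-addWith g h x)))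
    (solve 5 (λ a b x e f → (a :+ b) :+ x :* (e :+ f) := (a :+ x :* e) :+ (b :+ x :* f)) refl a b x (ev g x) (ev h x))

  multiply : List Carrier → List Carrier → List Carrier
  multiply []      h = []
  multiply (a ∷ g) h = addWith (map (a *_) h) (0# ∷ multiply g h)

  ev-scale : ∀ a h x → ev (map (a *_) h) x ≈ a * ev h x
  ev-scale a []      x = sym (zeroʳ a)
  ev-scale a (b ∷ h) x = trans (+-congˡ (*-congˡ (ev-scale a h x)))
    (solve 4 (λ a b x e → a :* b :+ x :* (a :* e) := a :* (b :+ x :* e)) refl a b x (ev h x))

  ev-multiply : ∀ g h x → ev (multiply g h) x ≈ ev g x * ev h x
  ev-multiply []      h x = sym (zeroˡ _)
  ev-multiply (a ∷ g) h x = trans (ev-addWith (map (a *_) h) (0# ∷ multiply g h) x)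
    (trans (+-cong (ev-scale a h x) (+-congˡ (*-congˡ (ev-multiply g h x))))
      (solve 4 (λ a x e f → a :* f :+ (con (+ 0) :+ x :* (e :* f)) := (a :+ x :* e) :* f) refl a x (ev g x) (ev h x)))

  length-multiply : ∀ g h → length (multiply g h) ℕ.≤ length g ℕ.+ length h
  length-multiply []      h = z≤n
  length-multiply (a ∷ g) h = ℕ.≤-trans (ℕ.≤-reflexive (length-addWith (map (a *_) h) (0# ∷ multiply g h)))
    (ℕ.⊔-lub (ℕ.≤-trans (ℕ.≤-reflexive (List.length-map (a *_) h)) (ℕ.m≤n+m _ (suc (length g))))
        (s≤s (length-multiply g h)))

  -- d bounds the number of coefficients, so the degree is less than d; this form of the bound still
  -- adds up under products.
  IsPolynomial : ℕ → Pred (Carrier → Carrier) 0ℓ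
  IsPolynomial d F = ∃[ g ] length g ℕ.≤ d × ∀ x → F x ≈ ev g x

  opaque
    poly-const : ∀ c → IsPolynomial 1 (λ _ → c)
    poly-const c = c ∷ [] , ℕ.≤-refl , λ x → solve 2 (λ c x → c := c :+ x :* con (+ 0)) refl c x

  opaque
    poly-id : IsPolynomial 2 (λ x → x)
    poly-id = 0# ∷ 1# ∷ [] , ℕ.≤-refl , λ x →
      solve 1 (λ x → x := con (+ 0) :+ x :* (con (+ 1) :+ x :* con (+ 0))) refl x

  opaque
    poly-+ : ∀ {d F G} → IsPolynomial d F → IsPolynomial d G → IsPolynomial d (λ x → F x + G x)
    poly-+ (g , |g|≤ , F≈) (h , |h|≤ , G≈) = addWith g h ,
      ℕ.≤-trans (ℕ.≤-reflexive (length-addWith g h)) (ℕ.⊔-lub |g|≤ |h|≤) ,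
      λ x → trans (+-cong (F≈ x) (G≈ x)) (sym (ev-addWith g h x))

  poly-zero : ∀ {d} → IsPolynomial d (λ _ → 0#)
  poly-zero = [] , z≤n , λ _ → refl

  poly-weaken : ∀ {d e F} → d ℕ.≤ e → IsPolynomial d F → IsPolynomial e F
  poly-weaken d≤e (g , |g|≤ , F≈) = g , ℕ.≤-trans |g|≤ d≤e , F≈

  opaque
    poly-* : ∀ {d e F G} → IsPolynomial d F → IsPolynomial e G → IsPolynomial (d ℕ.+ e) (λ x → F x * G x)
    poly-* {d} {e} (g , |g|≤ , F≈) (h , |h|≤ , G≈) = multiply g h ,
      ℕ.≤-trans (length-multiply g h) (ℕ.+-mono-≤ |g|≤ |h|≤) ,
      λ x → trans (*-cong (F≈ x) (G≈ x)) (sym (ev-multiply g h x))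

  opaque
    poly-neg : ∀ {d F} → IsPolynomial d F → IsPolynomial d (λ x → - F x)
    poly-neg (g , |g|≤ , F≈) = negate g , ℕ.≤-trans (ℕ.≤-reflexive (List.length-map _ g)) |g|≤ ,
      λ x → trans (-‿cong (F≈ x)) (sym (ev-negate g x))

  opaque
    sgn-poly-const : ∀ {d F} → IsPolynomial d F → ∃[ B ] length B ℕ.≤ d ×
                     ∀ x y → SameSide B x y → sgn (F x) ≡ sgn (F y)
    sgn-poly-const (g , |g|≤ , F≈) with sgn-ev-const g
    ... | B , |B|≤ , const = B , ℕ.≤-trans |B|≤ |g|≤ ,
      λ x y same → ≡.trans (sgn-cong (F≈ x)) (≡.trans (const x y same) (≡.sym (sgn-cong (F≈ y))))

  opaque
    sqrt : ∀ x → 0# ≤ x → ∃[ y ] 0# ≤ y × y * y ≈ x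
    sqrt x (inj₂ 0≈x) = 0# , ≤-refl , trans (zeroˡ 0#) 0≈x
    -- The polynomial X² - x is negative at 0 and has the value 1 + x + x² at 1 + x.
    sqrt x (inj₁ 0<x) with intermediate-value (- x ∷ 0# ∷ 1# ∷ []) 0<1+x
        (<-respˡ (solve 1 (λ x → :- x := :- x :+ con (+ 0) :* (con (+ 0) :+ con (+ 0) :*
            (con (+ 1) :+ con (+ 0) :* con (+ 0)))) refl x) (0<x⇒-x<0 0<x))
        (<-respʳ (solve 1 (λ x → (con (+ 1) :+ x) :+ x :* x := :- x :+ (con (+ 1) :+ x) :*
            (con (+ 0) :+ (con (+ 1) :+ x) :* (con (+ 1) :+ (con (+ 1) :+ x) :* con (+ 0)))) refl x)
          (+-pos-nonneg 0<1+x (square-nonneg x)))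
      where
      0<1+x : 0# < 1# + x
      0<1+x = +-pos-nonneg 0<1 (<⇒≤ 0<x)
    ... | y , 0<y , _ , e = y , <⇒≤ 0<y , x-y≈0⇒x≈y
      (trans (solve 2 (λ x y → y :* y :- x := :- x :+ y :* (con (+ 0) :+ y :* (con (+ 1) :+ y :* con (+ 0)))) refl x
          y) e)

-- Thom codes and Thom's lemma

_≟ˢ_ : DecidableEquality Sign
neg ≟ˢ neg = yes ≡.refl
neg ≟ˢ zer = no λ ()
neg ≟ˢ pos = no λ ()
zer ≟ˢ neg = no λ ()
zer ≟ˢ zer = yes ≡.refl
zer ≟ˢ pos = no λ ()
pos ≟ˢ neg = no λ ()
pos ≟ˢ zer = no λ ()
pos ≟ˢ pos = yes ≡.refl

_≟ᶜ_ : DecidableEquality (List Sign)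
_≟ᶜ_ = List.≡-dec _≟ˢ_

_·_ : Sign → Sign → Sign
neg · neg = pos
neg · zer = zer
neg · pos = neg
zer · _   = zer
pos · t   = t

-- The sign of b - a, for a of sign s and b of sign t ≢ s.
direction : Sign → Sign → Sign
direction neg neg = zer
direction neg _   = pos
direction zer neg = neg
direction zer zer = zer
direction zer pos = pos
direction pos pos = zer
direction pos _   = neg

leading : List Sign → Sign
leading []      = zer
leading (s ∷ _) = s

-- At the highest derivative where two Thom codes differ, the next derivative
-- has a constant sign between the two points, so it tells which one is larger.
ord : List Sign → List Sign → Sign
ord (s ∷ σ) (t ∷ τ) with σ ≟ᶜ τ
... | yes _ = direction s t · leading σ
... | no _  = ord σ τ
ord _       _       = zer

module ThomCodes (em : ExcludedMiddle 0ℓ) (ℝ : RealField) where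
  open UnivariatePolynomials em ℝ public
  open ≤-Reasoning

  ev-derivX : ∀ b g x → ev (derivX (b ∷ g)) x ≈ ev (b ∷ g) x + x * ev (derivX g) x
  ev-derivX b g x = trans (ev-addWith (b ∷ g) (0# ∷ derivX g) x) (+-congˡ (+-identityˡ _))

  -- The difference quotient becomes the derivative on the diagonal: both sides satisfy the same
  -- recursion.
  ev-quotient-diagonal : ∀ g s → ev (quotient s g) s ≈ ev (derivX g) s
  ev-quotient-diagonal []      s = refl
  ev-quotient-diagonal (b ∷ g) s = trans (+-congˡ (*-congˡ (ev-quotient-diagonal g s))) (sym (ev-derivX b g s))

  IncreasingNear : List Carrier → Carrier → Carrier → Set
  IncreasingNear p s δ = ∀ x → Near s δ x → (s < x → ev p s < ev p x) × (x < s → ev p x < ev p s)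

  increasing-near : ∀ p s → 0# < ev (deriv p) s → ∃[ δ ] 0# < δ × IncreasingNear p s δ
  increasing-near []      s 0<0 = contradiction 0<0 (<-irrefl refl)
  increasing-near (a ∷ g) s 0<p′ with ev-pos-near (quotient s g) s (<-respʳ (sym (ev-quotient-diagonal g s)) 0<p′)
  ... | δ , 0<δ , positive = δ , 0<δ , λ x near → right x near , left x near
    where
    q = quotient s g

    right : ∀ x → Near s δ x → s < x → ev (a ∷ g) s < ev (a ∷ g) x
    right x near s<x = begin-strict
      ev (a ∷ g) s                   <⟨ s<s+δ (*-pos (x<y⇒0<y-x s<x) (positive x near)) ⟩
      ev (a ∷ g) s + (x - s) * ev q x ≈⟨ ev-quotient s a g x ⟨
      ev (a ∷ g) x                   ∎

    left : ∀ x → Near s δ x → x < s → ev (a ∷ g) x < ev (a ∷ g) s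
    left x near x<s = begin-strict
      ev (a ∷ g) x                   ≈⟨ ev-quotient s a g x ⟩
      ev (a ∷ g) s + (x - s) * ev q x ≈⟨ solve 4 (λ e x s q → e :+ (x :- s) :* q := e :- (s :- x) :* q) refl
          (ev (a ∷ g) s) x s (ev q x) ⟩
      ev (a ∷ g) s - (s - x) * ev q x <⟨ s-δ<s (*-pos (x<y⇒0<y-x x<s) (positive x near)) ⟩
      ev (a ∷ g) s                   ∎

  On : Carrier → Carrier → Pred (Pred Carrier 0ℓ) 0ℓ
  On a b P = ∀ t → a ≤ t → t ≤ b → P t

  opaque
    -- A supremum does the work of the mean value theorem. Let s be the supremum of the points with
    -- value at least `ev p a`. Since p increases near s, a smaller value at s would make s - δ an
    -- upper bound, and s < b would leave such points to the right of s.
    weakly-increasing : ∀ p {a b} → On a b (λ t → 0# < ev (deriv p) t) → a ≤ b → ev p a ≤ ev p b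
    weakly-increasing p {a} {b} 0<p′ a≤b with supremum P (a , ≤-refl , a≤b , ≤-refl) (b , λ x → λ (_ , x≤b , _) → x≤b)
      where
      P : Pred Carrier 0ℓ
      P x = a ≤ x × x ≤ b × ev p a ≤ ev p x
    ... | s , upper , least with upper a (≤-refl , a≤b , ≤-refl) | least b (λ x → λ (_ , x≤b , _) → x≤b)
    ... | a≤s | s≤b with increasing-near p s (0<p′ s a≤s s≤b)
    ... | δ , 0<δ , increasing with ev p s <? ev p a
    ... | yes ps<pa = contradiction (s-δ<s 0<δ) (≤⇒≯ (least (s - δ) bound))
      where
      bound : ∀ x → a ≤ x × x ≤ b × ev p a ≤ ev p x → x ≤ s - δ
      bound x px@(_ , _ , pa≤px) with upper x px
      ... | inj₂ x≈s = contradiction (<-respˡ (ev-cong p (sym x≈s)) ps<pa) (≤⇒≯ pa≤px)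
      ... | inj₁ x<s = ≮⇒≥ λ s-δ<x →
              <-asym (<-≤-trans ps<pa pa≤px) (proj₂ (increasing x (s-δ<x , <-trans x<s (s<s+δ 0<δ))) x<s)
    ... | no ps≮pa with s≤b
    ... | inj₂ s≈b = ≤-respʳ (ev-cong p s≈b) (≮⇒≥ ps≮pa)
    ... | inj₁ s<b with above-near 0<δ s<b
    ... | x , s<x , x<b , near = contradiction s<x (≤⇒≯ (upper x
            (≤-trans a≤s (<⇒≤ s<x) , <⇒≤ x<b , ≤-trans (≮⇒≥ ps≮pa) (<⇒≤ (proj₁ (increasing x near) s<x)))))

  opaque
    increasing : ∀ p {a b} → On a b (λ t → 0# < ev (deriv p) t) → a < b → ev p a < ev p b
    increasing p {a} {b} 0<p′ a<b with increasing-near p a (0<p′ a ≤-refl (<⇒≤ a<b))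
    ... | δ , 0<δ , near-increasing with above-near 0<δ a<b
    ... | x , a<x , x<b , near = <-≤-trans (proj₁ (near-increasing x near) a<x)
            (weakly-increasing p (λ t x≤t t≤b → 0<p′ t (≤-trans (<⇒≤ a<x) x≤t) t≤b) (<⇒≤ x<b))

  ev-derivX-addWith : ∀ g h x → ev (derivX (addWith g h)) x ≈ ev (derivX g) x + ev (derivX h) x
  ev-derivX-addWith []      h       x = sym (+-identityˡ _)
  ev-derivX-addWith (a ∷ g) []      x = sym (+-identityʳ _)
  ev-derivX-addWith (a ∷ g) (b ∷ h) x = begin-equality
    ev (derivX (a + b ∷ addWith g h)) x
      ≈⟨ ev-derivX (a + b) (addWith g h) x ⟩
    ev (a + b ∷ addWith g h) x + x * ev (derivX (addWith g h)) x
      ≈⟨ +-cong (ev-addWith (a ∷ g) (b ∷ h) x) (*-congˡ (ev-derivX-addWith g h x)) ⟩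
    (ev (a ∷ g) x + ev (b ∷ h) x) + x * (ev (derivX g) x + ev (derivX h) x)
      ≈⟨ solve 5 (λ x u v m n → (u :+ v) :+ x :* (m :+ n) := (u :+ x :* m) :+ (v :+ x :* n)) refl
           x (ev (a ∷ g) x) (ev (b ∷ h) x) (ev (derivX g) x) (ev (derivX h) x) ⟩
    (ev (a ∷ g) x + x * ev (derivX g) x) + (ev (b ∷ h) x + x * ev (derivX h) x)
      ≈⟨ +-cong (ev-derivX a g x) (ev-derivX b h x) ⟨
    ev (derivX (a ∷ g)) x + ev (derivX (b ∷ h)) x ∎

  opaque
    nondecreasing : ∀ p {a b} → On a b (λ t → 0# ≤ ev (deriv p) t) → a < b → ev p a ≤ ev p b
    nondecreasing []      {a} {b} 0≤p′ a<b = ≤-refl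
    nondecreasing (c ∷ g) {a} {b} 0≤p′ a<b = ≮⇒≥ impossible
      where
      p : List Carrier
      p = c ∷ g

      -- p + ε X has a positive derivative for every ε > 0.
      perturbed : ∀ ε → 0# < ε → ev p a + ε * a < ev p b + ε * b
      perturbed ε 0<ε = <-respˡ (value a) (<-respʳ (value b) (increasing (c ∷ addWith g (ε ∷ [])) positive a<b))
        where
        value : ∀ x → ev (c ∷ addWith g (ε ∷ [])) x ≈ ev p x + ε * x
        value x = trans (+-congˡ (*-congˡ (ev-addWith g (ε ∷ []) x)))
          (solve 4 (λ c x e ε → c :+ x :* (e :+ (ε :+ x :* con (+ 0))) := (c :+ x :* e) :+ ε :* x) refl c x
              (ev g x) ε)

        positive : On a b (λ t → 0# < ev (derivX (addWith g (ε ∷ []))) t)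
        positive t a≤t t≤b = <-respʳ
          (sym (trans (ev-derivX-addWith g (ε ∷ []) t) (trans (+-congˡ
            (solve 2 (λ ε t → (ε :+ con (+ 0)) :+ t :* con (+ 0) := ε) refl ε t)) (+-comm _ _))))
          (+-pos-nonneg 0<ε (0≤p′ t a≤t t≤b))

      impossible : ¬ (ev p b < ev p a)
      impossible pb<pa with positive-inverse (x<y⇒0<y-x a<b)
      ... | i , 0<i , [b-a]i≈1 = <-irrefl refl (begin-strict
        ev p a + ε * a                     <⟨ perturbed ε (*-pos (x<y⇒0<y-x pb<pa) 0<i) ⟩
        ev p b + ε * b                     ≈⟨ solve 4 (λ v ε a b → v :+ ε :* b := v :+ ε :* (b :- a) :+ ε :* a) refl
            (ev p b) ε a b ⟩
        ev p b + ε * (b - a) + ε * a       ≈⟨ +-congʳ (+-congˡ gap) ⟩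
        ev p b + (ev p a - ev p b) + ε * a ≈⟨ +-congʳ (solve 2 (λ u v → v :+ (u :- v) := u) refl (ev p a) (ev p b)) ⟩
        ev p a + ε * a                     ∎)
        where
        -- With this slope the gain of ε X over [a , b] cancels the supposed loss of p, so the
        -- perturbed polynomial would take equal values at a and b while increasing strictly.
        ε : Carrier
        ε = (ev p a - ev p b) * i
        gap : ε * (b - a) ≈ ev p a - ev p b
        gap = trans (solve 3 (λ d i e → d :* i :* e := d :* (e :* i)) refl (ev p a - ev p b) i (b - a))
                    (trans (*-congˡ [b-a]i≈1) (*-identityʳ _))

  ev-deriv-negate : ∀ p x → ev (deriv (negate p)) x ≈ - ev (deriv p) x
  ev-deriv-negate []      x = sym -0≈0
  ev-deriv-negate (_ ∷ g) x = go g
    where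
    go : ∀ g → ev (derivX (negate g)) x ≈ - ev (derivX g) x
    go []      = sym -0≈0
    go (b ∷ g) = begin-equality
      ev (derivX (negate (b ∷ g))) x                        ≈⟨ ev-derivX (- b) (negate g) x ⟩
      ev (negate (b ∷ g)) x + x * ev (derivX (negate g)) x  ≈⟨ +-cong (ev-negate (b ∷ g) x) (*-congˡ (go g)) ⟩
      - ev (b ∷ g) x + x * (- ev (derivX g) x)              ≈⟨ solve 3
          (λ u x v → :- u :+ x :* (:- v) := :- (u :+ x :* v)) refl (ev (b ∷ g) x) x (ev (derivX g) x) ⟩
      - (ev (b ∷ g) x + x * ev (derivX g) x)                ≈⟨ -‿cong (ev-derivX b g x) ⟨
      - ev (derivX (b ∷ g)) x                               ∎

  -‿cancel-< : ∀ {x y} → - x < - y → y < x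
  -‿cancel-< {x} {y} lt = <-respˡ (solve 1 (λ x → :- :- x := x) refl y)
      (<-respʳ (solve 1 (λ x → :- :- x := x) refl x) (-‿mono-< lt))

  -‿cancel-≤ : ∀ {x y} → - x ≤ - y → y ≤ x
  -‿cancel-≤ {x} {y} le = ≤-respˡ (solve 1 (λ x → :- :- x := x) refl y)
      (≤-respʳ (solve 1 (λ x → :- :- x := x) refl x) (-‿mono-≤ le))

  Step : Sign → Carrier → Carrier → Set
  Step neg x y = y < x
  Step zer x y = x ≈ y
  Step pos x y = x < y

  opaque
    monotone : ∀ s p {a b} → On a b (λ t → sgn (ev (deriv p) t) ≡ s) → a < b → Step s (ev p a) (ev p b)
    monotone pos p sign a<b = increasing p (λ t a≤t t≤b → sgn⁻¹-pos (sign t a≤t t≤b)) a<b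
    monotone neg p {a} {b} sign a<b = -‿cancel-< (<-respˡ (ev-negate p a) (<-respʳ (ev-negate p b)
      (increasing (negate p) (λ t a≤t t≤b → <-respʳ (sym (ev-deriv-negate p t))
          (x<0⇒0<-x (sgn⁻¹-neg (sign t a≤t t≤b)))) a<b)))
    monotone zer p {a} {b} sign a<b = ≤-antisym
      (nondecreasing p (λ t a≤t t≤b → ≤-reflexive (sym (sgn⁻¹-zer (sign t a≤t t≤b)))) a<b)
      (-‿cancel-≤ (≤-respˡ (ev-negate p a) (≤-respʳ (ev-negate p b)
        (nondecreasing (negate p) (λ t a≤t t≤b → ≤-reflexive
          (sym (trans (ev-deriv-negate p t) (trans (-‿cong (sgn⁻¹-zer (sign t a≤t t≤b))) -0≈0)))) a<b))))

  -- The length k comes from a degree bound and not from p, so that codes on different vertical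
  -- lines can be compared.
  code : ℕ → List Carrier → Carrier → List Sign
  code zero    p y = []
  code (suc k) p y = sgn (ev p y) ∷ code k (deriv p) y

  code-cong : ∀ k p {x y} → x ≈ y → code k p x ≡ code k p y
  code-cong zero    p x≈y = ≡.refl
  code-cong (suc k) p x≈y = ≡.cong₂ _∷_ (sgn-cong (ev-cong p x≈y)) (code-cong k (deriv p) x≈y)

  leading-code : ∀ {k} p t → length p ℕ.≤ k → sgn (ev p t) ≡ leading (code k p t)
  -- The length bound makes p the zero polynomial here, which agrees with the default value of
  -- `leading`.
  leading-code {zero}  [] t _ = sgn-zer refl
  leading-code {suc k} p  t _ = ≡.refl

  between-sgn : ∀ s {x y z} → Step s x y → Step s y z → sgn x ≡ sgn z → sgn y ≡ sgn x
  between-sgn zer x≈y _ _ = sgn-cong (sym x≈y)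
  between-sgn pos {x} {y} {z} x<y y<z e with compare x 0#
  ... | tri< _ _ _   = sgn-neg (<-trans y<z (sgn⁻¹-neg (≡.sym e)))
  ... | tri≈ _ x≈0 _ = contradiction (<-trans (<-respˡ x≈0 x<y) y<z) λ 0<z → <⇒≉ 0<z (sym (sgn⁻¹-zer (≡.sym e)))
  ... | tri> _ _ 0<x = sgn-pos (<-trans 0<x x<y)
  between-sgn neg {x} {y} {z} y<x z<y e with compare x 0#
  ... | tri< x<0 _ _ = sgn-neg (<-trans y<x x<0)
  ... | tri≈ _ x≈0 _ = contradiction (<-trans z<y (<-respʳ x≈0 y<x)) λ z<0 → <⇒≉ z<0 (sgn⁻¹-zer (≡.sym e))
  ... | tri> _ _ _   = sgn-pos (<-trans (sgn⁻¹-pos (≡.sym e)) z<y)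

  opaque
    -- The convexity part of Thom's lemma. By induction the code of p′ is constant on [a , b], so p
    -- is monotone there, and its value at t lies between two values of equal sign.
    code-between : ∀ k p {a b} → length p ℕ.≤ k → code k p a ≡ code k p b →
                   On a b (λ t → code k p t ≡ code k p a)
    code-between zero    p         _    _ t a≤t t≤b = ≡.refl
    code-between (suc k) p {a} {b} |p|≤ e t a≤t t≤b = ≡.cong₂ _∷_ (head a≤t t≤b) (tail t a≤t t≤b)
      where
      tail : On a b (λ t → code k (deriv p) t ≡ code k (deriv p) a)
      tail = code-between k (deriv p) (length-deriv p |p|≤) (List.∷-injectiveʳ e)

      slope : On a b (λ t → sgn (ev (deriv p) t) ≡ leading (code k (deriv p) a))
      slope t a≤t t≤b = ≡.trans (leading-code (deriv p) t (length-deriv p |p|≤)) (≡.cong leading (tail t a≤t t≤b))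

      head : a ≤ t → t ≤ b → sgn (ev p t) ≡ sgn (ev p a)
      head (inj₂ a≈t) _          = sgn-cong (ev-cong p (sym a≈t))
      head (inj₁ _)   (inj₂ t≈b) = ≡.trans (sgn-cong (ev-cong p t≈b)) (≡.sym (List.∷-injectiveˡ e))
      head (inj₁ a<t) (inj₁ t<b) = between-sgn (leading (code k (deriv p) a))
              (monotone _ p (λ u a≤u u≤t → slope u a≤u (≤-trans u≤t t≤b)) a<t)
              (monotone _ p (λ u t≤u u≤b → slope u (≤-trans a≤t t≤u) u≤b) t<b)
              (List.∷-injectiveˡ e)

  opaque
    equal-codes-step : ∀ k p {a b} → length p ℕ.≤ suc k → a < b → code k (deriv p) a ≡ code k (deriv p) b →
                       Step (leading (code k (deriv p) a)) (ev p a) (ev p b)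
    equal-codes-step k p |p|≤ a<b e = monotone _ p
      (λ t a≤t t≤b → ≡.trans (leading-code (deriv p) t (length-deriv p |p|≤))
        (≡.cong leading (code-between k (deriv p) (length-deriv p |p|≤) e t a≤t t≤b))) a<b

  direction-sgn : ∀ s {x y} → Step s x y → sgn x ≡ sgn y ⊎ direction (sgn x) (sgn y) · s ≡ pos ×
      direction (sgn y) (sgn x) · s ≡ neg
  direction-sgn zer x≈y = inj₁ (sgn-cong x≈y)
  direction-sgn pos {x} {y} x<y with compare x 0# | compare y 0#
  ... | tri< _ _ _   | tri< _ _ _   = inj₁ ≡.refl
  ... | tri< _ _ _   | tri≈ _ _ _   = inj₂ (≡.refl , ≡.refl)
  ... | tri< _ _ _   | tri> _ _ _   = inj₂ (≡.refl , ≡.refl)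
  ... | tri≈ _ x≈0 _ | tri< y<0 _ _ = contradiction (<-respˡ x≈0 x<y) (<-asym y<0)
  ... | tri≈ _ _ _   | tri≈ _ _ _   = inj₁ ≡.refl
  ... | tri≈ _ _ _   | tri> _ _ _   = inj₂ (≡.refl , ≡.refl)
  ... | tri> _ _ 0<x | tri< y<0 _ _ = contradiction (<-trans 0<x x<y) (<-asym y<0)
  ... | tri> _ _ 0<x | tri≈ _ y≈0 _ = contradiction (<-respʳ y≈0 x<y) (<-asym 0<x)
  ... | tri> _ _ _   | tri> _ _ _   = inj₁ ≡.refl
  direction-sgn neg {x} {y} y<x with compare x 0# | compare y 0#
  ... | tri< _ _ _   | tri< _ _ _   = inj₁ ≡.refl
  ... | tri≈ _ _ _   | tri< _ _ _   = inj₂ (≡.refl , ≡.refl)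
  ... | tri> _ _ _   | tri< _ _ _   = inj₂ (≡.refl , ≡.refl)
  ... | tri< x<0 _ _ | tri≈ _ y≈0 _ = contradiction (<-respˡ y≈0 y<x) (<-asym x<0)
  ... | tri≈ _ _ _   | tri≈ _ _ _   = inj₁ ≡.refl
  ... | tri> _ _ _   | tri≈ _ _ _   = inj₂ (≡.refl , ≡.refl)
  ... | tri< x<0 _ _ | tri> _ _ 0<y = contradiction (<-trans 0<y y<x) (<-asym x<0)
  ... | tri≈ _ x≈0 _ | tri> _ _ 0<y = contradiction (<-respʳ x≈0 y<x) (<-asym 0<y)
  ... | tri> _ _ _   | tri> _ _ _   = inj₁ ≡.refl

  opaque
    -- Both orders of the arguments are recorded, because `thom` puts the code of the root first, on
    -- whichever side of α the root lies.
    ord-< : ∀ k p {a b} → length p ℕ.≤ k → a < b → code k p a ≡ code k p b ⊎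
            (ord (code k p a) (code k p b) ≡ pos × ord (code k p b) (code k p a) ≡ neg)
    ord-< zero    p         _    _   = inj₁ ≡.refl
    ord-< (suc k) p {a} {b} |p|≤ a<b
      with code k (deriv p) a ≟ᶜ code k (deriv p) b
         | code k (deriv p) b ≟ᶜ code k (deriv p) a
         | ord-< k (deriv p) (length-deriv p |p|≤) a<b
    ... | yes e | no ≢ | _       = contradiction (≡.sym e) ≢
    ... | no ≢ | yes e | _       = contradiction (≡.sym e) ≢
    ... | no ≢ | no _ | inj₁ e   = contradiction e ≢
    ... | no _ | no _ | inj₂ ords = inj₂ ords
    ... | yes e | yes _ | _ with direction-sgn _ (equal-codes-step k p |p|≤ a<b e)
    ...   | inj₁ heads = inj₁ (≡.cong₂ _∷_ heads e)
    ...   | inj₂ (d₁ , d₂) = inj₂ (d₁ , ≡.trans (≡.cong (λ σ → direction (sgn (ev p b)) (sgn (ev p a)) · leading σ)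
        (≡.sym e)) d₂)

  Vanishing : Pred (List Sign) 0ℓ
  Vanishing = All (_≡ zer)

  opaque
    -- The uniqueness part of Thom's lemma. The first entry makes b a root too. As p is monotone
    -- between two roots with equal codes, strictly unless the sign of p′ is zero, p′ vanishes at a;
    -- the same argument then applies to p′ and so on.
    equal-codes-vanish : ∀ k p {a b} → length p ℕ.≤ k → a < b → ev p a ≈ 0# →
                         code k p a ≡ code k p b → Vanishing (code k p a)
    equal-codes-vanish zero    p _ _ _ _ = []
    equal-codes-vanish (suc zero) p _ _ pa≈0 _ = sgn-zer pa≈0 ∷ []
    equal-codes-vanish (suc (suc k)) p {a} {b} |p|≤ a<b pa≈0 e =
      sgn-zer pa≈0 ∷ equal-codes-vanish (suc k) (deriv p) (length-deriv p |p|≤) a<b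
        (flat _ (sgn (ev (deriv p) a)) ≡.refl (equal-codes-step (suc k) p |p|≤ a<b (List.∷-injectiveʳ e)))
            (List.∷-injectiveʳ e)
      where
      pa≈pb : ev p a ≈ ev p b
      pa≈pb = trans pa≈0 (sym (sgn⁻¹-zer (≡.trans (≡.sym (List.∷-injectiveˡ e)) (sgn-zer pa≈0))))

      flat : ∀ v s → sgn v ≡ s → Step s (ev p a) (ev p b) → v ≈ 0#
      flat v neg _ step = contradiction (sym pa≈pb) (<⇒≉ step)
      flat v zer z _    = sgn⁻¹-zer z
      flat v pos _ step = contradiction pa≈pb (<⇒≉ step)

  ord-refl : ∀ σ → ord σ σ ≡ zer
  ord-refl []      = ≡.refl
  ord-refl (s ∷ σ) with σ ≟ᶜ σ
  ord-refl (neg ∷ σ) | yes _ = ≡.refl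
  ord-refl (zer ∷ σ) | yes _ = ≡.refl
  ord-refl (pos ∷ σ) | yes _ = ≡.refl
  ... | no ≢ = contradiction ≡.refl ≢

  opaque
    thom : ∀ k p y α → length p ℕ.≤ k → ev p y ≈ 0# → ¬ Vanishing (code k p y) →
           sgn (α - y) ≡ ord (code k p y) (code k p α)
    thom k p y α |p|≤ py≈0 nonvanishing with compare y α
    ... | tri≈ _ y≈α _ = ≡.trans (sgn-zer (x≈y⇒x-y≈0 (sym y≈α)))
            (≡.sym (≡.trans (≡.cong (ord (code k p y)) (code-cong k p (sym y≈α))) (ord-refl (code k p y))))
    ... | tri< y<α _ _ with ord-< k p |p|≤ y<α
    ...   | inj₁ e = contradiction (equal-codes-vanish k p |p|≤ y<α py≈0 e) nonvanishing
    ...   | inj₂ (o , _) = ≡.trans (sgn-pos (x<y⇒0<y-x y<α)) (≡.sym o)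
    thom k p y α |p|≤ py≈0 nonvanishing | tri> _ _ α<y with ord-< k p |p|≤ α<y
    ...   | inj₂ (_ , o) = ≡.trans (sgn-neg (0<-x⇒x<0 (<-respʳ (solve 2 (λ y α → y :- α := :- (α :- y)) refl y α)
        (x<y⇒0<y-x α<y)))) (≡.sym o)
    -- The uniqueness lemma starts from a root at the left end, which is α now; equal codes make α a
    -- root.
    ...   | inj₁ e = contradiction (≡.subst Vanishing e vanish) nonvanishing
      where
      root : ∀ k p → length p ℕ.≤ k → ev p y ≈ 0# → code k p α ≡ code k p y → ev p α ≈ 0#
      root zero    [] _ _ _ = refl
      root (suc k) p  _ py≈0 e = sgn⁻¹-zer (≡.trans (List.∷-injectiveˡ e) (sgn-zer py≈0))
      vanish : Vanishing (code k p α)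
      vanish = equal-codes-vanish k p |p|≤ α<y (root k p |p|≤ py≈0 e) e

-- The sign of A + B, from the signs of A, B and A² - B² = (A + B) (A - B).
sumSign : Sign → Sign → Sign → Sign
sumSign s   zer _ = s
sumSign zer t   _ = t
sumSign pos pos _ = pos
sumSign neg neg _ = neg
sumSign pos neg n = n
sumSign neg pos n = neg · n

-- Branches of a plane curve and their position with respect to disks

module PlaneCurves (em : ExcludedMiddle 0ℓ) (ℝ : RealField) where
  open ThomCodes em ℝ public
  open ≤-Reasoning

  sgn-* : ∀ x y → sgn (x * y) ≡ sgn x · sgn y
  sgn-* x y with compare x 0# | compare y 0#
  ... | tri< x<0 _ _ | tri< y<0 _ _ = sgn-pos (*-neg-neg x<0 y<0)
  ... | tri< _ _ _   | tri≈ _ y≈0 _ = sgn-zer (trans (*-congˡ y≈0) (zeroʳ x))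
  ... | tri< x<0 _ _ | tri> _ _ 0<y = sgn-neg (*-neg-pos x<0 0<y)
  ... | tri≈ _ x≈0 _ | _            = sgn-zer (trans (*-congʳ x≈0) (zeroˡ y))
  ... | tri> _ _ 0<x | tri< y<0 _ _ = sgn-neg (*-pos-neg 0<x y<0)
  ... | tri> _ _ _   | tri≈ _ y≈0 _ = sgn-zer (trans (*-congˡ y≈0) (zeroʳ x))
  ... | tri> _ _ 0<x | tri> _ _ 0<y = sgn-pos (*-pos 0<x 0<y)

  difference-of-squares : ∀ a b → a * a - b * b ≈ (a + b) * (a - b)
  difference-of-squares = solve 2 (λ a b → a :* a :- b :* b := (a :+ b) :* (a :- b)) refl

  opaque
    sgn-+ : ∀ a b → sgn (a + b) ≡ sumSign (sgn a) (sgn b) (sgn (a * a - b * b))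
    sgn-+ a b with compare a 0# | compare b 0#
    ... | tri< a<0 _ _ | tri≈ _ b≈0 _ = sgn-neg (<-respˡ (sym (trans (+-congˡ b≈0) (+-identityʳ a))) a<0)
    ... | tri≈ _ a≈0 _ | tri≈ _ b≈0 _ = sgn-zer (trans (+-congˡ b≈0) (trans (+-identityʳ a) a≈0))
    ... | tri> _ _ 0<a | tri≈ _ b≈0 _ = sgn-pos (<-respʳ (sym (trans (+-congˡ b≈0) (+-identityʳ a))) 0<a)
    ... | tri≈ _ a≈0 _ | tri< b<0 _ _ = sgn-neg (<-respˡ (sym (trans (+-congʳ a≈0) (+-identityˡ b))) b<0)
    ... | tri≈ _ a≈0 _ | tri> _ _ 0<b = sgn-pos (<-respʳ (sym (trans (+-congʳ a≈0) (+-identityˡ b))) 0<b)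
    ... | tri< a<0 _ _ | tri< b<0 _ _ = sgn-neg (<-respʳ (+-identityˡ 0#) (+-mono-<-≤ a<0 (<⇒≤ b<0)))
    ... | tri> _ _ 0<a | tri> _ _ 0<b = sgn-pos (+-pos-nonneg 0<a (<⇒≤ 0<b))
    ... | tri> _ _ 0<a | tri< b<0 _ _ = ≡.sym (≡.trans (sgn-cong (difference-of-squares a b))
            (≡.trans (sgn-* (a + b) (a - b)) (≡.trans (≡.cong (sgn (a + b) ·_)
                (sgn-pos (x<y⇒0<y-x (<-trans b<0 0<a)))) (·-posʳ _))))
      where
      ·-posʳ : ∀ s → s · pos ≡ s
      ·-posʳ neg = ≡.refl
      ·-posʳ zer = ≡.refl
      ·-posʳ pos = ≡.refl
    ... | tri< a<0 _ _ | tri> _ _ 0<b = ≡.sym (≡.trans (≡.cong (neg ·_) (sgn-cong (difference-of-squares a b)))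
            (≡.trans (≡.cong (neg ·_) (sgn-* (a + b) (a - b))) (≡.trans (≡.cong (λ t → neg · (sgn (a + b) · t))
              (sgn-neg (0<-x⇒x<0 (<-respʳ (solve 2 (λ a b → b :- a := :- (a :- b)) refl a b)
                  (x<y⇒0<y-x (<-trans a<0 0<b)))))) (neg-·-neg _))))
      where
      neg-·-neg : ∀ s → neg · (s · neg) ≡ s
      neg-·-neg neg = ≡.refl
      neg-·-neg zer = ≡.refl
      neg-·-neg pos = ≡.refl

  -- A curve is given by the coefficients in ℝ[x] of its powers of y.
  Curve : Set
  Curve = List (Carrier → Carrier)

  at : Carrier → Curve → List Carrier
  at x = map (λ c → c x)

  module ∂y = Derivative {Carrier → Carrier} (λ c d x → c x + d x) (λ _ → 0#)

  at-addWith : ∀ x F G → at x (∂y.addWith F G) ≡ addWith (at x F) (at x G)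
  at-addWith x []      G       = ≡.refl
  at-addWith x (c ∷ F) []      = ≡.refl
  at-addWith x (c ∷ F) (d ∷ G) = ≡.cong (c x + d x ∷_) (at-addWith x F G)

  at-derivX : ∀ x F → at x (∂y.derivX F) ≡ derivX (at x F)
  at-derivX x []      = ≡.refl
  at-derivX x (c ∷ F) = ≡.trans (at-addWith x (c ∷ F) ((λ _ → 0#) ∷ ∂y.derivX F))
    (≡.cong (λ g → addWith (c x ∷ at x F) (0# ∷ g)) (at-derivX x F))

  at-deriv : ∀ x F → at x (∂y.deriv F) ≡ deriv (at x F)
  at-deriv x []      = ≡.refl
  at-deriv x (_ ∷ F) = at-derivX x F

  length-at : ∀ {k} x F → length F ℕ.≤ k → length (at x F) ℕ.≤ k
  length-at x F = ℕ.≤-trans (ℕ.≤-reflexive (List.length-map _ F))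

  -- Bounds the coefficients, hence the degree in x; the degree in y is bounded by the length of the
  -- list.
  HasDegree≤ : ℕ → Pred Curve 0ℓ
  HasDegree≤ d = All (IsPolynomial d)

  ∂y-HasDegree≤ : ∀ {d F} → HasDegree≤ d F → HasDegree≤ d (∂y.deriv F)
  ∂y-HasDegree≤ = ∂y.All-deriv poly-+ poly-zero

  poly-cong : ∀ {d c} → IsPolynomial d c → ∀ {x x′} → x ≈ x′ → c x ≈ c x′
  poly-cong (g , _ , c≈) x≈x′ = trans (c≈ _) (trans (ev-cong g x≈x′) (sym (c≈ _)))

  ev-at-cong : ∀ {d F x x′} y → HasDegree≤ d F → x ≈ x′ → ev (at x F) y ≈ ev (at x′ F) y
  ev-at-cong y []       x≈x′ = refl
  ev-at-cong y (c ∷ cs) x≈x′ = +-cong (poly-cong c x≈x′) (*-congˡ (ev-at-cong y cs x≈x′))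

  code-at-cong : ∀ {d} k F {x x′} y → HasDegree≤ d F → x ≈ x′ → code k (at x F) y ≡ code k (at x′ F) y
  code-at-cong zero    F y F-poly x≈x′ = ≡.refl
  code-at-cong (suc k) F {x} {x′} y F-poly x≈x′ = ≡.cong₂ _∷_ (sgn-cong (ev-at-cong y F-poly x≈x′))
    (≡.subst₂ (λ p q → code k p y ≡ code k q y) (at-deriv x F) (at-deriv x′ F)
      (code-at-cong k (∂y.deriv F) y (∂y-HasDegree≤ F-poly) x≈x′))

  -- On y = b + w with w² = s, the polynomial F takes the value U + V w.
  reduce : Carrier → (Carrier → Carrier) → Curve → (Carrier → Carrier) × (Carrier → Carrier)
  reduce b s []      = (λ _ → 0#) , (λ _ → 0#)
  reduce b s (c ∷ F) with reduce b s F
  ... | U , V = (λ x → c x + (b * U x + s x * V x)) , (λ x → U x + b * V x)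

  opaque
    ev-reduce : ∀ b s F x w → w * w ≈ s x →
                ev (at x F) (b + w) ≈ proj₁ (reduce b s F) x + proj₂ (reduce b s F) x * w
    ev-reduce b s []      x w w²≈s = solve 1 (λ w → con (+ 0) := con (+ 0) :+ con (+ 0) :* w) refl w
    ev-reduce b s (c ∷ F) x w w²≈s with reduce b s F | ev-reduce b s F x w w²≈s
    ... | U , V | ih = begin-equality
      c x + (b + w) * ev (at x F) (b + w)                 ≈⟨ +-congˡ (*-congˡ ih) ⟩
      c x + (b + w) * (U x + V x * w)
        ≈⟨ solve 5 (λ c b w u v → c :+ (b :+ w) :* (u :+ v :* w) := (c :+ (b :* u :+ w :* w :* v)) :+
            (u :+ b :* v) :* w) refl (c x) b w (U x) (V x) ⟩
      (c x + (b * U x + w * w * V x)) + (U x + b * V x) * w ≈⟨ +-congʳ (+-congˡ (+-congˡ (*-congʳ w²≈s))) ⟩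
      (c x + (b * U x + s x * V x)) + (U x + b * V x) * w ∎

  -- Each Horner step of `reduce` multiplies by s at most once, which adds the 4 of
  -- `IsPolynomial 4 s`.
  reducedDegree : ℕ → ℕ → ℕ
  reducedDegree zero    d = d
  reducedDegree (suc k) d = 4 ℕ.+ reducedDegree k d

  d≤reducedDegree : ∀ k d → d ℕ.≤ reducedDegree k d
  d≤reducedDegree zero    d = ℕ.≤-refl
  d≤reducedDegree (suc k) d = ℕ.≤-trans (d≤reducedDegree k d) (ℕ.m≤n+m _ 4)

  opaque
    reduce-polynomial : ∀ {k d} b s → IsPolynomial 4 s → ∀ F → length F ℕ.≤ k → HasDegree≤ d F →
                        IsPolynomial (reducedDegree k d) (proj₁ (reduce b s F)) ×
                        IsPolynomial (reducedDegree k d) (proj₂ (reduce b s F))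
    reduce-polynomial b s s-poly []      _ _ = poly-zero , poly-zero
    reduce-polynomial {suc k} {d} b s s-poly (c ∷ F) (s≤s |F|≤) (c-poly ∷ F-poly)
      with reduce b s F | reduce-polynomial b s s-poly F |F|≤ F-poly
    ... | U , V | U-poly , V-poly =
      poly-+ (poly-weaken (d≤reducedDegree (suc k) d) c-poly)
             (poly-+ (b*poly U-poly) (poly-* s-poly V-poly)) ,
      poly-+ (poly-weaken (ℕ.m≤n+m _ 4) U-poly) (b*poly V-poly)
      where
      b*poly : ∀ {W} → IsPolynomial (reducedDegree k d) W → IsPolynomial (4 ℕ.+ reducedDegree k d) (λ x → b * W x)
      b*poly W-poly = poly-weaken (ℕ.+-monoˡ-≤ (reducedDegree k d) (s≤s z≤n)) (poly-* (poly-const b) W-poly)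

  -- The summands belong to U, to V and to U² - V² s.
  signBreaks : ℕ → ℕ → ℕ
  signBreaks k d = e ℕ.+ (e ℕ.+ (4 ℕ.+ (e ℕ.+ e)))
    where e = reducedDegree k d

  -- w and w′ run over both square roots. Equal signs pair the upper arcs y = b + √s at x and x′
  -- with each other, and likewise the lower arcs.
  Branches : Carrier → (Carrier → Carrier) → (Carrier → Carrier → Carrier → Carrier → Set) → Carrier → Carrier → Set
  Branches b s R x x′ = ∀ w w′ → w * w ≈ s x → w′ * w′ ≈ s x′ → sgn w ≡ sgn w′ → R x (b + w) x′ (b + w′)

  length-++-≤ : ∀ {m n} (B B′ : List Carrier) → length B ℕ.≤ m → length B′ ℕ.≤ n → length (B ++ B′) ℕ.≤ m ℕ.+ n
  length-++-≤ B B′ |B|≤ |B′|≤ = ℕ.≤-trans (ℕ.≤-reflexive (List.length-++ B)) (ℕ.+-mono-≤ |B|≤ |B′|≤)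

  opaque
    sgn-on-circle : ∀ {k d} b s → IsPolynomial 4 s → ∀ F → length F ℕ.≤ k → HasDegree≤ d F →
      ∃[ B ] length B ℕ.≤ signBreaks k d × ∀ x x′ → SameSide B x x′ →
      Branches b s (λ x y x′ y′ → sgn (ev (at x F) y) ≡ sgn (ev (at x′ F) y′)) x x′
    sgn-on-circle b s s-poly F |F|≤ F-poly with reduce-polynomial b s s-poly F |F|≤ F-poly
    ... | U-poly , V-poly with sgn-poly-const U-poly | sgn-poly-const V-poly
      | sgn-poly-const (poly-+ (poly-weaken (ℕ.m≤n+m _ 4) (poly-* U-poly U-poly))
          (poly-neg (poly-* s-poly (poly-* V-poly V-poly))))
    ... | B₁ , |B₁|≤ , const₁ | B₂ , |B₂|≤ , const₂ | B₃ , |B₃|≤ , const₃ =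
      B₁ ++ (B₂ ++ B₃) , length-++-≤ B₁ (B₂ ++ B₃) |B₁|≤ (length-++-≤ B₂ B₃ |B₂|≤ |B₃|≤) , const
      where
      U V : Carrier → Carrier
      U = proj₁ (reduce b s F)
      V = proj₂ (reduce b s F)

      sgn-value : ∀ x w → w * w ≈ s x → sgn (ev (at x F) (b + w)) ≡
                  sumSign (sgn (U x)) (sgn (V x) · sgn w) (sgn (U x * U x + - (s x * (V x * V x))))
      sgn-value x w w²≈s = ≡.trans (sgn-cong (ev-reduce b s F x w w²≈s)) (≡.trans (sgn-+ (U x) (V x * w))
        (≡.cong₂ (sumSign (sgn (U x))) (sgn-* (V x) w) (sgn-cong (+-congˡ (-‿cong
          (trans (solve 2 (λ v w → (v :* w) :* (v :* w) := (w :* w) :* (v :* v)) refl (V x) w) (*-congʳ w²≈s)))))))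

      const : ∀ x x′ → SameSide (B₁ ++ (B₂ ++ B₃)) x x′ →
              Branches b s (λ x y x′ y′ → sgn (ev (at x F) y) ≡ sgn (ev (at x′ F) y′)) x x′
      const x x′ same w w′ w²≈s w′²≈s sgn-w with All.++⁻ B₁ same
      ... | same₁ , same₂₃ with All.++⁻ B₂ same₂₃
      ... | same₂ , same₃ = ≡.trans (sgn-value x w w²≈s) (≡.trans
        (≡.cong₂ (λ u n → sumSign u (sgn (V x) · sgn w) n) (const₁ x x′ same₁) (const₃ x x′ same₃))
        (≡.trans (≡.cong (λ t → sumSign (sgn (U x′)) t (sgn (U x′ * U x′ + - (s x′ * (V x′ * V x′)))))
            (≡.cong₂ _·_ (const₂ x x′ same₂) sgn-w))
          (≡.sym (sgn-value x′ w′ w′²≈s))))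

  opaque
    code-on-circle : ∀ {k d} j b s → IsPolynomial 4 s → ∀ F → length F ℕ.≤ k → HasDegree≤ d F →
      ∃[ B ] length B ℕ.≤ j ℕ.* signBreaks k d × ∀ x x′ → SameSide B x x′ →
      Branches b s (λ x y x′ y′ → code j (at x F) y ≡ code j (at x′ F) y′) x x′
    code-on-circle zero    b s s-poly F |F|≤ F-poly = [] , z≤n , λ _ _ _ _ _ _ _ _ → ≡.refl
    code-on-circle (suc j) b s s-poly F |F|≤ F-poly
      with sgn-on-circle b s s-poly F |F|≤ F-poly
         | code-on-circle j b s s-poly (∂y.deriv F) (∂y.length-deriv F (ℕ.≤-trans |F|≤ (ℕ.n≤1+n _)))
             (∂y-HasDegree≤ F-poly)
    ... | B₁ , |B₁|≤ , const₁ | B₂ , |B₂|≤ , const₂ = B₁ ++ B₂ , length-++-≤ B₁ B₂ |B₁|≤ |B₂|≤ ,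
      λ x x′ same w w′ w²≈s w′²≈s sgn-w → ≡.cong₂ _∷_
        (const₁ x x′ (proj₁ (All.++⁻ B₁ same)) w w′ w²≈s w′²≈s sgn-w)
        (≡.subst₂ (λ p q → code j p (b + w) ≡ code j q (b + w′)) (at-deriv x F) (at-deriv x′ F)
          (const₂ x x′ (proj₂ (All.++⁻ B₁ same)) w w′ w²≈s w′²≈s sgn-w))

  sgn-neg-cong : ∀ {v w} → sgn v ≡ sgn w → sgn (- v) ≡ sgn (- w)
  sgn-neg-cong {v} {w} e = ≡.trans (flip v) (≡.trans (≡.cong (neg ·_) e) (≡.sym (flip w)))
    where
    flip : ∀ v → sgn (- v) ≡ neg · sgn v
    flip v = ≡.trans (sgn-cong (solve 1 (λ v → :- v := (:- con (+ 1)) :* v) refl v))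
      (≡.trans (sgn-* (- 1#) v) (≡.cong (_· sgn v) (sgn-neg (0<x⇒-x<0 0<1))))

  nonneg-sgn : ∀ {x y} → sgn x ≡ sgn y → 0# ≤ x → 0# ≤ y
  nonneg-sgn e (inj₁ 0<x) = inj₁ (sgn⁻¹-pos (≡.trans (≡.sym e) (sgn-pos 0<x)))
  nonneg-sgn e (inj₂ 0≈x) = inj₂ (sym (sgn⁻¹-zer (≡.trans (≡.sym e) (sgn-zer (sym 0≈x)))))

  sgn-sqrt : ∀ {w} → 0# ≤ w → sgn w ≡ sgn (w * w)
  sgn-sqrt (inj₁ 0<w)     = ≡.trans (sgn-pos 0<w) (≡.sym (sgn-pos (*-pos 0<w 0<w)))
  sgn-sqrt {w} (inj₂ 0≈w) = ≡.trans (sgn-zer (sym 0≈w)) (≡.sym (sgn-zer (trans (*-congʳ (sym 0≈w)) (zeroˡ w))))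

  -- s(x) such that (x - a)² + (y - b)² ≤ ρ iff (y - b)² ≤ s(x).
  chord : Carrier → Carrier → Carrier → Carrier
  chord a ρ x = ρ + - ((x + - a) * (x + - a))

  opaque
    chord-polynomial : ∀ a ρ → IsPolynomial 4 (chord a ρ)
    chord-polynomial a ρ = poly-+ (poly-weaken (s≤s z≤n) (poly-const ρ)) (poly-neg (poly-* x-a x-a))
      where
      x-a : IsPolynomial 2 (λ x → x + - a)
      x-a = poly-+ poly-id (poly-weaken (s≤s z≤n) (poly-const (- a)))

  -- 4 breaks for the sign of s, which tells whether the vertical line meets the disk, the others
  -- for the codes at the points of the circle.
  diskBreaks : ℕ → ℕ → ℕ
  diskBreaks k d = 4 ℕ.+ k ℕ.* signBreaks k d

  square-≤ : ∀ {u w} → 0# ≤ w → u * u ≤ w * w → (0# ≤ w - u) × (0# ≤ w + u)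
  square-≤ {u} {w} 0≤w u²≤w² =
    x≤y⇒0≤y-x (square-cancel-≤ 0≤w u²≤w²) ,
    ≤-respʳ (solve 2 (λ u w → w :- (:- u) := w :+ u) refl u w) (x≤y⇒0≤y-x (square-cancel-≤ 0≤w
      (≤-respˡ (solve 1 (λ u → u :* u := (:- u) :* (:- u)) refl u) u²≤w²)))

  square-≥ : ∀ {u w} → 0# ≤ w - u → 0# ≤ w + u → u * u ≤ w * w
  square-≥ {u} {w} 0≤w-u 0≤w+u = 0≤y-x⇒x≤y
    (≤-respʳ (solve 2 (λ u w → (w :- u) :* (w :+ u) := w :* w :- u :* u) refl u w) (*-nonneg 0≤w-u 0≤w+u))

  opaque
    -- A point is in the disk if it lies between the points b - w and b + w of the circle, w =
    -- √s(x). Within a cell, s keeps its sign, so that w′ exists, and the codes at these two points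
    -- stay the same, so that `thom` gives equal positions. One implication is enough, as `SameSide`
    -- is symmetric.
    disk-const : ∀ {k d} F → length F ℕ.≤ k → HasDegree≤ d F → ∀ a b ρ →
      ∃[ B ] length B ℕ.≤ diskBreaks k d × ∀ x y x′ y′ → SameSide B x x′ →
      ev (at x F) y ≈ 0# → ev (at x′ F) y′ ≈ 0# →
      code k (at x F) y ≡ code k (at x′ F) y′ → ¬ Vanishing (code k (at x F) y) →
      (y - b) * (y - b) ≤ chord a ρ x → (y′ - b) * (y′ - b) ≤ chord a ρ x′
    disk-const {k} {d} F |F|≤ F-poly a b ρ
      with sgn-poly-const (chord-polynomial a ρ) | code-on-circle k b (chord a ρ) (chord-polynomial a ρ) F |F|≤ F-poly
    ... | B₁ , |B₁|≤ , const₁ | B₂ , |B₂|≤ , const₂ = B₁ ++ B₂ , length-++-≤ B₁ B₂ |B₁|≤ |B₂|≤ , const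
      where
      const : ∀ x y x′ y′ → SameSide (B₁ ++ B₂) x x′ →
              ev (at x F) y ≈ 0# → ev (at x′ F) y′ ≈ 0# →
              code k (at x F) y ≡ code k (at x′ F) y′ → ¬ Vanishing (code k (at x F) y) →
              (y - b) * (y - b) ≤ chord a ρ x → (y′ - b) * (y′ - b) ≤ chord a ρ x′
      const x y x′ y′ same on-F on-F′ codes nonvanishing inside =
        compare-roots (sqrt (chord a ρ x) 0≤s) (sqrt (chord a ρ x′) (nonneg-sgn (const₁ x x′ same₁) 0≤s))
        where
        same₁ : SameSide B₁ x x′
        same₁ = proj₁ (All.++⁻ B₁ same)

        same₂ : SameSide B₂ x x′
        same₂ = proj₂ (All.++⁻ B₁ same)

        0≤s : 0# ≤ chord a ρ x
        0≤s = ≤-trans (square-nonneg (y - b)) inside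

        position : ∀ v v′ → v * v ≈ chord a ρ x → v′ * v′ ≈ chord a ρ x′ → sgn v ≡ sgn v′ →
                   sgn ((b + v) - y) ≡ sgn ((b + v′) - y′)
        position v v′ v²≈s v′²≈s′ sgn-v = ≡.trans
          (thom k (at x F) y (b + v) (length-at x F |F|≤) on-F nonvanishing)
          (≡.trans (≡.cong₂ ord codes (const₂ x x′ same₂ v v′ v²≈s v′²≈s′ sgn-v))
            (≡.sym (thom k (at x′ F) y′ (b + v′) (length-at x′ F |F|≤) on-F′
                (λ van → nonvanishing (≡.subst Vanishing (≡.sym codes) van)))))

        shuffle : ∀ w y → w - (y - b) ≈ (b + w) - y
        shuffle w y = solve 3 (λ b w y → w :- (y :- b) := (b :+ w) :- y) refl b w y

        reflect : ∀ w y → w + (y - b) ≈ - ((b + - w) - y)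
        reflect w y = solve 3 (λ b w y → w :+ (y :- b) := :- ((b :+ :- w) :- y)) refl b w y

        neg-square : ∀ {v s} → v * v ≈ s → - v * - v ≈ s
        neg-square {v} = trans (solve 1 (λ v → (:- v) :* (:- v) := v :* v) refl v)

        compare-roots : (∃[ w ] 0# ≤ w × w * w ≈ chord a ρ x) → (∃[ w′ ] 0# ≤ w′ × w′ * w′ ≈ chord a ρ x′) →
                        (y′ - b) * (y′ - b) ≤ chord a ρ x′
        compare-roots (w , 0≤w , w²≈s) (w′ , 0≤w′ , w′²≈s′) = ≤-respʳ w′²≈s′ (square-≥
          (nonneg-sgn below (proj₁ sides)) (nonneg-sgn above (proj₂ sides)))
          where
          sides : (0# ≤ w - (y - b)) × (0# ≤ w + (y - b))
          sides = square-≤ 0≤w (≤-respʳ (sym w²≈s) inside)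

          sgn-w : sgn w ≡ sgn w′
          sgn-w = ≡.trans (sgn-sqrt 0≤w) (≡.trans (sgn-cong w²≈s) (≡.trans (const₁ x x′ same₁)
            (≡.trans (≡.sym (sgn-cong w′²≈s′)) (≡.sym (sgn-sqrt 0≤w′)))))

          below : sgn (w - (y - b)) ≡ sgn (w′ - (y′ - b))
          below = ≡.trans (sgn-cong (shuffle w y)) (≡.trans (position w w′ w²≈s w′²≈s′ sgn-w)
              (≡.sym (sgn-cong (shuffle w′ y′))))

          above : sgn (w + (y - b)) ≡ sgn (w′ + (y′ - b))
          above = ≡.trans (sgn-cong (reflect w y)) (≡.trans
            (sgn-neg-cong (position (- w) (- w′) (neg-square w²≈s) (neg-square w′²≈s′) (sgn-neg-cong {w} {w′} sgn-w)))
            (≡.sym (sgn-cong (reflect w′ y′))))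

  opaque
    -- This is `thom` for α = y′: on equal codes `ord` is `zer`, so y′ - y is zero.
    code-determines-y : ∀ {k d} F → length F ℕ.≤ k → HasDegree≤ d F → ∀ {x y x′ y′} →
      ev (at x F) y ≈ 0# → code k (at x F) y ≡ code k (at x′ F) y′ → ¬ Vanishing (code k (at x F) y) →
      x ≈ x′ → y ≈ y′
    code-determines-y {k} F |F|≤ F-poly {x} {y} {x′} {y′} on-F codes nonvanishing x≈x′ =
      sym (x-y≈0⇒x≈y (sgn⁻¹-zer (≡.trans (thom k (at x F) y y′ (length-at x F |F|≤) on-F nonvanishing)
        (≡.trans (≡.cong (ord (code k (at x F) y)) (≡.trans (code-at-cong k F y′ F-poly x≈x′) (≡.sym codes)))
          (ord-refl (code k (at x F) y))))))

  opaque
    -- By induction p′ is zero everywhere, so p is constant with value zero at y. For a point of the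
    -- curve this means that its whole vertical line lies on the curve.
    vanishing-code⇒zero : ∀ k p {y} → length p ℕ.≤ k → Vanishing (code k p y) → ∀ t → ev p t ≈ 0#
    vanishing-code⇒zero zero    []  _    _                t = refl
    vanishing-code⇒zero (suc k) p {y} |p|≤ (py-zer ∷ codes) t = go (compare y t)
      where
      flat : ∀ u → sgn (ev (deriv p) u) ≡ zer
      flat u = sgn-zer (vanishing-code⇒zero k (deriv p) (length-deriv p |p|≤) codes u)

      go : Tri (y < t) (y ≈ t) (t < y) → ev p t ≈ 0#
      go (tri< y<t _ _) = trans (sym (monotone zer p (λ u _ _ → flat u) y<t)) (sgn⁻¹-zer py-zer)
      go (tri≈ _ y≈t _) = trans (ev-cong p (sym y≈t)) (sgn⁻¹-zer py-zer)
      go (tri> _ _ t<y) = trans (monotone zer p (λ u _ _ → flat u) t<y) (sgn⁻¹-zer py-zer)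

  beyond : ∀ B → ∃[ t ] All (_< t) B
  beyond []      = 0# , []
  beyond (b ∷ B) with beyond B
  ... | t , B<t with ≤-total b t
  ... | inj₁ b≤t = t + 1# , ≤-<-trans b≤t (s<s+δ 0<1) ∷ All.map (λ c<t → <-trans c<t (s<s+δ 0<1)) B<t
  ... | inj₂ t≤b = b + 1# , s<s+δ 0<1 ∷ All.map (λ c<t → <-trans (<-≤-trans c<t t≤b) (s<s+δ 0<1)) B<t

  zero-polynomial : ∀ p → (∀ t → ev p t ≈ 0#) → AllZero p
  zero-polynomial p p≈0 with All.all? (_≟ 0#) p
  ... | yes zeros = zeros
  ... | no nonzero with roots p nonzero
  ... | B , _ , covers with beyond B
  ... | t , B<t = contradiction (covers t (p≈0 t)) (notIn B<t)
    where
    notIn : ∀ {B} → All (_< t) B → ¬ Any (t ≈_) B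
    notIn (b<t ∷ _)  (here t≈b) = <⇒≉ b<t (sym t≈b)
    notIn (_ ∷ rest) (there p)  = notIn rest p

-- Finite sums, pigeonholes and the numerical core

∣+-+∣≤ : ∀ a b c d → ℕ.∣ a ℕ.+ b - c ℕ.+ d ∣ ℕ.≤ ℕ.∣ a - c ∣ ℕ.+ ℕ.∣ b - d ∣
∣+-+∣≤ a b c d = ℕ.≤-trans (ℕ.∣-∣-triangle (a ℕ.+ b) (c ℕ.+ b) (c ℕ.+ d)) (ℕ.≤-reflexive (≡.cong₂ ℕ._+_
  (≡.trans (≡.cong₂ ℕ.∣_-_∣ (ℕ.+-comm a b) (ℕ.+-comm c b)) (ℕ.∣m+n-m+o∣≡∣n-o∣ b a c)) (ℕ.∣m+n-m+o∣≡∣n-o∣ c b d)))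

m≤n⇒∣m-n∣+m≡n : ∀ {m n} → m ℕ.≤ n → ℕ.∣ m - n ∣ ℕ.+ m ≡ n
m≤n⇒∣m-n∣+m≡n {m} m≤n = ≡.trans (≡.cong (ℕ._+ m) (ℕ.m≤n⇒∣m-n∣≡n∸m m≤n)) (ℕ.m∸n+n≡m m≤n)

indicator : {P : Set} → Dec P → ℕ
indicator (yes _) = 1
indicator (no _)  = 0

module _ {A : Set} where
  sumOver : (A → ℕ) → List A → ℕ
  sumOver h xs = sum (map h xs)

  sumOver-+ : ∀ h k xs → sumOver (λ x → h x ℕ.+ k x) xs ≡ sumOver h xs ℕ.+ sumOver k xs
  sumOver-+ h k []       = ≡.refl
  sumOver-+ h k (x ∷ xs) = ≡.trans (≡.cong (h x ℕ.+ k x ℕ.+_) (sumOver-+ h k xs))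
    (solve 4 (λ a b c d → (a :+ b) :+ (c :+ d) := (a :+ c) :+ (b :+ d)) ≡.refl (h x) (k x) (sumOver h xs)
        (sumOver k xs))
    where open +-*-Solver

  sumOver-zero : ∀ xs → sumOver (λ _ → 0) xs ≡ 0
  sumOver-zero []       = ≡.refl
  sumOver-zero (x ∷ xs) = sumOver-zero xs

  sumOver-* : ∀ c h xs → sumOver (λ x → c ℕ.* h x) xs ≡ c ℕ.* sumOver h xs
  sumOver-* c h []       = ≡.sym (ℕ.*-zeroʳ c)
  sumOver-* c h (x ∷ xs) = ≡.trans (≡.cong (c ℕ.* h x ℕ.+_) (sumOver-* c h xs)) (≡.sym (ℕ.*-distribˡ-+ c (h x) _))

  sumOver-mono : ∀ {h k xs} → All (λ x → h x ℕ.≤ k x) xs → sumOver h xs ℕ.≤ sumOver k xs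
  sumOver-mono []         = z≤n
  sumOver-mono (le ∷ les) = ℕ.+-mono-≤ le (sumOver-mono les)

  sumOver-≤ : ∀ c {h xs} → All (λ x → h x ℕ.≤ c) xs → sumOver h xs ℕ.≤ length xs ℕ.* c
  sumOver-≤ c []         = z≤n
  sumOver-≤ c (le ∷ les) = ℕ.+-mono-≤ le (sumOver-≤ c les)

  ∣sumOver-sumOver∣≤ : ∀ h k xs → ℕ.∣ sumOver h xs - sumOver k xs ∣ ℕ.≤ sumOver (λ x → ℕ.∣ h x - k x ∣) xs
  ∣sumOver-sumOver∣≤ h k []       = z≤n
  ∣sumOver-sumOver∣≤ h k (x ∷ xs) = ℕ.≤-trans (∣+-+∣≤ (h x) _ (k x) _)
      (ℕ.+-monoʳ-≤ ℕ.∣ h x - k x ∣ (∣sumOver-sumOver∣≤ h k xs))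

  sumOver-indicator : ∀ {P : Pred A 0ℓ} (P? : Decidable P) xs → sumOver (λ x → indicator (P? x)) xs ≡ length
      (filter P? xs)
  sumOver-indicator P? []       = ≡.refl
  sumOver-indicator P? (x ∷ xs) with P? x
  ... | yes _ = ≡.cong suc (sumOver-indicator P? xs)
  ... | no _  = sumOver-indicator P? xs

  length-filter-¬ : ∀ {P : Pred A 0ℓ} (P? : Decidable P) xs → length xs ≡ length (filter P? xs) ℕ.+ length
      (filter (λ x → ¬? (P? x)) xs)
  length-filter-¬ P? []       = ≡.refl
  length-filter-¬ P? (x ∷ xs) with P? x
  ... | yes _ = ≡.cong suc (length-filter-¬ P? xs)
  ... | no _  = ≡.trans (≡.cong suc (length-filter-¬ P? xs)) (≡.sym (ℕ.+-suc _ _))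

  -- The bound c is asked only of lists that inherit R and G. This permits nesting, by one rank and
  -- then by its offset to another one.
  ≤-fibres : ∀ {R : Rel A 0ℓ} {G : Pred A 0ℓ} (h : A → ℕ) N c →
    (∀ j ys → AllPairs R ys → All G ys → All (λ y → h y ≡ j) ys → length ys ℕ.≤ c) →
    ∀ xs → AllPairs R xs → All G xs → All (λ x → h x ℕ.< N) xs → length xs ℕ.≤ N ℕ.* c
  ≤-fibres h zero    c fibre []       _  _ _        = z≤n
  ≤-fibres h zero    c fibre (x ∷ xs) _  _ (() ∷ _)
  ≤-fibres {R} {G} h (suc N) c fibre xs rs gs h< = ≡.subst (ℕ._≤ c ℕ.+ N ℕ.* c) (≡.sym (length-filter-¬ top? xs))
    (ℕ.+-mono-≤
      (fibre N (filter top? xs) (AllPairs.filter⁺ top? rs) (All.filter⁺ top? gs) (All.all-filter top? xs))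
      (≤-fibres {R} {G} h N c fibre (filter (λ x → ¬? (top? x)) xs)
        (AllPairs.filter⁺ (λ x → ¬? (top? x)) rs) (All.filter⁺ (λ x → ¬? (top? x)) gs)
        (All.zipWith (λ (lt , ≢N) → ℕ.≤∧≢⇒< (ℕ.s≤s⁻¹ lt) ≢N)
          (All.filter⁺ (λ x → ¬? (top? x)) h< , All.all-filter (λ x → ¬? (top? x)) xs))))
    where
    top? : Decidable (λ x → h x ≡ N)
    top? x = h x ℕ.≟ N

  length≤2 : ∀ {R : Rel A 0ℓ} {G : Pred A 0ℓ} →
    (∀ {x y z} → R x y → R x z → R y z → G x → G y → G z → ⊥) →
    ∀ xs → AllPairs R xs → All G xs → length xs ℕ.≤ 2
  length≤2 no-three []               _ _ = z≤n
  length≤2 no-three (x ∷ [])         _ _ = s≤s z≤n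
  length≤2 no-three (x ∷ y ∷ [])     _ _ = ℕ.≤-refl
  length≤2 no-three (x ∷ y ∷ z ∷ xs) ((xy ∷ xz ∷ _) ∷ (yz ∷ _) ∷ _) (gx ∷ gy ∷ gz ∷ _) =
    contradiction gz (no-three xy xz yz gx gy)

  sumPairs : (A → A → ℕ) → List A → ℕ
  sumPairs h (x ∷ xs@(y ∷ _)) = h x y ℕ.+ sumPairs h xs
  sumPairs h _                = 0

  sumPairs-mono : ∀ {R : Rel A 0ℓ} {h k} → (∀ {x y} → R x y → h x y ℕ.≤ k x y) →
                  ∀ {xs} → Linked R xs → sumPairs h xs ℕ.≤ sumPairs k xs
  sumPairs-mono h≤k []       = z≤n
  sumPairs-mono h≤k [-]      = z≤n
  sumPairs-mono h≤k (r ∷ rs) = ℕ.+-mono-≤ (h≤k r) (sumPairs-mono h≤k rs)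

  sumPairs-+ : ∀ h k xs → sumPairs (λ x y → h x y ℕ.+ k x y) xs ≡ sumPairs h xs ℕ.+ sumPairs k xs
  sumPairs-+ h k []       = ≡.refl
  sumPairs-+ h k (x ∷ []) = ≡.refl
  sumPairs-+ h k (x ∷ xs@(y ∷ _)) = ≡.trans (≡.cong (h x y ℕ.+ k x y ℕ.+_) (sumPairs-+ h k xs))
    (solve 4 (λ a b c d → (a :+ b) :+ (c :+ d) := (a :+ c) :+ (b :+ d)) ≡.refl (h x y) (k x y) (sumPairs h xs)
        (sumPairs k xs))
    where open +-*-Solver

  sumPairs-* : ∀ c h xs → sumPairs (λ x y → c ℕ.* h x y) xs ≡ c ℕ.* sumPairs h xs
  sumPairs-* c h []       = ≡.sym (ℕ.*-zeroʳ c)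
  sumPairs-* c h (x ∷ []) = ≡.sym (ℕ.*-zeroʳ c)
  sumPairs-* c h (x ∷ xs@(y ∷ _)) = ≡.trans (≡.cong (c ℕ.* h x y ℕ.+_) (sumPairs-* c h xs))
      (≡.sym (ℕ.*-distribˡ-+ c (h x y) _))

  sumPairs-const : ∀ c x xs → sumPairs (λ _ _ → c) (x ∷ xs) ≡ length xs ℕ.* c
  sumPairs-const c x []       = ≡.refl
  sumPairs-const c x (y ∷ xs) = ≡.cong (c ℕ.+_) (sumPairs-const c y xs)

  -- The differences of a monotone h telescope to its last value minus its first.
  sumPairs-∣-∣ : ∀ c (h : A → ℕ) → (∀ x → h x ℕ.≤ c) → ∀ {xs} → Linked (λ x y → h x ℕ.≤ h y) xs →
                 sumPairs (λ x y → ℕ.∣ h x - h y ∣) xs ℕ.≤ c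
  sumPairs-∣-∣ c h h≤c {[]}     _  = z≤n
  sumPairs-∣-∣ c h h≤c {x ∷ xs} up = ℕ.≤-trans (ℕ.m≤m+n _ (h x)) (telescope x xs up)
    where
    telescope : ∀ x xs → Linked (λ x y → h x ℕ.≤ h y) (x ∷ xs) →
                sumPairs (λ x y → ℕ.∣ h x - h y ∣) (x ∷ xs) ℕ.+ h x ℕ.≤ c
    telescope x []       _         = h≤c x
    telescope x (y ∷ xs) (le ∷ up) = ℕ.≤-trans (ℕ.≤-reflexive (≡.trans
      (solve 3 (λ a b c → (a :+ b) :+ c := b :+ (a :+ c)) ≡.refl ℕ.∣ h x - h y ∣ _ (h x))
      (≡.cong (sumPairs (λ x y → ℕ.∣ h x - h y ∣) (y ∷ xs) ℕ.+_) (m≤n⇒∣m-n∣+m≡n le))))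
      (telescope y xs up)
      where open +-*-Solver

  -- If no three consecutive elements are constant under the change δ, then
  -- every second step is a change.
  length≤2changes : ∀ {R : Rel A 0ℓ} (δ : A → A → ℕ) →
    (∀ {x y z} → R x y → R x z → R y z → δ x y ≡ 0 → δ y z ≡ 0 → ⊥) →
    ∀ {xs} → AllPairs R xs → length xs ℕ.≤ 2 ℕ.* sumPairs δ xs ℕ.+ 2
  length≤2changes δ no-three {[]}         _ = z≤n
  length≤2changes δ no-three {x ∷ []}     _ = s≤s z≤n
  length≤2changes δ no-three {x ∷ y ∷ []} _ = ℕ.m≤n+m 2 _
  length≤2changes δ no-three {x ∷ y ∷ z ∷ xs} ((xy ∷ xz ∷ _) ∷ (yz ∷ rs) ∷ rss)
    with δ x y in eq₁ | δ y z in eq₂ | length≤2changes δ no-three ((yz ∷ rs) ∷ rss) | length≤2changes δ no-three rss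
  ... | zero  | zero  | _  | _  = contradiction eq₂ (no-three xy xz yz eq₁)
  ... | suc a | _     | ih | _  = ℕ.≤-trans (s≤s ih) (ℕ.≤-trans (s≤s (ℕ.m≤n+m _ (2 ℕ.* a ℕ.+ 1))) (ℕ.≤-reflexive
    (solve 2 (λ a t → con 1 :+ (con 2 :* a :+ con 1 :+ (con 2 :* t :+ con 2)) := con 2 :*
        (con 1 :+ a :+ t) :+ con 2) ≡.refl a _)))
    where open +-*-Solver
  ... | zero  | suc b | _  | ih = ℕ.≤-trans (s≤s (s≤s ih)) (ℕ.≤-trans (s≤s (s≤s (ℕ.m≤n+m _ (2 ℕ.* b)))) (ℕ.≤-reflexive
    (solve 2 (λ b t → con 2 :+ (con 2 :* b :+ (con 2 :* t :+ con 2)) := con 2 :* (con 1 :+ b :+ t) :+ con 2) ≡.refl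
        b _)))
    where open +-*-Solver

module _ {A B : Set} where
  sumPairs-sumOver : ∀ (h : B → A → A → ℕ) bs xs →
    sumPairs (λ x y → sumOver (λ b → h b x y) bs) xs ≡ sumOver (λ b → sumPairs (h b) xs) bs
  sumPairs-sumOver h bs []       = ≡.sym (sumOver-zero bs)
  sumPairs-sumOver h bs (x ∷ []) = ≡.sym (sumOver-zero bs)
  sumPairs-sumOver h bs (x ∷ xs@(y ∷ _)) = ≡.trans (≡.cong (sumOver (λ b → h b x y) bs ℕ.+_)
      (sumPairs-sumOver h bs xs))
    (≡.sym (sumOver-+ (λ b → h b x y) (λ b → sumPairs (h b) xs) bs))

  -- Colours may overlap. If the first one is too rare, its elements are removed and c is the
  -- frequent colour of the rest. The rarity of b then makes b rarer than c, so c pays for the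
  -- removed elements as well.
  pigeonhole : ∀ {R : B → A → Set} (R? : ∀ b a → Dec (R b a)) b bs xs → All (λ x → Any (λ b → R b x) (b ∷ bs)) xs →
               ∃[ c ] length xs ℕ.≤ suc (length bs) ℕ.* length (filter (R? c) xs)
  pigeonhole {R} R? b []        xs coloured = b , ℕ.≤-reflexive
      (≡.trans (≡.sym (≡.cong length (List.filter-all (R? b) (All.map single coloured)))) (≡.sym (ℕ.+-identityʳ _)))
    where
    single : ∀ {x} → Any (λ b → R b x) (b ∷ []) → R b x
    single (here r) = r
  pigeonhole {R} R? b (b′ ∷ bs) xs coloured with length xs ℕ.≤? suc (length (b′ ∷ bs)) ℕ.* length (filter (R? b) xs)
  ... | yes le = b , le
  ... | no ≰ with pigeonhole R? b′ bs rest (All.zipWith other (All.filter⁺ other? coloured ,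
      All.all-filter other? xs))
    where
    other? = λ x → ¬? (R? b x)
    rest = filter other? xs
    other : ∀ {x} → Any (λ b → R b x) (b ∷ b′ ∷ bs) × ¬ R b x → Any (λ b → R b x) (b′ ∷ bs)
    other (here r , ¬r)  = contradiction r ¬r
    other (there a , _)  = a
  ... | c , |rest|≤ = c , ℕ.≤-trans (ℕ.≤-reflexive (length-filter-¬ (R? b) xs))
      (ℕ.+-mono-≤ first≤ (ℕ.≤-trans |rest|≤ (ℕ.*-monoʳ-≤ N sub)))
    where
    N = suc (length bs)
    other? = λ x → ¬? (R? b x)
    rest = filter other? xs
    p = length (filter (R? b) xs)
    q = length (filter (R? c) xs)

    filter-filter : ∀ xs → length (filter (R? c) (filter other? xs)) ℕ.≤ length (filter (R? c) xs)
    filter-filter []       = z≤n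
    filter-filter (x ∷ xs) with R? b x
    filter-filter (x ∷ xs) | yes _ with R? c x
    ... | yes _ = ℕ.m≤n⇒m≤1+n (filter-filter xs)
    ... | no _  = filter-filter xs
    filter-filter (x ∷ xs) | no _ with R? c x
    ... | yes _ = s≤s (filter-filter xs)
    ... | no _  = filter-filter xs

    sub : length (filter (R? c) rest) ℕ.≤ q
    sub = filter-filter xs

    first≤ : p ℕ.≤ q
    first≤ = ℕ.<⇒≤ (ℕ.*-cancelˡ-< N p q (ℕ.+-cancelˡ-< p (N ℕ.* p) (N ℕ.* q) (ℕ.<-≤-trans (ℕ.≰⇒> ≰)
      (ℕ.≤-trans (ℕ.≤-reflexive (length-filter-¬ (R? b) xs)) (ℕ.+-monoʳ-≤ p
          (ℕ.≤-trans |rest|≤ (ℕ.*-monoʳ-≤ N sub)))))))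

-- Here suc e is the number of points of a path on the curve, T bounds the total
-- variation of the ranks along it, and good counts the pairs of a point p and a
-- step of the path whose ranks differ by less than w; the choice is w ≈ 2 T / e.
counting-bound : ∀ {n e T D K} → 1 ℕ.≤ e → 1 ℕ.≤ D → T ≡ D ℕ.* K →
  e ℕ.≤ 4 ℕ.* T ℕ.+ 1 →
  (∀ w → 1 ℕ.≤ w → ∃[ good ] n ℕ.* (e ℕ.* w) ℕ.≤ w ℕ.* good ℕ.+ n ℕ.* T × good ℕ.≤ e ℕ.* (D ℕ.* (2 ℕ.* w ℕ.* 2))) →
  n ℕ.* suc e ℕ.≤ (96 ℕ.* K ℕ.+ 16) ℕ.* (D ℕ.* D)
counting-bound {n} {e} {T} {D} {K} 1≤e 1≤D T≡ e≤ close = goal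
  where
  open +-*-Solver
  open ℕ.≤-Reasoning
  instance
    e≢0 : ℕ.NonZero e
    e≢0 = ℕ.>-nonZero 1≤e

  -- Rounding up ensures 2 T ≤ e w, which leaves at least half of the pairs close. It costs at most
  -- e, and e ≤ 4 T + 1 keeps e w of order T.
  w : ℕ
  w = suc (2 ℕ.* T / e)

  2T≤ew : 2 ℕ.* T ℕ.≤ e ℕ.* w
  2T≤ew = begin
    2 ℕ.* T                                  ≡⟨ m≡m%n+[m/n]*n (2 ℕ.* T) e ⟩
    (2 ℕ.* T) % e ℕ.+ 2 ℕ.* T / e ℕ.* e      ≤⟨ ℕ.+-monoˡ-≤ _ (ℕ.<⇒≤ (m%n<n (2 ℕ.* T) e)) ⟩
    w ℕ.* e                                  ≡⟨ ℕ.*-comm w e ⟩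
    e ℕ.* w                                  ∎

  ew≤ : e ℕ.* w ℕ.≤ 6 ℕ.* T ℕ.+ 1
  ew≤ = begin
    e ℕ.* w                              ≡⟨ ℕ.*-comm e w ⟩
    e ℕ.+ 2 ℕ.* T / e ℕ.* e              ≤⟨ ℕ.+-mono-≤ e≤ (m/n*n≤m (2 ℕ.* T) e) ⟩
    4 ℕ.* T ℕ.+ 1 ℕ.+ 2 ℕ.* T            ≡⟨ solve 1 (λ t → con 4 :* t :+ con 1 :+ con 2 :* t := con 6 :* t :+ con 1)
        ≡.refl T ⟩
    6 ℕ.* T ℕ.+ 1                        ∎

  g : ℕ
  g = proj₁ (close w (s≤s z≤n))

  ne≤2g : n ℕ.* e ℕ.≤ 2 ℕ.* g
  ne≤2g = ℕ.*-cancelʳ-≤ (n ℕ.* e) (2 ℕ.* g) w (ℕ.+-cancelʳ-≤ (n ℕ.* (e ℕ.* w)) _ _ (begin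
    n ℕ.* e ℕ.* w ℕ.+ n ℕ.* (e ℕ.* w)        ≡⟨ solve 3 (λ n e w → n :* e :* w :+ n :* (e :* w) := con 2 :*
        (n :* (e :* w))) ≡.refl n e w ⟩
    2 ℕ.* (n ℕ.* (e ℕ.* w))                  ≤⟨ ℕ.*-monoʳ-≤ 2 (proj₁ (proj₂ (close w (s≤s z≤n)))) ⟩
    2 ℕ.* (w ℕ.* g ℕ.+ n ℕ.* T)              ≡⟨ solve 4 (λ w g n t →
        con 2 :* (w :* g :+ n :* t) := con 2 :* g :* w :+ n :* (con 2 :* t)) ≡.refl w g n T ⟩
    2 ℕ.* g ℕ.* w ℕ.+ n ℕ.* (2 ℕ.* T)        ≤⟨ ℕ.+-monoʳ-≤ (2 ℕ.* g ℕ.* w) (ℕ.*-monoʳ-≤ n 2T≤ew) ⟩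
    2 ℕ.* g ℕ.* w ℕ.+ n ℕ.* (e ℕ.* w)        ∎))

  ne≤8Dew : n ℕ.* e ℕ.≤ 8 ℕ.* D ℕ.* (e ℕ.* w)
  ne≤8Dew = begin
    n ℕ.* e                                  ≤⟨ ne≤2g ⟩
    2 ℕ.* g                                  ≤⟨ ℕ.*-monoʳ-≤ 2 (proj₂ (proj₂ (close w (s≤s z≤n)))) ⟩
    2 ℕ.* (e ℕ.* (D ℕ.* (2 ℕ.* w ℕ.* 2)))    ≡⟨ solve 3 (λ e d w →
        con 2 :* (e :* (d :* (con 2 :* w :* con 2))) := con 8 :* d :* (e :* w)) ≡.refl e D w ⟩
    8 ℕ.* D ℕ.* (e ℕ.* w)                    ∎

  -- The constant is 2 · 8 · (6 K + 1): the 2 passes from e + 1 to e, the 8 comes from the close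
  -- pairs, and D ≥ 1 absorbs the last summand of 6 T + 1.
  goal : n ℕ.* suc e ℕ.≤ (96 ℕ.* K ℕ.+ 16) ℕ.* (D ℕ.* D)
  goal = begin
    n ℕ.* suc e                              ≤⟨ ℕ.*-monoʳ-≤ n (ℕ.+-monoˡ-≤ e 1≤e) ⟩
    n ℕ.* (e ℕ.+ e)                          ≡⟨ solve 2 (λ n e → n :* (e :+ e) := con 2 :* (n :* e)) ≡.refl n e ⟩
    2 ℕ.* (n ℕ.* e)                          ≤⟨ ℕ.*-monoʳ-≤ 2 ne≤8Dew ⟩
    2 ℕ.* (8 ℕ.* D ℕ.* (e ℕ.* w))            ≤⟨ ℕ.*-monoʳ-≤ 2 (ℕ.*-monoʳ-≤ (8 ℕ.* D) ew≤) ⟩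
    2 ℕ.* (8 ℕ.* D ℕ.* (6 ℕ.* T ℕ.+ 1))      ≤⟨ ℕ.*-monoʳ-≤ 2 (ℕ.*-monoʳ-≤ (8 ℕ.* D)
        (ℕ.+-mono-≤ (ℕ.≤-reflexive (≡.cong (6 ℕ.*_) T≡)) 1≤D)) ⟩
    2 ℕ.* (8 ℕ.* D ℕ.* (6 ℕ.* (D ℕ.* K) ℕ.+ D)) ≡⟨ solve 2 (λ d k →
        con 2 :* (con 8 :* d :* (con 6 :* (d :* k) :+ d)) := (con 96 :* k :+ con 16) :* (d :* d)) ≡.refl D K ⟩
    (96 ℕ.* K ℕ.+ 16) ℕ.* (D ℕ.* D)          ∎

AllPairs-restrict : ∀ {A : Set} {R : Rel A 0ℓ} {G : Pred A 0ℓ} {xs} → All G xs → AllPairs R xs →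
                    AllPairs (λ x y → R x y × G x × G y) xs
AllPairs-restrict []       []         = []
AllPairs-restrict (g ∷ gs) (rs ∷ rss) =
  All.zipWith (λ (r , g′) → r , g , g′) (rs , gs) ∷ AllPairs-restrict gs rss

-- The numbering respects the order of the signs, so the side of a break is monotone along an
-- increasing path and varies by at most 2 in total.
signIndex : Sign → ℕ
signIndex neg = 0
signIndex zer = 1
signIndex pos = 2

signIndex-injective : ∀ {s t} → signIndex s ≡ signIndex t → s ≡ t
signIndex-injective {neg} {neg} _ = ≡.refl
signIndex-injective {zer} {zer} _ = ≡.refl
signIndex-injective {pos} {pos} _ = ≡.refl

signIndex≤2 : ∀ s → signIndex s ℕ.≤ 2
signIndex≤2 neg = z≤n
signIndex≤2 zer = s≤s z≤n
signIndex≤2 pos = ℕ.≤-refl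

-- Intersections of circles

module Distances (em : ExcludedMiddle 0ℓ) (ℝ : RealField) where
  open PlaneCurves em ℝ public
  open ≤-Reasoning

  Point : Set
  Point = Carrier × Carrier

  infix 4 _≈ₚ_ _≉ₚ_
  _≈ₚ_ _≉ₚ_ : Rel Point 0ℓ
  (x , y) ≈ₚ (x′ , y′) = x ≈ x′ × y ≈ y′
  p ≉ₚ q = ¬ (p ≈ₚ q)

  dist² : Point → Point → Carrier
  dist² (x , y) (x′ , y′) = (x - x′) * (x - x′) + (y - y′) * (y - y′)

  dist²-sym : ∀ p q → dist² p q ≈ dist² q p
  dist²-sym (x , y) (x′ , y′) = solve 4 (λ x y x′ y′ →
    (x :- x′) :* (x :- x′) :+ (y :- y′) :* (y :- y′) := (x′ :- x) :* (x′ :- x) :+ (y′ :- y) :* (y′ :- y)) refl x y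
        x′ y′

  halve-zero : ∀ {x} → x + x ≈ 0# → x ≈ 0#
  halve-zero {x} 2x≈0 with compare x 0#
  ... | tri< x<0 _ _ = contradiction 2x≈0 (<⇒≉ (<-respʳ (+-identityˡ 0#) (+-mono-<-≤ x<0 (<⇒≤ x<0))))
  ... | tri≈ _ x≈0 _ = x≈0
  ... | tri> _ _ 0<x = contradiction (sym 2x≈0) (<⇒≉ (+-pos-nonneg 0<x (<⇒≤ 0<x)))

  sum-of-squares-zero : ∀ {x y} → x * x + y * y ≈ 0# → x ≈ 0# × y ≈ 0#
  sum-of-squares-zero {x} {y} e = root e , root (trans (+-comm _ _) e)
    where
    root : ∀ {x y} → x * x + y * y ≈ 0# → x ≈ 0#
    root {x} {y} e with square-nonneg x
    ... | inj₁ 0<x² = contradiction (sym e) (<⇒≉ (+-pos-nonneg 0<x² (square-nonneg y)))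
    ... | inj₂ 0≈x² with x*y≈0⇒x≈0⊎y≈0 (sym 0≈x²)
    ...   | inj₁ x≈0 = x≈0
    ...   | inj₂ x≈0 = x≈0

  -- For d = (d₁ , d₂) ≠ 0, a vector u orthogonal to d is determined by the
  -- determinant of d and u.
  orthogonal-zero : ∀ {d₁ d₂ u₁ u₂} → d₁ * d₁ + d₂ * d₂ ≉ 0# → d₁ * u₁ + d₂ * u₂ ≈ 0# →
                    d₁ * u₂ - d₂ * u₁ ≈ 0# → u₁ ≈ 0# × u₂ ≈ 0#
  orthogonal-zero {d₁} {d₂} {u₁} {u₂} N≉0 du≈0 det≈0 = *-cancelˡ-≉0 N≉0 first , *-cancelˡ-≉0 N≉0 second
    where
    combine : ∀ {s t} → s ≈ 0# → t ≈ 0# → ∀ a b → a * s + b * t ≈ 0#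
    combine s≈0 t≈0 a b = trans (+-cong (trans (*-congˡ s≈0) (zeroʳ a)) (trans (*-congˡ t≈0) (zeroʳ b)))
        (+-identityˡ 0#)

    first : (d₁ * d₁ + d₂ * d₂) * u₁ ≈ 0#
    first = trans (solve 4 (λ d₁ d₂ u₁ u₂ → (d₁ :* d₁ :+ d₂ :* d₂) :* u₁ := d₁ :* (d₁ :* u₁ :+ d₂ :* u₂) :+
        (:- d₂) :* (d₁ :* u₂ :- d₂ :* u₁)) refl d₁ d₂ u₁ u₂)
      (combine du≈0 det≈0 d₁ (- d₂))

    second : (d₁ * d₁ + d₂ * d₂) * u₂ ≈ 0#
    second = trans (solve 4 (λ d₁ d₂ u₁ u₂ → (d₁ :* d₁ :+ d₂ :* d₂) :* u₂ := d₂ :* (d₁ :* u₁ :+ d₂ :* u₂) :+ d₁ :*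
        (d₁ :* u₂ :- d₂ :* u₁)) refl d₁ d₂ u₁ u₂)
      (combine du≈0 det≈0 d₂ d₁)

  -- Combines det(d , u)² = |d|² |u|² - (d·u)² with det(d , u) det(d , c) = |d|² (u·c) - (d·u)
  -- (d·c). The right-hand side vanishes when d·u = 0 and |c - u| = |c|.
  det-identity : ∀ d₁ d₂ u₁ u₂ c₁ c₂ →
    (d₁ * u₂ - d₂ * u₁) * ((d₁ * u₂ - d₂ * u₁) - ((d₁ * c₂ - d₂ * c₁) + (d₁ * c₂ - d₂ * c₁))) ≈
    (d₁ * d₁ + d₂ * d₂) * (((c₁ - u₁) * (c₁ - u₁) + (c₂ - u₂) * (c₂ - u₂)) - (c₁ * c₁ + c₂ * c₂))
    + (((c₁ * d₁ + c₂ * d₂) + (c₁ * d₁ + c₂ * d₂)) - (d₁ * u₁ + d₂ * u₂)) * (d₁ * u₁ + d₂ * u₂)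
  det-identity = solve 6 (λ d₁ d₂ u₁ u₂ c₁ c₂ →
    (d₁ :* u₂ :- d₂ :* u₁) :* ((d₁ :* u₂ :- d₂ :* u₁) :- ((d₁ :* c₂ :- d₂ :* c₁) :+ (d₁ :* c₂ :- d₂ :* c₁)))
    := (d₁ :* d₁ :+ d₂ :* d₂) :* (((c₁ :- u₁) :* (c₁ :- u₁) :+ (c₂ :- u₂) :* (c₂ :- u₂)) :- (c₁ :* c₁ :+ c₂ :* c₂))
    :+ (((c₁ :* d₁ :+ c₂ :* d₂) :+ (c₁ :* d₁ :+ c₂ :* d₂)) :- (d₁ :* u₁ :+ d₂ :* u₂)) :* (d₁ :* u₁ :+ d₂ :* u₂)) refl

  -- The second intersection p of the circles about z and z′ through p₁: with
  -- d = z - z′, c = z - p₁ and u = p - p₁ one has d·u = 0 and u·u = 2 c·u, so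
  -- det(d , u) is 0 or 2 det(d , c).
  module _ {z₁ z₂ z′₁ z′₂ a₁ a₂ : Carrier} where
    private
      d₁ d₂ : Carrier
      d₁ = z₁ - z′₁
      d₂ = z₂ - z′₂

    det : Carrier → Carrier → Carrier
    det p₁ p₂ = d₁ * (p₂ - a₂) - d₂ * (p₁ - a₁)

    opaque
      -- The common chord is orthogonal to the line of centres: the difference of the two equations
      -- is twice this scalar product.
      difference-orthogonal : ∀ {p₁ p₂} → dist² (z₁ , z₂) (a₁ , a₂) ≈ dist² (z₁ , z₂) (p₁ , p₂) →
        dist² (z′₁ , z′₂) (a₁ , a₂) ≈ dist² (z′₁ , z′₂) (p₁ , p₂) → d₁ * (p₁ - a₁) + d₂ * (p₂ - a₂) ≈ 0#
      difference-orthogonal {p₁} {p₂} e e′ = halve-zero (trans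
        (solve 8 (λ z₁ z₂ z′₁ z′₂ a₁ a₂ p₁ p₂ →
          ((z₁ :- z′₁) :* (p₁ :- a₁) :+ (z₂ :- z′₂) :* (p₂ :- a₂)) :+
              ((z₁ :- z′₁) :* (p₁ :- a₁) :+ (z₂ :- z′₂) :* (p₂ :- a₂))
          := (((z₁ :- a₁) :* (z₁ :- a₁) :+ (z₂ :- a₂) :* (z₂ :- a₂)) :-
              ((z₁ :- p₁) :* (z₁ :- p₁) :+ (z₂ :- p₂) :* (z₂ :- p₂)))
          :- (((z′₁ :- a₁) :* (z′₁ :- a₁) :+ (z′₂ :- a₂) :* (z′₂ :- a₂)) :-
              ((z′₁ :- p₁) :* (z′₁ :- p₁) :+ (z′₂ :- p₂) :* (z′₂ :- p₂))))
          refl z₁ z₂ z′₁ z′₂ a₁ a₂ p₁ p₂)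
        (trans (+-cong (x≈y⇒x-y≈0 e) (trans (-‿cong (x≈y⇒x-y≈0 e′)) -0≈0)) (+-identityˡ 0#)))

      det-values : ∀ {p₁ p₂} → dist² (z₁ , z₂) (a₁ , a₂) ≈ dist² (z₁ , z₂) (p₁ , p₂) →
        dist² (z′₁ , z′₂) (a₁ , a₂) ≈ dist² (z′₁ , z′₂) (p₁ , p₂) →
        det p₁ p₂ ≈ 0# ⊎ det p₁ p₂ ≈ det z₁ z₂ + det z₁ z₂
      det-values {p₁} {p₂} e e′ = Sum.map₂ x-y≈0⇒x≈y (x*y≈0⇒x≈0⊎y≈0 product)
        where
        u·u≈2c·u : (z₁ - a₁ - (p₁ - a₁)) * (z₁ - a₁ - (p₁ - a₁)) + (z₂ - a₂ - (p₂ - a₂)) * (z₂ - a₂ - (p₂ - a₂))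
                   - dist² (z₁ , z₂) (a₁ , a₂) ≈ 0#
        u·u≈2c·u = x≈y⇒x-y≈0 (trans (solve 6 (λ z₁ z₂ a₁ a₂ p₁ p₂ →
          (z₁ :- a₁ :- (p₁ :- a₁)) :* (z₁ :- a₁ :- (p₁ :- a₁)) :+ (z₂ :- a₂ :- (p₂ :- a₂)) :* (z₂ :- a₂ :- (p₂ :- a₂))
          := (z₁ :- p₁) :* (z₁ :- p₁) :+ (z₂ :- p₂) :* (z₂ :- p₂)) refl z₁ z₂ a₁ a₂ p₁ p₂) (sym e))

        product : det p₁ p₂ * (det p₁ p₂ - (det z₁ z₂ + det z₁ z₂)) ≈ 0#
        product = trans (det-identity d₁ d₂ (p₁ - a₁) (p₂ - a₂) (z₁ - a₁) (z₂ - a₂))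
          (trans (+-cong (trans (*-congˡ u·u≈2c·u) (zeroʳ _)) (trans (*-congˡ (difference-orthogonal e e′))
              (zeroʳ _)))
            (+-identityˡ 0#))

  opaque
    -- p and q have determinant 0 or 2 det(d , z - a) each. The value 0 belongs to a alone, so both
    -- have the other value, and then p - q is orthogonal to d with determinant 0.
    circles-meet-twice : ∀ {z z′ a p q} → z ≉ₚ z′ → a ≉ₚ p → a ≉ₚ q → p ≉ₚ q →
      dist² z a ≈ dist² z p → dist² z a ≈ dist² z q → dist² z′ a ≈ dist² z′ p → dist² z′ a ≈ dist² z′ q → ⊥
    circles-meet-twice {z₁ , z₂} {z′₁ , z′₂} {a₁ , a₂} {p₁ , p₂} {q₁ , q₂} z≉z′ a≉p a≉q p≉q ep eq ep′ eq′ =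
      impossible (det-values {z₁} {z₂} {z′₁} {z′₂} {a₁} {a₂} ep ep′)
          (det-values {z₁} {z₂} {z′₁} {z′₂} {a₁} {a₂} eq eq′)
      where
      d₁ d₂ : Carrier
      d₁ = z₁ - z′₁
      d₂ = z₂ - z′₂

      Δ : Carrier → Carrier → Carrier
      Δ = det {z₁} {z₂} {z′₁} {z′₂} {a₁} {a₂}

      N≉0 : d₁ * d₁ + d₂ * d₂ ≉ 0#
      N≉0 N≈0 = z≉z′ (x-y≈0⇒x≈y (proj₁ (sum-of-squares-zero N≈0)) , x-y≈0⇒x≈y (proj₂ (sum-of-squares-zero N≈0)))

      ⊥p : d₁ * (p₁ - a₁) + d₂ * (p₂ - a₂) ≈ 0#
      ⊥p = difference-orthogonal ep ep′

      ⊥q : d₁ * (q₁ - a₁) + d₂ * (q₂ - a₂) ≈ 0#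
      ⊥q = difference-orthogonal eq eq′

      distinct : ∀ {p₁ p₂} → (a₁ , a₂) ≉ₚ (p₁ , p₂) → d₁ * (p₁ - a₁) + d₂ * (p₂ - a₂) ≈ 0# → Δ p₁ p₂ ≉ 0#
      distinct a≉p ⊥p Δ≈0 = a≉p (Product.map (λ e → sym (x-y≈0⇒x≈y e)) (λ e → sym (x-y≈0⇒x≈y e))
          (orthogonal-zero N≉0 ⊥p Δ≈0))

      same : Δ p₁ p₂ ≈ Δ q₁ q₂ → ⊥
      same Δp≈Δq = p≉q (Product.map x-y≈0⇒x≈y x-y≈0⇒x≈y (orthogonal-zero {d₁} {d₂} {p₁ - q₁} {p₂ - q₂} N≉0
        (trans (solve 8 (λ d₁ d₂ a₁ a₂ p₁ p₂ q₁ q₂ → d₁ :* (p₁ :- q₁) :+ d₂ :* (p₂ :- q₂)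
            := (d₁ :* (p₁ :- a₁) :+ d₂ :* (p₂ :- a₂)) :- (d₁ :* (q₁ :- a₁) :+ d₂ :* (q₂ :- a₂))) refl d₁ d₂ a₁ a₂ p₁
                p₂ q₁ q₂)
          (x≈y⇒x-y≈0 (trans ⊥p (sym ⊥q))))
        (trans (solve 8 (λ d₁ d₂ a₁ a₂ p₁ p₂ q₁ q₂ → d₁ :* (p₂ :- q₂) :- d₂ :* (p₁ :- q₁)
            := (d₁ :* (p₂ :- a₂) :- d₂ :* (p₁ :- a₁)) :- (d₁ :* (q₂ :- a₂) :- d₂ :* (q₁ :- a₁))) refl d₁ d₂ a₁ a₂ p₁
                p₂ q₁ q₂)
          (x≈y⇒x-y≈0 Δp≈Δq))))

      impossible : Δ p₁ p₂ ≈ 0# ⊎ Δ p₁ p₂ ≈ Δ z₁ z₂ + Δ z₁ z₂ → Δ q₁ q₂ ≈ 0# ⊎ Δ q₁ q₂ ≈ Δ z₁ z₂ + Δ z₁ z₂ → ⊥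
      impossible (inj₁ Δp≈0) _           = distinct a≉p ⊥p Δp≈0
      impossible (inj₂ _)    (inj₁ Δq≈0) = distinct a≉q ⊥q Δq≈0
      impossible (inj₂ e)    (inj₂ e′)   = same (trans e (sym e′))

  -- Ranks of distances and their variation along a path

  above : Carrier → Carrier → ℕ
  above v t = indicator (v <? t)

  above≤1 : ∀ v t → above v t ℕ.≤ 1
  above≤1 v t with v <? t
  ... | yes _ = ℕ.≤-refl
  ... | no _  = z≤n

  above-mono : ∀ v {s t} → s ≤ t → above v s ℕ.≤ above v t
  above-mono v {s} {t} s≤t with v <? s | v <? t
  ... | no _    | _      = z≤n
  ... | yes _   | yes _  = ℕ.≤-refl
  ... | yes v<s | no v≮t = contradiction (<-≤-trans v<s s≤t) v≮t

  above-cong : ∀ v {s t} → (v < s → v < t) → (v < t → v < s) → above v s ≡ above v t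
  above-cong v {s} {t} f g with v <? s | v <? t
  ... | yes _   | yes _   = ≡.refl
  ... | no _    | no _    = ≡.refl
  ... | yes v<s | no v≮t  = contradiction (f v<s) v≮t
  ... | no v≮s  | yes v<t = contradiction (g v<t) v≮s

  -- As a sum over levels, the rank varies along a path by at most the number of crossings of all
  -- levels.
  rank : List Carrier → Carrier → ℕ
  rank S t = sumOver (λ v → above v t) S

  -- The level s itself counts for t but not for s, because `above` is strict.
  rank-strict : ∀ {S s t} → Any (s ≈_) S → s < t → rank S s ℕ.< rank S t
  rank-strict {v ∷ S} {s} {t} (here s≈v) s<t with v <? s | v <? t
  ... | yes v<s | _      = contradiction (sym s≈v) (<⇒≉ v<s)
  ... | no _    | no v≮t = contradiction (<-respˡ s≈v s<t) v≮t
  ... | no _    | yes _  = s≤s (sumOver-mono (All.universal (λ v → above-mono v (<⇒≤ s<t)) S))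
  rank-strict {v ∷ S} (there s∈S) s<t = ℕ.+-mono-≤-< (above-mono v (<⇒≤ s<t)) (rank-strict s∈S s<t)

  rank-bounded : ∀ {S t} → Any (t ≈_) S → rank S t ℕ.< length S
  rank-bounded {v ∷ S} {t} (here t≈v) with v <? t
  ... | yes v<t = contradiction (sym t≈v) (<⇒≉ v<t)
  ... | no _    = s≤s (ℕ.≤-trans (sumOver-≤ 1 (All.universal (λ v → above≤1 v t) S))
      (ℕ.≤-reflexive (ℕ.*-identityʳ _)))
  rank-bounded {v ∷ S} {t} (there t∈S) = ℕ.+-mono-≤-< (above≤1 v t) (rank-bounded t∈S)

  rank-injective : ∀ {S s t} → Any (s ≈_) S → Any (t ≈_) S → rank S s ≡ rank S t → s ≈ t
  rank-injective {S} {s} {t} s∈S t∈S e with compare s t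
  ... | tri< s<t _ _ = contradiction e (ℕ.<⇒≢ (rank-strict s∈S s<t))
  ... | tri≈ _ s≈t _ = s≈t
  ... | tri> _ _ t<s = contradiction (≡.sym e) (ℕ.<⇒≢ (rank-strict t∈S t<s))

  side : Carrier → Carrier → ℕ
  side b x = signIndex (sgn (x - b))

  side-mono : ∀ b {x y} → x ≤ y → side b x ℕ.≤ side b y
  side-mono b {x} {y} x≤y with compare (x - b) 0# | compare (y - b) 0#
  ... | tri< _ _ _     | _              = z≤n
  ... | tri≈ _ _ _     | tri≈ _ _ _     = ℕ.≤-refl
  ... | tri≈ _ _ _     | tri> _ _ _     = s≤s z≤n
  ... | tri> _ _ _     | tri> _ _ _     = ℕ.≤-refl
  ... | tri≈ _ x-b≈0 _ | tri< y-b<0 _ _ = contradiction y-b<0 (≤⇒≯ (≤-respˡ x-b≈0 (+-monoˡ-≤ (- b) x≤y)))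
  ... | tri> _ _ 0<x-b | tri< y-b<0 _ _ = contradiction y-b<0 (≤⇒≯ (<⇒≤ (<-≤-trans 0<x-b (+-monoˡ-≤ (- b) x≤y))))
  ... | tri> _ _ 0<x-b | tri≈ _ y-b≈0 _ = contradiction (<-≤-trans 0<x-b (≤-respʳ y-b≈0 (+-monoˡ-≤ (- b) x≤y)))
      (<-irrefl refl)

  sides-equal : ∀ B {x y} → sumOver (λ b → ℕ.∣ side b x - side b y ∣) B ≡ 0 → SameSide B x y
  sides-equal []      _ = []
  sides-equal (b ∷ B) {x} {y} e = signIndex-injective (ℕ.∣m-n∣≡0⇒m≡n (ℕ.m+n≡0⇒m≡0 ℕ.∣ side b x - side b y ∣ e)) ∷
    sides-equal B (ℕ.m+n≡0⇒n≡0 ℕ.∣ side b x - side b y ∣ e)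

  Realises : List Carrier → Pred Point 0ℓ → Pred Point 0ℓ
  Realises S G p = ∀ z → G z → Any (dist² z p ≈_) S

  opaque
    -- The ranks from z and from z′ fix both distances of p, which leaves at most two points. There
    -- are `length S` ranks from z, and for each of them at most 2 w ranks from z′ that are close to
    -- it.
    close-pairs : ∀ S (G : Pred Point 0ℓ) w {z z′} → G z → G z′ → z ≉ₚ z′ → ∀ P → AllPairs _≉ₚ_ P →
      All (Realises S G) P → All (λ p → ℕ.∣ rank S (dist² z p) - rank S (dist² z′ p) ∣ ℕ.< w) P →
      length P ℕ.≤ length S ℕ.* (2 ℕ.* w ℕ.* 2)
    close-pairs S G w {z} {z′} gz gz′ z≉z′ P distinct realises close =
      ≤-fibres {G = Close} r (length S) _ same-rank P distinct (All.zip (realises , close))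
          (All.map (λ h → rank-bounded (h z gz)) realises)
      where
      r r′ offset : Point → ℕ
      r p = rank S (dist² z p)
      r′ p = rank S (dist² z′ p)
      -- The shift by w keeps the truncated subtraction exact, since r p ≤ w + r′ p for close ranks.
      offset p = w ℕ.+ r′ p ℕ.∸ r p

      Close : Pred Point 0ℓ
      Close p = Realises S G p × ℕ.∣ r p - r′ p ∣ ℕ.< w

      r<w+r′ : ∀ {p} → Close p → r p ℕ.≤ w ℕ.+ r′ p
      r<w+r′ {p} (_ , c) = ℕ.≤-trans (ℕ.m≤∣m-n∣+n (r p) (r′ p)) (ℕ.+-monoˡ-≤ (r′ p) (ℕ.<⇒≤ c))

      offset-bound : ∀ {p} → Close p → offset p ℕ.< 2 ℕ.* w
      offset-bound {p} (_ , c) = ℕ.≤-<-trans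
        (ℕ.≤-trans (ℕ.∸-monoˡ-≤ (r p) (ℕ.+-monoʳ-≤ w (ℕ.m≤n+∣m-n∣ (r′ p) (r p))))
          (ℕ.≤-reflexive (≡.trans (≡.cong (ℕ._∸ r p) (≡.trans (≡.sym (ℕ.+-assoc w (r p) _))
              (≡.trans (≡.cong (ℕ._+ ℕ.∣ r′ p - r p ∣) (ℕ.+-comm w (r p))) (ℕ.+-assoc (r p) w _))))
            (ℕ.m+n∸m≡n (r p) _))))
        (ℕ.<-≤-trans (ℕ.+-monoʳ-< w (≡.subst (ℕ._< w) (ℕ.∣-∣-comm (r p) (r′ p)) c))
            (ℕ.≤-reflexive (≡.cong (w ℕ.+_) (≡.sym (ℕ.+-identityʳ w)))))

      Bucket : ℕ → ℕ → Pred Point 0ℓ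
      Bucket j i p = (Close p × r p ≡ j) × offset p ≡ i

      r′-determined : ∀ {p q j i} → Bucket j i p → Bucket j i q → r′ p ≡ r′ q
      r′-determined {p} {q} ((cp , rp) , op) ((cq , rq) , oq) =
          ℕ.+-cancelˡ-≡ w _ _ (≡.trans (≡.sym (ℕ.m∸n+n≡m (r<w+r′ cp)))
        (≡.trans (≡.cong₂ ℕ._+_ (≡.trans op (≡.sym oq)) (≡.trans rp (≡.sym rq))) (ℕ.m∸n+n≡m (r<w+r′ cq))))

      r-equal : ∀ {p q j i} → Bucket j i p → Bucket j i q → dist² z p ≈ dist² z q
      r-equal ((cp , rp) , _) ((cq , rq) , _) = rank-injective (proj₁ cp z gz) (proj₁ cq z gz) (≡.trans rp (≡.sym rq))

      r′-equal : ∀ {p q j i} → Bucket j i p → Bucket j i q → dist² z′ p ≈ dist² z′ q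
      r′-equal bp bq = rank-injective (proj₁ (proj₁ (proj₁ bp)) z′ gz′) (proj₁ (proj₁ (proj₁ bq)) z′ gz′)
          (r′-determined bp bq)

      bucket-small : ∀ j i ps → AllPairs _≉ₚ_ ps → All (λ p → Close p × r p ≡ j) ps → All (λ p → offset p ≡ i) ps →
          length ps ℕ.≤ 2
      bucket-small j i ps ds cs os = length≤2 {R = _≉ₚ_} {G = Bucket j i}
        (λ xy xz yz bx by bz → circles-meet-twice z≉z′ xy xz yz (r-equal bx by) (r-equal bx bz) (r′-equal bx by)
            (r′-equal bx bz))
        ps ds (All.zip (cs , os))

      same-rank : ∀ j ps → AllPairs _≉ₚ_ ps → All Close ps → All (λ p → r p ≡ j) ps → length ps ℕ.≤ 2 ℕ.* w ℕ.* 2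
      same-rank j ps ds cs rs = ≤-fibres {G = λ p → Close p × r p ≡ j} offset (2 ℕ.* w) 2 (bucket-small j) ps ds
          (All.zip (cs , rs))
        (All.map offset-bound cs)

  -- ξ orders the points of a piece G of the curve in such a way that every
  -- disk meets G in boundedly many ξ-intervals.
  record Ordering (K : ℕ) (G : Pred Point 0ℓ) : Set where
    field
      ξ      : Point → Carrier
      ξ-cong : ∀ {z z′} → z ≈ₚ z′ → ξ z ≈ ξ z′
      breaks : ∀ p v → ∃[ B ] length B ℕ.≤ K × ∀ z z′ → G z → G z′ → SameSide B (ξ z) (ξ z′) →
               dist² z p ≤ v → dist² z′ p ≤ v

  module _ {K G} (ordering : Ordering K G) (S : List Carrier) where
    open Ordering ordering

    Before : Rel Point 0ℓ
    Before z z′ = ξ z < ξ z′ × G z × G z′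

    variation : Point → Point → Point → ℕ
    variation p z z′ = ℕ.∣ rank S (dist² z p) - rank S (dist² z′ p) ∣

    opaque
      -- A step that crosses the level v changes the side of some break. Since ξ increases along the
      -- path, the side of each break only rises, from 0 to 2 at most.
      level-changes : ∀ p v {zs} → Linked Before zs →
        sumPairs (λ z z′ → ℕ.∣ above v (dist² z p) - above v (dist² z′ p) ∣) zs ℕ.≤ K ℕ.* 2
      level-changes p v {zs} path with breaks p v
      ... | B , |B|≤K , const = ℕ.≤-trans (sumPairs-mono pointwise path)
        (ℕ.≤-trans (ℕ.≤-reflexive (sumPairs-sumOver (λ b z z′ → ℕ.∣ side b (ξ z) - side b (ξ z′) ∣) B zs))
          (ℕ.≤-trans (sumOver-≤ 2 (All.universal (λ b → sumPairs-∣-∣ 2 (λ z → side b (ξ z)) (λ z → signIndex≤2 _)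
              (Linked.map (λ (lt , _) → side-mono b (<⇒≤ lt)) path)) B))
            (ℕ.*-monoˡ-≤ 2 |B|≤K)))
        where
        pointwise : ∀ {z z′} → Before z z′ → ℕ.∣ above v (dist² z p) - above v (dist² z′ p) ∣ ℕ.≤
                    sumOver (λ b → ℕ.∣ side b (ξ z) - side b (ξ z′) ∣) B
        pointwise {z} {z′} (_ , gz , gz′) with sumOver (λ b → ℕ.∣ side b (ξ z) - side b (ξ z′) ∣) B in total
        ... | suc _ = ℕ.≤-trans (ℕ.∣m-n∣≤m⊔n (above v (dist² z p)) (above v (dist² z′ p)))
                        (ℕ.⊔-lub (ℕ.≤-trans (above≤1 v _) (s≤s z≤n)) (ℕ.≤-trans (above≤1 v _) (s≤s z≤n)))
        ... | zero = ℕ.≤-reflexive (ℕ.m≡n⇒∣m-n∣≡0 (above-cong v (transfer gz′ gz (SameSide-sym same))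
            (transfer gz gz′ same)))
          where
          same : SameSide B (ξ z) (ξ z′)
          same = sides-equal B total
          transfer : ∀ {z z′} → G z → G z′ → SameSide B (ξ z) (ξ z′) → v < dist² z′ p → v < dist² z p
          transfer gz gz′ same v< = ≰⇒> (λ ≤v → ≤⇒≯ (const _ _ gz gz′ same ≤v) v<)

    opaque
      total-variation : ∀ p {zs} → Linked Before zs → sumPairs (variation p) zs ℕ.≤ length S ℕ.* (K ℕ.* 2)
      total-variation p {zs} path = ℕ.≤-trans
        (sumPairs-mono (λ {z} {z′} _ → ∣sumOver-sumOver∣≤ (λ v → above v (dist² z p))
            (λ v → above v (dist² z′ p)) S) path)
        (ℕ.≤-trans (ℕ.≤-reflexive (sumPairs-sumOver (λ v z z′ → ℕ.∣ above v (dist² z p) - above v (dist² z′ p) ∣) S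
            zs))
          (sumOver-≤ (K ℕ.* 2) (All.universal (λ v → level-changes p v path) S)))

    Before⇒≉ : ∀ {z z′} → Before z z′ → z ≉ₚ z′
    Before⇒≉ (lt , _) z≈z′ = <⇒≉ lt (ξ-cong z≈z′)

    opaque
      -- The two sets exchange roles in `circles-meet-twice`: the centres are p and q, and three
      -- consecutive points of the path would be the common points. So some rank changes at one of
      -- any two consecutive steps, and the two total variations bound the number of changes.
      path-short : ∀ {p q} → p ≉ₚ q → Realises S G p → Realises S G q → ∀ {zs} → AllPairs Before zs →
                   length zs ℕ.≤ 4 ℕ.* (length S ℕ.* (K ℕ.* 2)) ℕ.+ 2
      path-short {p} {q} p≉q real-p real-q {zs} path = ℕ.≤-trans
        (length≤2changes δ no-three path)
        (ℕ.+-monoˡ-≤ 2 (ℕ.≤-trans (ℕ.*-monoʳ-≤ 2 (ℕ.≤-trans (ℕ.≤-reflexive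
            (sumPairs-+ (variation p) (variation q) zs))
          (ℕ.+-mono-≤ (total-variation p linked) (total-variation q linked))))
          (ℕ.≤-reflexive (solve′ (length S ℕ.* (K ℕ.* 2))))))
        where
        linked : Linked Before zs
        linked = Linked.AllPairs⇒Linked path

        solve′ : ∀ t → 2 ℕ.* (t ℕ.+ t) ≡ 4 ℕ.* t
        solve′ t = ≡.trans (≡.cong (2 ℕ.*_) (≡.cong (t ℕ.+_) (≡.sym (ℕ.+-identityʳ t)))) (≡.sym (ℕ.*-assoc 2 2 t))

        δ : Point → Point → ℕ
        δ z z′ = variation p z z′ ℕ.+ variation q z z′

        equidistant : ∀ {p z z′} → Realises S G p → G z → G z′ → variation p z z′ ≡ 0 → dist² p z ≈ dist² p z′
        equidistant {p} {z} {z′} real gz gz′ e = trans (dist²-sym p z)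
          (trans (rank-injective (real z gz) (real z′ gz′) (ℕ.∣m-n∣≡0⇒m≡n e)) (dist²-sym z′ p))

        no-three : ∀ {x y z} → Before x y → Before x z → Before y z → δ x y ≡ 0 → δ y z ≡ 0 → ⊥
        no-three {x} {y} {z} xy@(_ , gx , gy) xz yz@(_ , _ , gz) δxy δyz = circles-meet-twice p≉q (Before⇒≉ xy)
            (Before⇒≉ xz) (Before⇒≉ yz)
          pxy (trans pxy (equidistant real-p gy gz (ℕ.m+n≡0⇒m≡0 _ δyz))) qxy
              (trans qxy (equidistant real-q gy gz (ℕ.m+n≡0⇒n≡0 (variation p y z) δyz)))
          where
          pxy : dist² p x ≈ dist² p y
          pxy = equidistant real-p gx gy (ℕ.m+n≡0⇒m≡0 _ δxy)
          qxy : dist² q x ≈ dist² q y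
          qxy = equidistant real-q gx gy (ℕ.m+n≡0⇒n≡0 (variation p x y) δxy)

    opaque
      many-distances : ∀ {P zs} → AllPairs _≉ₚ_ P → 2 ℕ.≤ length P → All (Realises S G) P →
        AllPairs Before zs → 3 ℕ.≤ length zs →
        length P ℕ.* length zs ℕ.≤ (96 ℕ.* (K ℕ.* 2) ℕ.+ 16) ℕ.* (length S ℕ.* length S)
      many-distances {P@(p ∷ q ∷ _)} {z ∷ zs@(_ ∷ _ ∷ _)} distinct@((p≉q ∷ _) ∷ _) _ realises@(real-p ∷ real-q ∷ _)
          path _ =
        counting-bound {n = length P} {e = length zs} {K = K ℕ.* 2} (s≤s z≤n) nonempty ≡.refl
            (ℕ.s≤s⁻¹ (ℕ.≤-trans short (ℕ.≤-reflexive (ℕ.+-suc _ 1)))) close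
        where
        T : ℕ
        T = length S ℕ.* (K ℕ.* 2)

        linked : Linked Before (z ∷ zs)
        linked = Linked.AllPairs⇒Linked path

        short : length (z ∷ zs) ℕ.≤ 4 ℕ.* T ℕ.+ 2
        short = path-short p≉q real-p real-q path

        -- For empty S the bound of `path-short` is 2, but the path has three points.
        nonempty : 1 ℕ.≤ length S
        nonempty = positive (length S) short
          where
          positive : ∀ d {m} → 3 ℕ.+ m ℕ.≤ 4 ℕ.* (d ℕ.* (K ℕ.* 2)) ℕ.+ 2 → 1 ℕ.≤ d
          positive zero    (s≤s (s≤s ()))
          positive (suc d) _ = s≤s z≤n

        close : ∀ w → 1 ℕ.≤ w → ∃[ good ] length P ℕ.* (length zs ℕ.* w) ℕ.≤ w ℕ.* good ℕ.+ length P ℕ.* T ×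
                good ℕ.≤ length zs ℕ.* (length S ℕ.* (2 ℕ.* w ℕ.* 2))
        close w _ = sumOver good P , lower , upper
          where
          near : Point → Point → Point → ℕ
          near p z z′ = indicator (variation p z z′ ℕ.<? w)

          good : Point → ℕ
          good p = sumPairs (near p) (z ∷ zs)

          markov : ∀ p z z′ → w ℕ.≤ w ℕ.* near p z z′ ℕ.+ variation p z z′
          markov p z z′ with variation p z z′ ℕ.<? w
          ... | yes _ = ℕ.≤-trans (ℕ.≤-reflexive (≡.sym (ℕ.*-identityʳ w))) (ℕ.m≤m+n (w ℕ.* 1) _)
          ... | no ≮w = ℕ.≤-trans (ℕ.≮⇒≥ ≮w) (ℕ.m≤n+m _ (w ℕ.* 0))

          per-point : ∀ p → length zs ℕ.* w ℕ.≤ w ℕ.* good p ℕ.+ T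
          per-point p = ℕ.≤-trans (ℕ.≤-reflexive (≡.sym (sumPairs-const w z zs)))
            (ℕ.≤-trans (sumPairs-mono (λ {z} {z′} _ → markov p z z′) linked)
              (ℕ.≤-trans (ℕ.≤-reflexive (≡.trans (sumPairs-+ (λ z z′ → w ℕ.* near p z z′) (variation p) (z ∷ zs))
                  (≡.cong (ℕ._+ sumPairs (variation p) (z ∷ zs)) (sumPairs-* w (near p) (z ∷ zs)))))
                (ℕ.+-monoʳ-≤ (w ℕ.* good p) (total-variation p linked))))

          sumOver-const : ∀ c (ps : List Point) → sumOver (λ _ → c) ps ≡ length ps ℕ.* c
          sumOver-const c []       = ≡.refl
          sumOver-const c (_ ∷ ps) = ≡.cong (c ℕ.+_) (sumOver-const c ps)

          lower : length P ℕ.* (length zs ℕ.* w) ℕ.≤ w ℕ.* sumOver good P ℕ.+ length P ℕ.* T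
          lower = ℕ.≤-trans (ℕ.≤-reflexive (≡.sym (sumOver-const (length zs ℕ.* w) P)))
            (ℕ.≤-trans (sumOver-mono {xs = P} (All.universal per-point P))
              (ℕ.≤-reflexive (≡.trans (sumOver-+ (λ p → w ℕ.* good p) (λ _ → T) P)
                  (≡.cong₂ ℕ._+_ (sumOver-* w good P) (sumOver-const T P)))))

          pair : ∀ {z z′} → Before z z′ → sumOver (λ p → near p z z′) P ℕ.≤ length S ℕ.* (2 ℕ.* w ℕ.* 2)
          pair {z} {z′} b@(_ , gz , gz′) = ℕ.≤-trans (ℕ.≤-reflexive
              (sumOver-indicator (λ p → variation p z z′ ℕ.<? w) P))
            (close-pairs S G w gz gz′ (Before⇒≉ b) (filter near? P) (AllPairs.filter⁺ near? distinct)
                (All.filter⁺ near? realises) (All.all-filter near? P))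
            where
            near? : ∀ p → Dec (variation p z z′ ℕ.< w)
            near? p = variation p z z′ ℕ.<? w

          upper : sumOver good P ℕ.≤ length zs ℕ.* (length S ℕ.* (2 ℕ.* w ℕ.* 2))
          upper = ℕ.≤-trans (ℕ.≤-reflexive (≡.sym (sumPairs-sumOver near P (z ∷ zs))))
            (ℕ.≤-trans (sumPairs-mono pair linked) (ℕ.≤-reflexive
                (sumPairs-const (length S ℕ.* (2 ℕ.* w ℕ.* 2)) z zs)))
      many-distances {[]}     _ () _ _ _
      many-distances {_ ∷ []} _ (s≤s ()) _ _ _
      many-distances {_ ∷ _ ∷ _} {[]}         _ _ _ _ ()
      many-distances {_ ∷ _ ∷ _} {_ ∷ []}     _ _ _ _ (s≤s ())
      many-distances {_ ∷ _ ∷ _} {_ ∷ _ ∷ []} _ _ _ _ (s≤s (s≤s ()))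

-- From branches and vertical lines to the whole curve

codes : ℕ → List (List Sign)
codes zero    = [] ∷ []
codes (suc k) = cartesianProductWith _∷_ (neg ∷ zer ∷ pos ∷ []) (codes k)

∈-signs : ∀ s → s ∈ neg ∷ zer ∷ pos ∷ []
∈-signs neg = here ≡.refl
∈-signs zer = there (here ≡.refl)
∈-signs pos = there (there (here ≡.refl))

double-square : ∀ d → d ℕ.* (2 ℕ.* d ℕ.* 2) ℕ.* 2 ≡ 8 ℕ.* (d ℕ.* d)
double-square = solve 1 (λ d → d :* (con 2 :* d :* con 2) :* con 2 := con 8 :* (d :* d)) ≡.refl
  where open +-*-Solver

x*[y*z]≡y*[x*z] : ∀ x y z → x ℕ.* (y ℕ.* z) ≡ y ℕ.* (x ℕ.* z)
x*[y*z]≡y*[x*z] = solve 3 (λ x y z → x :* (y :* z) := y :* (x :* z)) ≡.refl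
  where open +-*-Solver

module CurveBound (em : ExcludedMiddle 0ℓ) (ℝ : RealField) where
  open Distances em ℝ public
  open RealPlane em ℝ using (nth; coeff; eval; HasDegree; Polynomial) public
  open ≤-Reasoning

  code∈codes : ∀ k p y → code k p y ∈ codes k
  code∈codes zero    p y = here ≡.refl
  code∈codes (suc k) p y = ∈.∈-cartesianProductWith⁺ _∷_ (∈-signs _) (code∈codes k (deriv p) y)

  module _ (ξ : Point → Carrier) where
    insert : Point → List Point → List Point
    insert z []       = z ∷ []
    insert z (y ∷ ys) with ξ z <? ξ y
    ... | yes _ = z ∷ y ∷ ys
    ... | no _  = y ∷ insert z ys

    insert-All : ∀ {P : Pred Point 0ℓ} {z} ys → P z → All P ys → All P (insert z ys)
    insert-All []       pz []         = pz ∷ []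
    insert-All {z = z} (y ∷ ys) pz (py ∷ pys) with ξ z <? ξ y
    ... | yes _ = pz ∷ py ∷ pys
    ... | no _  = py ∷ insert-All ys pz pys

    length-insert : ∀ z ys → length (insert z ys) ≡ suc (length ys)
    length-insert z []       = ≡.refl
    length-insert z (y ∷ ys) with ξ z <? ξ y
    ... | yes _ = ≡.refl
    ... | no _  = ≡.cong suc (length-insert z ys)

    insert-sorted : ∀ z ys → All (λ y → ξ z ≉ ξ y) ys → AllPairs (λ x y → ξ x < ξ y) ys →
                    AllPairs (λ x y → ξ x < ξ y) (insert z ys)
    insert-sorted z []       _ _ = [] ∷ []
    insert-sorted z (y ∷ ys) (z≉y ∷ z≉) (y< ∷ sorted) with ξ z <? ξ y
    ... | yes z<y = (z<y ∷ All.map (<-trans z<y) y<) ∷ y< ∷ sorted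
    ... | no z≮y with ≮⇒≥ z≮y
    ...   | inj₂ y≈z = contradiction (sym y≈z) z≉y
    ...   | inj₁ y<z = insert-All ys y<z y< ∷ insert-sorted z ys z≉ sorted

    sort : ∀ zs → AllPairs (λ x y → ξ x ≉ ξ y) zs → ∃[ ys ] AllPairs (λ x y → ξ x < ξ y) ys ×
           length ys ≡ length zs × (∀ {P : Pred Point 0ℓ} → All P zs → All P ys)
    sort []       []         = [] , [] , ≡.refl , λ p → p
    sort (z ∷ zs) (z≉ ∷ zs≉) with sort zs zs≉
    ... | ys , sorted , |ys| , transfer = insert z ys , insert-sorted z ys (transfer z≉) sorted ,
      ≡.trans (length-insert z ys) (≡.cong suc |ys|) , λ { (pz ∷ pzs) → insert-All ys pz (transfer pzs) }

  -- The constant of `many-distances`, plus 8 for pieces with at most two points, where n ≤ 4 D²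
  -- suffices.
  pieceConstant : ℕ → ℕ
  pieceConstant K = 96 ℕ.* (K ℕ.* 2) ℕ.+ 16 ℕ.+ 8

  -- S contains the squares of the distances between the two sets.
  module _ (S : List Carrier) (P : List Point) (P-distinct : AllPairs _≉ₚ_ P) (2≤n : 2 ℕ.≤ length P) where
    Realised : Pred Point 0ℓ
    Realised z = All (λ p → Any (dist² z p ≈_) S) P

    realises : ∀ {G : Pred Point 0ℓ} → (∀ {z} → G z → Realised z) → All (Realises S G) P
    realises G⇒ = All.tabulate λ p∈P z gz → All.lookup (G⇒ gz) p∈P

    -- The window w = `length S` makes any two ranks close, so `close-pairs` counts all of P.
    n≤4D² : ∀ {z z′} → Realised z → Realised z′ → z ≉ₚ z′ → length P ℕ.≤ length S ℕ.* (2 ℕ.* length S ℕ.* 2)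
    n≤4D² {z} {z′} rz rz′ z≉z′ = close-pairs S Realised (length S) rz rz′ z≉z′ P P-distinct (realises λ r → r)
      (All.zipWith (λ (a , b) → ℕ.≤-<-trans (ℕ.∣m-n∣≤m⊔n (rank S (dist² z _)) (rank S (dist² z′ _)))
          (ℕ.⊔-lub (rank-bounded a) (rank-bounded b))) (rz , rz′))

    opaque
      piece-bound : ∀ {K G} (ordering : Ordering K G) → (∀ {z} → G z → Realised z) →
        length P ℕ.≤ length S ℕ.* (2 ℕ.* length S ℕ.* 2) →
        ∀ zs → All G zs → AllPairs (λ x y → Ordering.ξ ordering x ≉ Ordering.ξ ordering y) zs →
        length P ℕ.* length zs ℕ.≤ pieceConstant K ℕ.* (length S ℕ.* length S)
      piece-bound {K} {G} ordering G⇒ n≤ zs gs ξ≉ = bound (sort ξ zs ξ≉)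
        where
        open Ordering ordering
        d : ℕ
        d = length S

        bound : (∃[ ys ] AllPairs (λ x y → ξ x < ξ y) ys × length ys ≡ length zs ×
            (∀ {P : Pred Point 0ℓ} → All P zs → All P ys)) →
                length P ℕ.* length zs ℕ.≤ pieceConstant K ℕ.* (d ℕ.* d)
        bound (ys , sorted , |ys| , transfer) with 3 ℕ.≤? length ys
        ... | yes 3≤ = ℕ.≤-trans (≡.subst (λ l → length P ℕ.* l ℕ.≤ (96 ℕ.* (K ℕ.* 2) ℕ.+ 16) ℕ.* (d ℕ.* d)) |ys|
                (many-distances ordering S P-distinct 2≤n (realises G⇒) (AllPairs-restrict (transfer gs) sorted) 3≤))
                (ℕ.*-monoˡ-≤ (d ℕ.* d) (ℕ.m≤m+n (96 ℕ.* (K ℕ.* 2) ℕ.+ 16) 8))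
        ... | no ≰ = ℕ.≤-trans (ℕ.*-mono-≤ n≤ (≡.subst (ℕ._≤ 2) |ys| (ℕ.s≤s⁻¹ (ℕ.≰⇒> ≰))))
                (ℕ.≤-trans (ℕ.≤-reflexive (double-square d)) (ℕ.*-monoˡ-≤ (d ℕ.* d)
                    (ℕ.m≤n+m 8 (96 ℕ.* (K ℕ.* 2) ℕ.+ 16))))

  codeOf : ℕ → Curve → Point → List Sign
  codeOf k F (x , y) = code k (at x F) y

  Branch : ℕ → Curve → List Sign → Pred Point 0ℓ
  Branch k F c (x , y) = ev (at x F) y ≈ 0# × code k (at x F) y ≡ c

  module _ {k d} (F : Curve) (|F|≤ : length F ℕ.≤ k) (F-poly : HasDegree≤ d F) where
    branch-ordering : ∀ {G c} → ¬ Vanishing c → (∀ {z} → G z → Branch k F c z) → Ordering (diskBreaks k d) G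
    branch-ordering {G} {c} nonvanishing G⇒ = record { ξ = proj₁ ; ξ-cong = proj₁ ; breaks = breaks }
      where
      toChord : ∀ x y a b v → v - ((x - a) * (x - a) + (y - b) * (y - b)) ≈ chord a v x - (y - b) * (y - b)
      toChord = solve 5 (λ x y a b v → v :- ((x :- a) :* (x :- a) :+ (y :- b) :* (y :- b)) :=
          (v :+ :- ((x :+ :- a) :* (x :+ :- a))) :- (y :- b) :* (y :- b)) refl

      breaks : ∀ p v → ∃[ B ] length B ℕ.≤ diskBreaks k d × ∀ z z′ → G z → G z′ → SameSide B (proj₁ z) (proj₁ z′) →
               dist² z p ≤ v → dist² z′ p ≤ v
      breaks (a , b) v with disk-const F |F|≤ F-poly a b v
      ... | B , |B|≤ , const = B , |B|≤ , λ (x , y) (x′ , y′) gz gz′ same inside →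
        0≤y-x⇒x≤y (≤-respʳ (sym (toChord x′ y′ a b v)) (x≤y⇒0≤y-x
          (const x y x′ y′ same (proj₁ (G⇒ gz)) (proj₁ (G⇒ gz′)) (≡.trans (proj₂ (G⇒ gz)) (≡.sym (proj₂ (G⇒ gz′))))
            (λ van → nonvanishing (≡.subst Vanishing (proj₂ (G⇒ gz)) van))
            (0≤y-x⇒x≤y (≤-respʳ (toChord x y a b v) (x≤y⇒0≤y-x inside))))))

    branch-graph : ∀ {c z z′} → ¬ Vanishing c → Branch k F c z → Branch k F c z′ → z ≉ₚ z′ → proj₁ z ≉ proj₁ z′
    branch-graph nonvanishing (on-F , cz) (_ , cz′) z≉z′ x≈x′ =
      z≉z′ (x≈x′ , code-determines-y F |F|≤ F-poly on-F (≡.trans cz (≡.sym cz′))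
        (λ van → nonvanishing (≡.subst Vanishing cz van)) x≈x′)

  -- On a vertical line the squared distance to p is a quadratic polynomial in y, so its sign
  -- changes are counted directly, without codes.
  vertical-ordering : ∀ {G x₀} → (∀ {z} → G z → proj₁ z ≈ x₀) → Ordering 4 G
  vertical-ordering {G} {x₀} G⇒ = record { ξ = proj₂ ; ξ-cong = proj₂ ; breaks = breaks }
    where
    height : Carrier → Carrier → Carrier → Carrier → Carrier
    height a b v y = (v - (x₀ - a) * (x₀ - a)) + - ((y + - b) * (y + - b))

    height-polynomial : ∀ a b v → IsPolynomial 4 (height a b v)
    height-polynomial a b v = poly-+ (poly-weaken (s≤s z≤n) (poly-const _)) (poly-neg (poly-* y-b y-b))
      where
      y-b : IsPolynomial 2 (λ y → y + - b)
      y-b = poly-+ poly-id (poly-weaken (s≤s z≤n) (poly-const (- b)))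

    toHeight : ∀ {x y} a b v → x ≈ x₀ → v - dist² (x , y) (a , b) ≈ height a b v y
    toHeight {x} {y} a b v x≈x₀ = trans (+-congˡ (-‿cong (+-congʳ (*-cong (+-congʳ x≈x₀) (+-congʳ x≈x₀)))))
      (solve 3 (λ v s t → v :- (s :+ t) := (v :- s) :- t) refl v ((x₀ - a) * (x₀ - a)) ((y - b) * (y - b)))

    breaks : ∀ p v → ∃[ B ] length B ℕ.≤ 4 × ∀ z z′ → G z → G z′ → SameSide B (proj₂ z) (proj₂ z′) →
             dist² z p ≤ v → dist² z′ p ≤ v
    breaks (a , b) v with sgn-poly-const (height-polynomial a b v)
    ... | B , |B|≤ , const = B , |B|≤ , λ (x , y) (x′ , y′) gz gz′ same inside →
      0≤y-x⇒x≤y (≤-respʳ (sym (toHeight a b v (G⇒ gz′))) (nonneg-sgn (const y y′ same)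
        (≤-respʳ (toHeight a b v (G⇒ gz)) (x≤y⇒0≤y-x inside))))

  -- The lists of f may continue beyond the degree with coefficients equal to zero, whereas the
  -- numbers of breaks are bounded through list lengths.
  truncate : ℕ → Polynomial → Curve
  truncate k f = map (λ g x → ev (take k g) x) (take k f)

  nth-zero⇒AllZero : ∀ g → (∀ i → nth 0# g i ≈ 0#) → AllZero g
  nth-zero⇒AllZero []      _ = []
  nth-zero⇒AllZero (a ∷ g) z = z 0 ∷ nth-zero⇒AllZero g (λ i → z (suc i))

  ev-take : ∀ k g → (∀ i → k ℕ.≤ i → nth 0# g i ≈ 0#) → ∀ x → ev g x ≈ ev (take k g) x
  ev-take zero    g       z x = ev-AllZero x (nth-zero⇒AllZero g (λ i → z i z≤n))
  ev-take (suc k) []      z x = refl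
  ev-take (suc k) (a ∷ g) z x = +-congˡ (*-congˡ (ev-take k g (λ i k≤i → z (suc i) (s≤s k≤i)) x))

  eval-zero : ∀ f → (∀ i j → coeff f i j ≈ 0#) → ∀ x y → eval f (x , y) ≈ 0#
  eval-zero []      z x y = refl
  eval-zero (g ∷ f) z x y = trans (+-cong (ev-AllZero x (nth-zero⇒AllZero g (λ i → z i 0)))
    (trans (*-congˡ (eval-zero f (λ i j → z i (suc j)) x y)) (zeroʳ y))) (+-identityˡ 0#)

  eval-truncate : ∀ k l f → (∀ i j → k ℕ.≤ i → coeff f i j ≈ 0#) → (∀ i j → l ℕ.≤ j → coeff f i j ≈ 0#) →
                  ∀ x y → eval f (x , y) ≈ ev (at x (map (λ g x → ev (take k g) x) (take l f))) y
  eval-truncate k zero    f       zk zl x y = eval-zero f (λ i j → zl i j z≤n) x y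
  eval-truncate k (suc l) []      zk zl x y = refl
  eval-truncate k (suc l) (g ∷ f) zk zl x y = +-cong (ev-take k g (λ i → zk i 0) x)
    (*-congˡ (eval-truncate k l f (λ i j → zk i (suc j)) (λ i j l≤j → zl i (suc j) (s≤s l≤j)) x y))

  truncate-HasDegree≤ : ∀ k l f → HasDegree≤ k (map (λ g x → ev (take k g) x) (take l f))
  truncate-HasDegree≤ k l f = All.map⁺ (All.universal (λ g → take k g ,
    ℕ.≤-trans (ℕ.≤-reflexive (List.length-take k g)) (ℕ.m⊓n≤m k (length g)) , λ x → refl) (take l f))

  length-truncate : ∀ k f → length (truncate k f) ℕ.≤ k
  length-truncate k f = ℕ.≤-trans (ℕ.≤-reflexive (≡.trans (List.length-map _ (take k f)) (List.length-take k f)))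
      (ℕ.m⊓n≤m k (length f))

  take-AllZero : ∀ k g {i} → AllZero (take k g) → i ℕ.< k → nth 0# g i ≈ 0#
  take-AllZero (suc k) []      _ _ = refl
  take-AllZero (suc k) (a ∷ g) {zero}  (a≈0 ∷ _) _         = a≈0
  take-AllZero (suc k) (a ∷ g) {suc i} (_ ∷ g≈0) (s≤s i<k) = take-AllZero k g g≈0 i<k

  -- If the vertical line at x lies on the curve, then every coefficient of a power of y has the
  -- root x. Applied to a nonzero one, this bounds the number of vertical lines.
  row-vanishes : ∀ k l f {j x} → j ℕ.< l → AllZero (at x (map (λ g x → ev (take k g) x) (take l f))) →
                 ev (take k (nth [] f j)) x ≈ 0#
  row-vanishes k (suc l) []      {x = x} _ _ = ev-AllZero x (nil k)
    where
    nil : ∀ k → AllZero (take k [])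
    nil zero    = []
    nil (suc k) = []
  row-vanishes k (suc l) (g ∷ f) {zero}  _         (e ∷ _)  = e
  row-vanishes k (suc l) (g ∷ f) {suc j} (s≤s j<l) (_ ∷ es) = row-vanishes k l f j<l es

  -- A class of equal codes is a graph over x or lies on vertical lines; the costs of both cases are
  -- added. Each `suc` in front of a number of colours stands for the extra first colour handed to
  -- `pigeonhole`.
  classConstant curveConstant : ℕ → ℕ
  classConstant k = pieceConstant (diskBreaks k k) ℕ.+ suc k ℕ.* pieceConstant 4
  curveConstant k = suc (length (codes k)) ℕ.* classConstant k

  module _ (S : List Carrier) (P₁ P₂ : List Point) (P₁-distinct : AllPairs _≉ₚ_ P₁) (P₂-distinct : AllPairs _≉ₚ_ P₂)
           (2≤m : 2 ℕ.≤ length P₁) (2≤n : 2 ℕ.≤ length P₂) (realised : All (Realised S P₂ P₂-distinct 2≤n) P₁) where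
    private
      D² : ℕ
      D² = length S ℕ.* length S

      Real : Pred Point 0ℓ
      Real = Realised S P₂ P₂-distinct 2≤n

    small-n : length P₂ ℕ.≤ length S ℕ.* (2 ℕ.* length S ℕ.* 2)
    small-n = go P₁ P₁-distinct 2≤m realised
      where
      go : ∀ P → AllPairs _≉ₚ_ P → 2 ℕ.≤ length P → All Real P → length P₂ ℕ.≤ length S ℕ.* (2 ℕ.* length S ℕ.* 2)
      go (z ∷ z′ ∷ _) ((z≉z′ ∷ _) ∷ _) _ (r ∷ r′ ∷ _) = n≤4D² S P₂ P₂-distinct 2≤n r r′ z≉z′
      go (z ∷ [])     _ (s≤s ()) _

    opaque
      vertical-bound : ∀ k g → length g ℕ.≤ k → ¬ AllZero g → ∀ M → AllPairs _≉ₚ_ M → All Real M →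
        All (λ z → ev g (proj₁ z) ≈ 0#) M → length P₂ ℕ.* length M ℕ.≤ suc k ℕ.* pieceConstant 4 ℕ.* D²
      vertical-bound k g |g|≤k g≉0 M distinct real on-g = split (roots g g≉0)
        where
        on-line? : ∀ b (z : Point) → Dec (proj₁ z ≈ b)
        on-line? b z = proj₁ z ≟ b

        line-bound : ∀ c → length P₂ ℕ.* length (filter (on-line? c) M) ℕ.≤ pieceConstant 4 ℕ.* D²
        line-bound c = piece-bound S P₂ P₂-distinct 2≤n {G = λ z → proj₁ z ≈ c × Real z}
          (vertical-ordering proj₁) proj₂ small-n (filter (on-line? c) M)
              (All.zip (on-line , All.filter⁺ (on-line? c) real))
          (AllPairs.map (λ ((z≉z′ , x≈c , x′≈c)) y≈y′ → z≉z′ (trans x≈c (sym x′≈c) , y≈y′))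
            (AllPairs-restrict on-line (AllPairs.filter⁺ (on-line? c) distinct)))
          where
          on-line : All (λ z → proj₁ z ≈ c) (filter (on-line? c) M)
          on-line = All.all-filter (on-line? c) M

        split : (∃[ B ] length B ℕ.≤ length g × Covers B (Root g)) →
            length P₂ ℕ.* length M ℕ.≤ suc k ℕ.* pieceConstant 4 ℕ.* D²
        -- The extra colour `0#` makes the list of colours nonempty. It may even be the colour
        -- chosen, as `line-bound` holds for every c.
        split (B , |B|≤ , covers) = combine (pigeonhole on-line? 0# B M
            (All.map (λ {z} e → there (covers (proj₁ z) e)) on-g))
          where
          combine : (∃[ c ] length M ℕ.≤ suc (length B) ℕ.* length (filter (on-line? c) M)) →
                    length P₂ ℕ.* length M ℕ.≤ suc k ℕ.* pieceConstant 4 ℕ.* D²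
          combine (c , |M|≤) = ℕ.≤-trans (ℕ.*-monoʳ-≤ (length P₂) |M|≤)
            (ℕ.≤-trans (ℕ.≤-reflexive (x*[y*z]≡y*[x*z] (length P₂) (suc (length B)) _))
              (ℕ.≤-trans (ℕ.*-mono-≤ (s≤s (ℕ.≤-trans |B|≤ |g|≤k)) (line-bound c))
                (ℕ.≤-reflexive (≡.sym (ℕ.*-assoc (suc k) (pieceConstant 4) D²)))))

    opaque
      -- g locates the vertical lines on the curve: where the code vanishes, the fibre of F is the
      -- zero polynomial and x is a root of g. For any other code, `branch-graph` makes the class a
      -- graph over x.
      curve-bound : ∀ k F → length F ℕ.≤ k → (F-poly : HasDegree≤ k F) →
        ∀ g → length g ℕ.≤ k → ¬ AllZero g → (∀ x → AllZero (at x F) → ev g x ≈ 0#) →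
        All (λ z → ev (at (proj₁ z) F) (proj₂ z) ≈ 0#) P₁ →
        length P₂ ℕ.* length P₁ ℕ.≤ curveConstant k ℕ.* D²
      curve-bound k F |F|≤ F-poly g |g|≤ g≉0 F⇒g on-F = combine
        (pigeonhole same-code? [] (codes k) P₁ (All.universal (λ z →
            there (Any.map (λ e → e) (code∈codes k (at (proj₁ z) F) (proj₂ z)))) P₁))
        where
        same-code? : ∀ c z → Dec (codeOf k F z ≡ c)
        same-code? c z = codeOf k F z ≟ᶜ c

        class-bound : ∀ c → length P₂ ℕ.* length (filter (same-code? c) P₁) ℕ.≤
                      classConstant k ℕ.* D²
        class-bound c = cases (All.all? (_≟ˢ zer) c)
          where
          M : List Point
          M = filter (same-code? c) P₁

          M-distinct : AllPairs _≉ₚ_ M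
          M-distinct = AllPairs.filter⁺ (same-code? c) P₁-distinct

          branch : All (Branch k F c) M
          branch = All.zip (All.filter⁺ (same-code? c) on-F , All.all-filter (same-code? c) P₁)

          real : All Real M
          real = All.filter⁺ (same-code? c) realised

          cases : Dec (Vanishing c) → length P₂ ℕ.* length M ℕ.≤ classConstant k ℕ.* D²
          cases (no nonvanishing) = ℕ.≤-trans
            (piece-bound S P₂ P₂-distinct 2≤n {G = λ z → Branch k F c z × Real z}
              (branch-ordering F |F|≤ F-poly nonvanishing proj₁) proj₂ small-n M (All.zip (branch , real))
              (AllPairs.map (λ ((z≉z′ , bz , bz′)) → branch-graph F |F|≤ F-poly nonvanishing bz bz′ z≉z′)
                (AllPairs-restrict branch M-distinct)))
            (ℕ.*-monoˡ-≤ D² (ℕ.m≤m+n (pieceConstant (diskBreaks k k)) (suc k ℕ.* pieceConstant 4)))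
          cases (yes vanishing) = ℕ.≤-trans
            (vertical-bound k g |g|≤ g≉0 M M-distinct real
              (All.map (λ {z} (_ , cz) → F⇒g (proj₁ z) (zero-polynomial (at (proj₁ z) F)
                (vanishing-code⇒zero k (at (proj₁ z) F) (length-at (proj₁ z) F |F|≤)
                    (≡.subst Vanishing (≡.sym cz) vanishing)))) branch))
            (ℕ.*-monoˡ-≤ D² (ℕ.m≤n+m (suc k ℕ.* pieceConstant 4) (pieceConstant (diskBreaks k k))))

        combine : (∃[ c ] length P₁ ℕ.≤ suc (length (codes k)) ℕ.* length (filter (same-code? c) P₁)) →
                  length P₂ ℕ.* length P₁ ℕ.≤ curveConstant k ℕ.* D²
        combine (c , |P₁|≤) = ℕ.≤-trans (ℕ.*-monoʳ-≤ (length P₂) |P₁|≤)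
          (ℕ.≤-trans (ℕ.≤-reflexive (x*[y*z]≡y*[x*z] (length P₂) (suc (length (codes k))) _))
            (ℕ.≤-trans (ℕ.*-monoʳ-≤ (suc (length (codes k))) (class-bound c))
              (ℕ.≤-reflexive (≡.sym (ℕ.*-assoc (suc (length (codes k))) (classConstant k) D²)))))

    -- Degree r means r + 1 coefficients in either variable, hence `suc r`. The coefficient of y^j
    -- that contains the nonzero term of degree r is taken as g.
    polynomial-bound : ∀ r f → HasDegree f r → All (λ z → eval f z ≈ 0#) P₁ →
                       length P₂ ℕ.* length P₁ ℕ.≤ curveConstant (suc r) ℕ.* D²
    polynomial-bound r f (high , i , j , i+j≡r , fᵢⱼ≉0) on-f = curve-bound (suc r) (truncate (suc r) f)
      (length-truncate (suc r) f) (truncate-HasDegree≤ (suc r) (suc r) f)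
      (take (suc r) (nth [] f j)) (ℕ.≤-trans (ℕ.≤-reflexive (List.length-take (suc r) (nth [] f j)))
          (ℕ.m⊓n≤m (suc r) _))
      (λ zeros → fᵢⱼ≉0 (take-AllZero (suc r) (nth [] f j) zeros (s≤s (ℕ.m+n≤o⇒m≤o i (ℕ.≤-reflexive i+j≡r)))))
      (λ x → row-vanishes (suc r) (suc r) f (s≤s (ℕ.m+n≤o⇒n≤o i (ℕ.≤-reflexive i+j≡r))))
      (All.map (λ {z} e → trans (sym (eval-truncate (suc r) (suc r) f
        (λ i j r<i → high i j (ℕ.<-≤-trans r<i (ℕ.m≤m+n i j)))
            (λ i j r<j → high i j (ℕ.<-≤-trans r<j (ℕ.m≤n+m j i))) (proj₁ z) (proj₂ z))) e) on-f)

-- Passage to real roots and logarithms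

module DistinctDistances (em : ExcludedMiddle 0ℓ) (ℝ : RealField) where
  open CurveBound em ℝ
  open RealPlane em ℝ using (the; dist; root; log; _⁻¹; fromℕ; HasSum; D; Unique; V; _^_)
  open SemiringMult semiring using (×1-homo-*)
  open ≤-Reasoning

  the-spec : ∀ (P : Pred Carrier 0ℓ) → ∃ P → P (the P)
  the-spec P ∃P with em {∃ P}
  ... | yes (_ , px) = px
  ... | no ∄P        = contradiction ∃P ∄P

  -- Inverses, roots and logarithms occur below in upper bounds by nonnegative numbers, and the junk
  -- value 0 is treated as a second case there. For `dist` the value must be the true one, which
  -- `sqrt` provides.
  the-cases : ∀ (P : Pred Carrier 0ℓ) → P (the P) ⊎ the P ≈ 0#
  the-cases P with em {∃ P}
  ... | yes (_ , px) = inj₁ px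
  ... | no _         = inj₂ refl

  x^2≈x*x : ∀ x → x ^ 2 ≈ x * x
  x^2≈x*x x = *-congˡ (*-identityʳ x)

  root₂-cases : ∀ x → (0# ≤ root 2 x × root 2 x * root 2 x ≈ x) ⊎ root 2 x ≈ 0#
  root₂-cases x = Sum.map₁ (Product.map₂ (trans (sym (x^2≈x*x _)))) (the-cases (λ y → 0# ≤ y × y ^ 2 ≈ x))

  dist-square : ∀ z p → dist z p * dist z p ≈ dist² z p
  dist-square (x , y) (a , b) = trans (sym (x^2≈x*x _)) (trans
      (proj₂ (the-spec (λ d → 0# ≤ d × d ^ 2 ≈ q) (exists (sqrt q 0≤q)))) q≈)
    where
    q : Carrier
    q = (x - a) ^ 2 + (y - b) ^ 2
    q≈ : q ≈ dist² (x , y) (a , b)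
    q≈ = +-cong (x^2≈x*x _) (x^2≈x*x _)
    0≤q : 0# ≤ q
    0≤q = ≤-respʳ (sym q≈) (+-nonneg (square-nonneg _) (square-nonneg _))
    exists : (∃[ d ] 0# ≤ d × d * d ≈ q) → ∃[ d ] 0# ≤ d × d ^ 2 ≈ q
    exists (d , 0≤d , d²≈q) = d , 0≤d , trans (x^2≈x*x d) d²≈q

  bound-ℕ : ∀ r f P₁ P₂ → HasDegree f r → Unique P₁ → Unique P₂ → All (V f) P₁ → 2 ℕ.≤ length P₁ → 2 ℕ.≤ length P₂ →
            length P₂ ℕ.* length P₁ ℕ.≤ curveConstant (suc r) ℕ.* (D P₁ P₂ ℕ.* D P₁ P₂)
  bound-ℕ r f P₁ P₂ degree unique₁ unique₂ on-f 2≤m 2≤n =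
    ≡.subst (λ d → length P₂ ℕ.* length P₁ ℕ.≤ curveConstant (suc r) ℕ.* (d ℕ.* d)) (List.length-map _ distances)
      (polynomial-bound (map (λ v → v * v) distances) P₁ P₂ unique₁ unique₂ 2≤m 2≤n realised r f degree on-f)
    where
    distances : List Carrier
    distances = deduplicate _≟_ (cartesianProductWith dist P₁ P₂)

    realised : All (λ z → All (λ p → Any (dist² z p ≈_) (map (λ v → v * v) distances)) P₂) P₁
    realised = All.tabulate λ z∈P₁ → All.tabulate λ p∈P₂ →
      Any.map⁺ (Any.map (λ d≈v → trans (sym (dist-square _ _)) (*-cong d≈v d≈v))
        (Any.deduplicate⁺ _≟_ (λ v≈w d≈w → trans d≈w (sym v≈w))
          (Any.map reflexive (∈.∈-cartesianProductWith⁺ dist z∈P₁ p∈P₂))))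

  fromℕ-nonneg : ∀ n → 0# ≤ fromℕ n
  fromℕ-nonneg zero    = ≤-refl
  fromℕ-nonneg (suc n) = <⇒≤ (+-pos-nonneg 0<1 (fromℕ-nonneg n))

  fromℕ-mono : ∀ {m n} → m ℕ.≤ n → fromℕ m ≤ fromℕ n
  fromℕ-mono {n = n} z≤n = fromℕ-nonneg n
  fromℕ-mono (s≤s m≤n)   = +-monoʳ-≤ 1# (fromℕ-mono m≤n)

  1≤fromℕ : ∀ {n} → 1 ℕ.≤ n → 1# ≤ fromℕ n
  1≤fromℕ 1≤n = ≤-respˡ (+-identityʳ 1#) (fromℕ-mono 1≤n)

  -- Both sides are compared after squaring; N + 1 serves as a bound for √N.
  product-bound : ∀ {m n d N u v} → n ℕ.* m ℕ.≤ N ℕ.* (d ℕ.* d) → 0# ≤ u → 0# ≤ v →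
                  u * u ≈ fromℕ m → v * v ≈ fromℕ n → u * v ≤ fromℕ (suc N) * fromℕ d
  product-bound {m} {n} {d} {N} {u} {v} nm≤ 0≤u 0≤v u²≈m v²≈n =
    square-cancel-≤ (*-nonneg (fromℕ-nonneg (suc N)) (fromℕ-nonneg d)) (begin
      u * v * (u * v)                   ≈⟨ solve 2 (λ u v → u :* v :* (u :* v) := (v :* v) :* (u :* u)) refl u v ⟩
      (v * v) * (u * u)                 ≈⟨ *-cong v²≈n u²≈m ⟩
      fromℕ n * fromℕ m                 ≈⟨ ×1-homo-* n m ⟨
      fromℕ (n ℕ.* m)                   ≤⟨ fromℕ-mono (ℕ.≤-trans nm≤ (enlarge N d)) ⟩
      fromℕ (suc N ℕ.* d ℕ.* (suc N ℕ.* d)) ≈⟨ ×1-homo-* (suc N ℕ.* d) (suc N ℕ.* d) ⟩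
      fromℕ (suc N ℕ.* d) * fromℕ (suc N ℕ.* d) ≈⟨ *-cong (×1-homo-* (suc N) d) (×1-homo-* (suc N) d) ⟩
      (fromℕ (suc N) * fromℕ d) * (fromℕ (suc N) * fromℕ d) ∎)
    where
    enlarge : ∀ N d → N ℕ.* (d ℕ.* d) ℕ.≤ suc N ℕ.* d ℕ.* (suc N ℕ.* d)
    enlarge N d = ℕ.≤-trans (ℕ.≤-reflexive (≡.sym (ℕ.*-assoc N d d)))
        (ℕ.*-mono-≤ (ℕ.m≤n+m (N ℕ.* d) d) (ℕ.m≤m+n d (N ℕ.* d)))

  ^-nonneg : ∀ {y} k → 0# ≤ y → 0# ≤ y ^ k
  ^-nonneg zero    0≤y = <⇒≤ 0<1
  ^-nonneg (suc k) 0≤y = *-nonneg 0≤y (^-nonneg k 0≤y)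

  x⁻¹≤1 : ∀ {x} → 1# ≤ x → x ⁻¹ ≤ 1#
  x⁻¹≤1 {x} 1≤x with the-cases (λ y → x * y ≈ 1#)
  ... | inj₂ i≈0  = ≤-respˡ (sym i≈0) (<⇒≤ 0<1)
  ... | inj₁ xi≈1 = ≮⇒≥ λ 1<i → <-irrefl refl (begin-strict
    1#            <⟨ 1<i ⟩
    x ⁻¹          ≈⟨ *-identityˡ _ ⟨
    1# * x ⁻¹     ≤⟨ *-monoˡ-≤ (<⇒≤ (<-trans 0<1 1<i)) 1≤x ⟩
    x * x ⁻¹      ≈⟨ xi≈1 ⟩
    1#            ∎)

  -- For y ≤ 1/2 the partial sums of the geometric series stay below 1 + 2 y, since 1 + y (1 + 2 y)
  -- ≤ 1 + 2 y. The weight w carries the power of y through the induction.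
  geometric-bound : ∀ {y} → 0# ≤ y → y + y ≤ 1# → ∀ M w (a : ℕ → Carrier) → 0# ≤ w → (∀ k → a k ≤ w * y ^ k) →
                    MonoidSum.sum +-monoid {M} (λ k → a (toℕ k)) ≤ w * (1# + (y + y))
  geometric-bound {y} 0≤y 2y≤1 zero    w a 0≤w a≤ = *-nonneg 0≤w (+-nonneg (<⇒≤ 0<1) (+-nonneg 0≤y 0≤y))
  geometric-bound {y} 0≤y 2y≤1 (suc M) w a 0≤w a≤ = begin
    a 0 + MonoidSum.sum +-monoid {M} (λ k → a (suc (toℕ k)))
      ≤⟨ +-mono-≤ (a≤ 0) (geometric-bound 0≤y 2y≤1 M (w * y) (λ k → a (suc k)) (*-nonneg 0≤w 0≤y)
           (λ k → ≤-respʳ (sym (*-assoc w y (y ^ k))) (a≤ (suc k)))) ⟩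
    w * 1# + w * y * (1# + (y + y))
      ≈⟨ solve 2 (λ w y → w :* con (+ 1) :+ w :* y :* (con (+ 1) :+ (y :+ y)) := w :*
          (con (+ 1) :+ (y :+ (y :+ y) :* y))) refl w y ⟩
    w * (1# + (y + (y + y) * y))
      ≤⟨ *-monoʳ-≤ 0≤w (+-monoʳ-≤ 1# (+-monoʳ-≤ y (≤-respʳ (*-identityˡ y) (*-monoˡ-≤ 0≤y 2y≤1)))) ⟩
    w * (1# + (y + y)) ∎

  exponential-terms : ∀ {y} → 0# ≤ y → ∀ k → y ^ k * fromℕ (k !) ⁻¹ ≤ 1# * y ^ k
  exponential-terms {y} 0≤y k = ≤-respʳ (*-comm (y ^ k) 1#) (*-monoʳ-≤ (^-nonneg k 0≤y) (x⁻¹≤1 (1≤fromℕ (1≤k! k))))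
    where
    1≤k! : ∀ k → 1 ℕ.≤ k !
    1≤k! zero    = ℕ.≤-refl
    1≤k! (suc k) = ℕ.≤-trans (1≤k! k) (ℕ.m≤m+n (k !) (k ℕ.* k !))

  -- exp y < 2 for small y ≥ 0, which keeps log n away from 0 for n ≥ 2.
  log-lower-bound : ∀ {h y n} → h + h ≈ 1# → 0# ≤ y → y + y ≤ h → 2 ℕ.≤ n → ¬ HasSum (λ k → y ^ k * fromℕ (k !) ⁻¹)
      (fromℕ n)
  log-lower-bound {h} {y} {n} 2h≈1 0≤y 2y≤h 2≤n sums = contradict (sums h 0<h)
    where
    0<h : 0# < h
    0<h = ≰⇒> λ h≤0 → ≤⇒≯ (≤-respˡ 2h≈1 (≤-respʳ (+-identityˡ 0#) (+-mono-≤ h≤0 h≤0))) 0<1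

    -- With h = 1/2, all partial sums are at most 1 + 2 y ≤ 1 + h = 2 - h ≤ n - h, so they do not
    -- come within h of n.
    contradict : (∃[ N ] ∀ M → N ℕ.≤ M → (fromℕ n - h < MonoidSum.sum +-monoid {M}
        (λ k → y ^ toℕ k * fromℕ (toℕ k !) ⁻¹)) ×
                  (MonoidSum.sum +-monoid {M} (λ k → y ^ toℕ k * fromℕ (toℕ k !) ⁻¹) < fromℕ n + h)) → _
    contradict (N , close) = <-irrefl refl (begin-strict
      fromℕ n - h                                                <⟨ proj₁ (close N ℕ.≤-refl) ⟩
      MonoidSum.sum +-monoid {N} (λ k → y ^ toℕ k * fromℕ (toℕ k !) ⁻¹)   ≤⟨ geometric-bound 0≤y
        (≤-trans 2y≤h (≤-respʳ 2h≈1 (≤-respˡ (+-identityʳ h) (+-monoʳ-≤ h (<⇒≤ 0<h))))) N 1# _ (<⇒≤ 0<1)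
            (exponential-terms 0≤y) ⟩
      1# * (1# + (y + y))                                        ≈⟨ *-identityˡ _ ⟩
      1# + (y + y)                                               ≤⟨ +-monoʳ-≤ 1# 2y≤h ⟩
      1# + h                                                     ≈⟨ solve 1
          (λ h → con (+ 1) :+ h := (con (+ 1) :+ (h :+ h)) :- h) refl h ⟩
      (1# + (h + h)) - h                                         ≈⟨ +-congʳ (+-congˡ 2h≈1) ⟩
      (1# + 1#) - h                                              ≈⟨ +-congʳ (+-congˡ (+-identityʳ 1#)) ⟨
      fromℕ 2 - h                                                ≤⟨ +-monoˡ-≤ (- h) (fromℕ-mono 2≤n) ⟩
      fromℕ n - h                                                ∎)

  opaque
    -- If √(log n) were less than h = 1/2, then 2 log n ≤ 2 h² = h, against `log-lower-bound`.
    inverse-root-log≤2 : ∀ {n} → 2 ℕ.≤ n → root 2 (log (fromℕ n)) ⁻¹ ≤ 1# + 1#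
    inverse-root-log≤2 {n} 2≤n = cases (positive-inverse (+-pos-nonneg 0<1 (<⇒≤ 0<1)))
      where
      l : Carrier
      l = root 2 (log (fromℕ n))

      0≤2 : 0# ≤ 1# + 1#
      0≤2 = +-nonneg (<⇒≤ 0<1) (<⇒≤ 0<1)

      l≉0 : l * l ⁻¹ ≈ 1# → l ≉ 0#
      l≉0 lt≈1 l≈0 = 0≉1 (trans (sym (trans (*-congʳ l≈0) (zeroˡ _))) lt≈1)

      half≤l : ∀ h → h + h ≈ 1# → 0# < h → l ≉ 0# → h ≤ l
      half≤l h 2h≈1 0<h l≉0 with root₂-cases (log (fromℕ n))
      ... | inj₂ l≈0 = contradiction l≈0 l≉0
      ... | inj₁ (0≤l , l²≈y) = ≮⇒≥ λ l<h → [ log-lower-bound 2h≈1 0≤y (2y≤h l<h) 2≤n ,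
              (λ y≈0 → [ l≉0 , l≉0 ]′ (x*y≈0⇒x≈0⊎y≈0 (trans l²≈y y≈0))) ]′
              (the-cases (λ y → HasSum (λ k → y ^ k * fromℕ (k !) ⁻¹) (fromℕ n)))
        where
        0≤y : 0# ≤ log (fromℕ n)
        0≤y = ≤-respʳ l²≈y (*-nonneg 0≤l 0≤l)

        2y≤h : l < h → log (fromℕ n) + log (fromℕ n) ≤ h
        2y≤h l<h = begin
          log (fromℕ n) + log (fromℕ n) ≈⟨ +-cong l²≈y l²≈y ⟨
          l * l + l * l                 ≤⟨ +-mono-≤ l²≤h² l²≤h² ⟩
          h * h + h * h                 ≈⟨ distribˡ h h h ⟨
          h * (h + h)                   ≈⟨ trans (*-congˡ 2h≈1) (*-identityʳ h) ⟩
          h                             ∎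
          where
          l²≤h² : l * l ≤ h * h
          l²≤h² = <⇒≤ (square-mono-< 0≤l l<h)

      cases : (∃[ h ] 0# < h × (1# + 1#) * h ≈ 1#) → l ⁻¹ ≤ 1# + 1#
      cases (h , 0<h , 2h≈1) with the-cases (λ t → l * t ≈ 1#)
      ... | inj₂ t≈0  = ≤-respˡ (sym t≈0) 0≤2
      ... | inj₁ lt≈1 = ≮⇒≥ λ 2<t → <-irrefl refl (begin-strict
        1#               ≈⟨ 2h≈1 ⟨
        (1# + 1#) * h    <⟨ *-monoˡ-< 0<h 2<t ⟩
        l ⁻¹ * h         ≤⟨ *-monoʳ-≤ (<⇒≤ (≤-<-trans 0≤2 2<t))
            (half≤l h (trans (solve 1 (λ h → h :+ h := (con (+ 1) :+ con (+ 1)) :* h) refl h) 2h≈1) 0<h (l≉0 lt≈1)) ⟩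
        l ⁻¹ * l         ≈⟨ *-comm _ _ ⟩
        l * l ⁻¹         ≈⟨ lt≈1 ⟩
        1#               ∎)

  cube-root≤square-root : ∀ {a u x} → 1# ≤ x → 0# ≤ u → u * u ≈ x → a ^ 3 ≈ x → a ≤ u
  cube-root≤square-root {a} {u} {x} 1≤x 0≤u u²≈x a³≈x = ≮⇒≥ λ u<a → <-irrefl refl (begin-strict
    x            ≈⟨ u²≈x ⟨
    u * u        <⟨ square-mono-< 0≤u u<a ⟩
    a * a        ≈⟨ *-identityˡ _ ⟨
    1# * (a * a) ≤⟨ *-monoˡ-≤ (square-nonneg a) (≤-trans 1≤u (<⇒≤ u<a)) ⟩
    a * (a * a)  ≈⟨ *-congˡ (*-congˡ (*-identityʳ a)) ⟨
    a ^ 3        ≈⟨ a³≈x ⟩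
    x            ∎)
    where
    1≤u : 1# ≤ u
    1≤u = square-cancel-≤ 0≤u (≤-respˡ (sym (*-identityˡ 1#)) (≤-respʳ (sym u²≈x) 1≤x))

  module _ (r : ℕ) where
    N : Carrier
    N = fromℕ (suc (curveConstant (suc r)))

    0<N : 0# < N
    0<N = +-pos-nonneg 0<1 (fromℕ-nonneg (curveConstant (suc r)))

    -- c = 1 / (2 N), where the 2 pays for the factor (log n)^(-1/2) ≤ 2. The bound with the cube
    -- root uses the same c and gives this 2 away.
    scale : ∃[ c ] 0# < c × (N + N) * c ≈ 1#
    scale = positive-inverse (+-pos-nonneg 0<N (<⇒≤ 0<N))

    scaled : ∀ {x d} → x ≤ N * fromℕ d * (1# + 1#) → proj₁ scale * x ≤ fromℕ d
    scaled {x} {d} x≤ = begin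
      c * x                            ≤⟨ *-monoʳ-≤ (<⇒≤ (proj₁ (proj₂ scale))) x≤ ⟩
      c * (N * fromℕ d * (1# + 1#))    ≈⟨ solve 3 (λ c n d → c :* (n :* d :* (con (+ 1) :+ con (+ 1))) :=
          ((n :+ n) :* c) :* d) refl c N (fromℕ d) ⟩
      (N + N) * c * fromℕ d            ≈⟨ trans (*-congʳ (proj₂ (proj₂ scale))) (*-identityˡ _) ⟩
      fromℕ d                          ∎
      where
      c : Carrier
      c = proj₁ scale

    module _ (f : Polynomial) (P₁ P₂ : List Point) (degree : HasDegree f r) (unique₁ : Unique P₁) (unique₂ : Unique P₂) (on-f : All (V f) P₁)
             (2≤m : 2 ℕ.≤ length P₁) (2≤n : 2 ℕ.≤ length P₂) where
      private
        m n d : ℕ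
        m = length P₁
        n = length P₂
        d = D P₁ P₂

        nonneg-bound : 0# ≤ N * fromℕ d
        nonneg-bound = *-nonneg (<⇒≤ 0<N) (fromℕ-nonneg d)

        0≤2 : 0# ≤ 1# + 1#
        0≤2 = +-nonneg (<⇒≤ 0<1) (<⇒≤ 0<1)

        roots-bound : ∀ {u v} → 0# ≤ u → 0# ≤ v → u * u ≈ fromℕ m → v * v ≈ fromℕ n → u * v ≤ N * fromℕ d
        roots-bound = product-bound {m} {n} {d} {curveConstant (suc r)}
            (bound-ℕ r f P₁ P₂ degree unique₁ unique₂ on-f 2≤m 2≤n)

        zero-bound : ∀ {x} → x ≈ 0# → x ≤ N * fromℕ d * (1# + 1#)
        zero-bound x≈0 = ≤-respˡ (sym x≈0) (*-nonneg nonneg-bound 0≤2)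

      many-points : proj₁ scale * (root 2 (fromℕ m) * root 2 (fromℕ n) * root 2 (log (fromℕ n)) ⁻¹) ≤ fromℕ d
      many-points = scaled {d = d} (cases (root₂-cases (fromℕ m)) (root₂-cases (fromℕ n)))
        where
        cases : ∀ {u v} → (0# ≤ u × u * u ≈ fromℕ m) ⊎ u ≈ 0# → (0# ≤ v × v * v ≈ fromℕ n) ⊎ v ≈ 0# →
                u * v * root 2 (log (fromℕ n)) ⁻¹ ≤ N * fromℕ d * (1# + 1#)
        cases (inj₂ u≈0) _ = zero-bound (trans (*-congʳ (trans (*-congʳ u≈0) (zeroˡ _))) (zeroˡ _))
        cases (inj₁ _) (inj₂ v≈0) = zero-bound (trans (*-congʳ (trans (*-congˡ v≈0) (zeroʳ _))) (zeroˡ _))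
        cases (inj₁ (0≤u , u²≈m)) (inj₁ (0≤v , v²≈n)) =
          *-mono-≤ (*-nonneg 0≤u 0≤v) 0≤2 (roots-bound 0≤u 0≤v u²≈m v²≈n) (inverse-root-log≤2 2≤n)

      few-points : proj₁ scale * (root 3 (fromℕ m) * root 2 (fromℕ n)) ≤ fromℕ d
      few-points = scaled {d = d} (cases (the-cases (λ y → 0# ≤ y × y ^ 3 ≈ fromℕ m)) (root₂-cases (fromℕ n))
          (sqrt (fromℕ m) (fromℕ-nonneg m)))
        where
        cases : ∀ {a v} → (0# ≤ a × a ^ 3 ≈ fromℕ m) ⊎ a ≈ 0# → (0# ≤ v × v * v ≈ fromℕ n) ⊎ v ≈ 0# →
                (∃[ u ] 0# ≤ u × u * u ≈ fromℕ m) → a * v ≤ N * fromℕ d * (1# + 1#)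
        cases (inj₂ a≈0) _ _ = zero-bound (trans (*-congʳ a≈0) (zeroˡ _))
        cases (inj₁ _) (inj₂ v≈0) _ = zero-bound (trans (*-congˡ v≈0) (zeroʳ _))
        cases {a} {v} (inj₁ (_ , a³≈m)) (inj₁ (0≤v , v²≈n)) (u , 0≤u , u²≈m) = begin
          a * v                      ≤⟨ *-monoˡ-≤ 0≤v (cube-root≤square-root (1≤fromℕ (ℕ.<⇒≤ 2≤m)) 0≤u u²≈m a³≈m) ⟩
          u * v                      ≤⟨ roots-bound 0≤u 0≤v u²≈m v²≈n ⟩
          N * fromℕ d                ≈⟨ +-identityʳ _ ⟨
          N * fromℕ d + 0#           ≤⟨ +-monoʳ-≤ (N * fromℕ d) nonneg-bound ⟩
          N * fromℕ d + N * fromℕ d  ≈⟨ solve 1 (λ x → x :+ x := x :* (con (+ 1) :+ con (+ 1))) refl (N * fromℕ d) ⟩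
          N * fromℕ d * (1# + 1#)    ∎

theorem1p1 :
    (em : ∀ {ℓ} → ExcludedMiddle ℓ) (ℝ : RealField) →
    let open RealPlane em ℝ in
    (r : ℕ) (C : Carrier) → 0# < C →
    (∃[ c ] 0# < c ×
      (∀ (f : Polynomial) (P₁ P₂ : List Point) →
       HasDegree f r → Unique P₁ → Unique P₂ → All (V f) P₁ →
       let m = length P₁
           n = length P₂
           m′ = fromℕ m
           n′ = fromℕ n in
       2 ℕ.≤ m → 2 ℕ.≤ n →
       C * (root 2 n′ * root 3 (log n′) ⁻¹) ≤ m′ →
       c * (root 2 m′ * root 2 n′ * root 2 (log n′) ⁻¹) ≤ fromℕ (D P₁ P₂)))
    ×
    (∃[ c ] 0# < c ×
      (∀ (f : Polynomial) (P₁ P₂ : List Point) →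
       HasDegree f r → Unique P₁ → Unique P₂ → All (V f) P₁ →
       let m = length P₁
           n = length P₂
           m′ = fromℕ m
           n′ = fromℕ n in
       2 ℕ.≤ m → 2 ℕ.≤ n →
       m′ ≤ C * (root 2 n′ * root 3 (log n′) ⁻¹) →
       c * (root 3 m′ * root 2 n′) ≤ fromℕ (D P₁ P₂)))
theorem1p1 em ℝ r C 0<C =
  (proj₁ scale′ , proj₁ (proj₂ scale′) , λ f P₁ P₂ degree unique₁ unique₂ on-f 2≤m 2≤n _ →
    many-points r f P₁ P₂ degree unique₁ unique₂ on-f 2≤m 2≤n) ,
  (proj₁ scale′ , proj₁ (proj₂ scale′) , λ f P₁ P₂ degree unique₁ unique₂ on-f 2≤m 2≤n _ →
    few-points r f P₁ P₂ degree unique₁ unique₂ on-f 2≤m 2≤n)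
  where
  open DistinctDistances em ℝ
  scale′ = scale r
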